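{- For all integers $k \geq 3$, $c_{K_k} \geq \frac{1}{9k^{10}}$.
   Context: All graphs are finite, undirected and simple. For a fixed graph $H$ and a graph $G$, the $H$-packing number $\nu_H(G)$ is the maximum number of pairwise edge-disjoint copies of $H$ in $G$. $K_k$ denotes the complete graph on $k$ vertices, $e(G)$ the number of edges of $G$, and $\delta(G)$ the minimum degree of $G$. For a fixed graph $H$, $c_H$ is defined as the supremum of all constants $c$ guaranteeing that every graph $G$ with $n$ vertices and $\delta(G) \geq (1-c)(n-1)$ has $\nu_H(G) \geq (1-o_n(1))\, e(G)/e(H)$; that is, the supremum of all $c$ such that for every $\varepsilon>0$ there is $n_0$ such that every graph $G$ on $n \ge n_0$ vertices with $\delta(G)\ge (1-c)(n-1)$ satisfies $\nu_H(G) \ge (1-\varepsilon)e(G)/e(H)$. -}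

module Defs where

open import Data.Nat as ℕ using (ℕ; zero; suc; _<ᵇ_)
open import Data.Bool using (Bool; true; false; if_then_else_; _∧_)
open import Data.Fin using (Fin; toℕ)
open import Data.List using (List; map; allFin)
open import Data.Nat.ListAction using (sum)
open import Data.Integer using (+_)
open import Data.Rational using (ℚ; _/_)
open import Data.Product using (Σ; _×_)
open import Data.Empty using (⊥)
open import Relation.Binary.PropositionalEquality using (_≡_)
open import Relation.Nullary using (¬_)

record Graph (n : ℕ) : Set where
  field
    adj    : Fin n → Fin n → Bool
    sym    : ∀ i j → adj i j ≡ adj j i
    irrefl : ∀ i → adj i i ≡ false
open Graph public

count : ∀ {n} → (Fin n → Bool) → ℕ
count {n} f = sum (map (λ i → if f i then 1 else 0) (allFin n))

deg : ∀ {n} → Graph n → Fin n → ℕ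
deg G v = count (adj G v)

edges : ∀ {n} → Graph n → ℕ
edges {n} G = sum (map (λ i → count (λ j → (toℕ i <ᵇ toℕ j) ∧ adj G i j)) (allFin n))

ℕ→ℚ : ℕ → ℚ
ℕ→ℚ m = (+ m) / 1

IsKkCopy : ∀ {n} (k : ℕ) → Graph n → (Fin k → Fin n) → Set
IsKkCopy k G f =
  (∀ i j → f i ≡ f j → i ≡ j) × (∀ i j → ¬ (i ≡ j) → adj G (f i) (f j) ≡ true)

IsKkPacking : ∀ {n} (k m : ℕ) → Graph n → (Fin m → Fin k → Fin n) → Set
IsKkPacking k m G P =
  (∀ a → IsKkCopy k G (P a)) ×
  (∀ a b → ¬ (a ≡ b) → ∀ i j i′ j′ → ¬ (i ≡ j) →
     P a i ≡ P b i′ → P a j ≡ P b j′ → ⊥)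

HasKkPacking : ∀ {n} (k m : ℕ) → Graph n → Set
HasKkPacking {n} k m G = Σ (Fin m → Fin k → Fin n) (IsKkPacking k m G)

{-# OPTIONS --safe #-}
module Submission where

-- Two ingredients. First, G has a fractional K_k-decomposition with weights O(n^(2-k)): start with the uniform
-- weighting of the k-cliques, which misses 1 at every edge by a relative O(k^2 / k^10), and repair each edge with
-- signed gadgets supported on the (k+2)-cliques through it, which change the total weight of no other edge.
--
-- Second, a hypergraph with edge weights of total 1 at every vertex and small codegrees has a nearly perfect
-- matching. Here the vertices are the edges of G and the edges are its k-cliques. In each step of a random greedy
-- process either an edge K inside the set U of remaining vertices is matched, with probability proportional to its
-- weight, or a single vertex is thrown away, with probabilities equalised so that every vertex of U disappears with
-- the same probability. Thus P(A ⊆ U) is almost β^|A| for bounded sets A, so by a second moment computation the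
-- weight at a typical vertex of U is close to its mean β^(r-1), and few vertices are wasted.

open import Defs renaming (sym to adj-sym; irrefl to adj-irrefl)
open import Data.Nat as ℕ using (ℕ; zero; suc)
import Data.Nat.Properties as ℕₚ
import Data.Integer as ℤ
import Data.Integer.Properties as ℤₚ
open import Data.Rational using (ℚ; _<_; _≤_; 0ℚ; 1ℚ; 1/_)
import Data.Rational as ℚ
import Data.Rational.Properties as ℚₚ
open ℚₚ using (≤-refl; ≤-trans; ≤-reflexive)
open import Data.Bool using (Bool; true; false; if_then_else_; _∧_; _∨_; not)
import Data.Bool.Properties as Boolₚ
open import Data.List using (List; []; _∷_; _++_; length; map; filter; concatMap; allFin; _ʳ++_; cartesianProduct; lookup)
import Data.List.Properties as Listₚ
open import Data.List.Membership.Propositional using (_∈_; _∉_)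
open import Data.List.Membership.Propositional.Properties using (∈-map⁺; ∈-map⁻; ∈-++⁺ˡ; ∈-++⁺ʳ; ∈-++⁻; ∈-filter⁻; ∈-filter⁺; ∈-allFin; ∈-cartesianProduct⁺; ∈-lookup)
open import Data.List.Relation.Unary.Any using (here; there)
open import Data.List.Relation.Unary.All using (All; []; _∷_)
import Data.List.Relation.Unary.All as All
open import Data.List.Relation.Unary.Unique.Propositional using (Unique)
import Data.List.Relation.Unary.Unique.Propositional.Properties as Uniqueₚ
open import Data.List.Relation.Unary.AllPairs using (AllPairs; []; _∷_)
open import Data.Product using (Σ; ∃; _×_; _,_; proj₁; proj₂)
open import Data.Sum using (_⊎_; inj₁; inj₂)
open import Data.Empty using (⊥; ⊥-elim)
open import Function using (_∘_; case_of_)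
open import Relation.Nullary using (¬_; Dec; yes; no; ⌊_⌋)
open import Relation.Binary.Definitions using (DecidableEquality; tri<; tri≈; tri>)
open import Relation.Binary.PropositionalEquality using (_≡_; _≢_; refl; sym; trans; cong; cong₂; subst; module ≡-Reasoning)
open import Tactic.RingSolver using (solve-∀)
import Data.Rational.Unnormalised as ℚᵘ
import Data.Rational.Unnormalised.Properties as ℚᵘₚ
open import Relation.Nullary.Decidable using (dec⇒maybe; ¬?)
open import Tactic.RingSolver.Core.AlmostCommutativeRing using (AlmostCommutativeRing; fromCommutativeRing)
open import Data.List.Relation.Binary.Permutation.Propositional using (_↭_; ↭-sym; ↭-trans; ↭-refl)
import Data.List.Relation.Binary.Permutation.Propositional as Perm
import Data.List.Relation.Binary.Permutation.Propositional.Properties as Permₚ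
open import Data.Fin using (Fin; toℕ)
import Data.Fin.Properties as Finₚ
open import Data.Nat.Combinatorics using (_C_; nCk+nC[k+1]≡[n+1]C[k+1]; nC1≡n)
import Data.Fin as Fin
import Data.Product.Properties as Productₚ
import Data.Bool as Bool
open import Data.Nat.ListAction using (sum)
import Data.Nat.Tactic.RingSolver as ℕSolver

-- No probability space is built. A random step is a linear operator on rational functions of the
-- state, and the one principle behind it is that some reachable valid state is at least as good as
-- the expectation; even positivity of the expectation is deduced from it. All estimates are thus
-- finite sums of rationals.
--
-- Equalising the disappearance rates keeps the analysis short: while a set A is still contained in
-- U, it is hit in the next step with probability exactly |A| h minus an overcount of edges meeting
-- A twice. So concentration along the process is never studied; availability probabilities of sets
-- of at most 2r - 1 vertices suffice: r vertices for the mean and 2r - 1 for the second moment of a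
-- degree inside U.
--
-- Cliques are ordered tuples, each k-clique occurring k! times. Invariance under permutations then
-- takes the place of binomial coefficients, and k (k - 1) counts the places of an edge in a
-- k-tuple.
--
-- The size of c is dictated by nonnegativity of the repaired weights: with m = k - 2, the negative
-- parts of the gadgets amount to at most 2 m² k (k + 2) ς times the uniform weight, where ς n
-- bounds the number of non-neighbours of a vertex.

module Arithmetic where

  -- Ordered-field arithmetic of the rationals, powers and naturals as rationals.

  ℚ-ring : AlmostCommutativeRing _ _
  ℚ-ring = fromCommutativeRing ℚₚ.+-*-commutativeRing (λ x → dec⇒maybe (0ℚ ℚ.≟ x))

  infixl 6 _+_ _-_
  infixl 7 _*_

  -- Opaque copies of the operations of ℚ, so that the unifier treats them as injective.
  opaque
    _+_ _*_ _-_ : ℚ → ℚ → ℚ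
    _+_ = ℚ._+_
    _*_ = ℚ._*_
    _-_ = ℚ._-_

  opaque
    unfolding _+_

    +-comm : ∀ a b → a + b ≡ b + a
    +-comm = ℚₚ.+-comm

    +-assoc : ∀ a b c → a + b + c ≡ a + (b + c)
    +-assoc = ℚₚ.+-assoc

    +-identityˡ : ∀ a → 0ℚ + a ≡ a
    +-identityˡ = ℚₚ.+-identityˡ

    +-identityʳ : ∀ a → a + 0ℚ ≡ a
    +-identityʳ = ℚₚ.+-identityʳ

    +-inverseʳ : ∀ a → a - a ≡ 0ℚ
    +-inverseʳ = ℚₚ.+-inverseʳ

    *-comm : ∀ a b → a * b ≡ b * a
    *-comm = ℚₚ.*-comm

    *-assoc : ∀ a b c → a * b * c ≡ a * (b * c)
    *-assoc = ℚₚ.*-assoc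

    *-identityˡ : ∀ a → 1ℚ * a ≡ a
    *-identityˡ = ℚₚ.*-identityˡ

    *-identityʳ : ∀ a → a * 1ℚ ≡ a
    *-identityʳ = ℚₚ.*-identityʳ

    *-zeroˡ : ∀ a → 0ℚ * a ≡ 0ℚ
    *-zeroˡ = ℚₚ.*-zeroˡ

    *-zeroʳ : ∀ a → a * 0ℚ ≡ 0ℚ
    *-zeroʳ = ℚₚ.*-zeroʳ

    *-distribˡ-+ : ∀ a b c → a * (b + c) ≡ a * b + a * c
    *-distribˡ-+ = ℚₚ.*-distribˡ-+

    *-distribʳ-+ : ∀ a b c → (b + c) * a ≡ b * a + c * a
    *-distribʳ-+ = ℚₚ.*-distribʳ-+

    +-mono-≤ : ∀ {a b c d} → a ≤ b → c ≤ d → a + c ≤ b + d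
    +-mono-≤ = ℚₚ.+-mono-≤

    sub-mono : ∀ {a a′ b b′} → a ≤ a′ → b ≤ b′ → a - b′ ≤ a′ - b
    sub-mono p q = ℚₚ.+-mono-≤ p (ℚₚ.neg-antimono-≤ q)

    *-monoˡ : ∀ {a b c} → 0ℚ ≤ a → b ≤ c → a * b ≤ a * c
    *-monoˡ {a} 0≤a b≤c = ℚₚ.*-monoˡ-≤-nonNeg a {{ℚ.nonNegative 0≤a}} b≤c

    *-monoʳ : ∀ {a b c} → 0ℚ ≤ a → b ≤ c → b * a ≤ c * a
    *-monoʳ {a} 0≤a b≤c = ℚₚ.*-monoʳ-≤-nonNeg a {{ℚ.nonNegative 0≤a}} b≤c

    *-pos : ∀ {a b} → 0ℚ < a → 0ℚ < b → 0ℚ < a * b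
    *-pos {a} {b} p q = ℚₚ.≤-<-trans (≤-reflexive (sym (ℚₚ.*-zeroʳ a)))
      (ℚₚ.*-monoʳ-<-pos a {{ℚ.positive p}} q)

    *-cancelˡ : ∀ {a b c} → 0ℚ < a → a * b ≤ a * c → b ≤ c
    *-cancelˡ {a} 0<a = ℚₚ.*-cancelˡ-≤-pos a {{ℚ.positive 0<a}}

    -- inv 0ℚ is 0ℚ.
    inv : ℚ → ℚ
    inv p with p ℚ.≟ 0ℚ
    ... | yes _ = 0ℚ
    ... | no p≢0 = 1/_ p {{ℚ.≢-nonZero p≢0}}

    *-inv : ∀ {p} → 0ℚ < p → p * inv p ≡ 1ℚ
    *-inv {p} 0<p with p ℚ.≟ 0ℚ
    ... | yes refl = ⊥-elim (ℚₚ.<-irrefl refl 0<p)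
    ... | no p≢0 = ℚₚ.*-inverseʳ p {{ℚ.≢-nonZero p≢0}}

  infix 4 _≤ᵇ_

  opaque
    _≤ᵇ_ : ℚ → ℚ → Bool
    a ≤ᵇ b = ⌊ a ℚ.≤? b ⌋

    ≤ᵇ-true : ∀ {a b} → (a ≤ᵇ b) ≡ true → a ≤ b
    ≤ᵇ-true {a} {b} e with a ℚ.≤? b
    ... | yes a≤b = a≤b

    ≤ᵇ-false : ∀ {a b} → (a ≤ᵇ b) ≡ false → b < a
    ≤ᵇ-false {a} {b} e with a ℚ.≤? b
    ... | no a≰b = ℚₚ.≰⇒> a≰b

  +-monoʳ-≤ : ∀ a {b c} → b ≤ c → a + b ≤ a + c
  +-monoʳ-≤ a = +-mono-≤ (≤-refl {a})

  +-monoˡ-≤ : ∀ a {b c} → b ≤ c → b + a ≤ c + a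
  +-monoˡ-≤ a h = +-mono-≤ h (≤-refl {a})

  0≤1 : 0ℚ ≤ 1ℚ
  0≤1 = ℚₚ.nonNegative⁻¹ 1ℚ

  0<1 : 0ℚ < 1ℚ
  0<1 = ℚₚ.positive⁻¹ 1ℚ

  ≤-resp : ∀ {a a′ b b′} → a ≡ a′ → b ≡ b′ → a ≤ b → a′ ≤ b′
  ≤-resp refl refl p = p

  +-nonneg : ∀ {a b} → 0ℚ ≤ a → 0ℚ ≤ b → 0ℚ ≤ a + b
  +-nonneg p q = ≤-resp (+-identityˡ 0ℚ) refl (+-mono-≤ p q)

  *-mono : ∀ {a a′ b b′} → 0ℚ ≤ a → 0ℚ ≤ b′ → a ≤ a′ → b ≤ b′ → a * b ≤ a′ * b′
  *-mono 0≤a 0≤b′ p q = ≤-trans (*-monoˡ 0≤a q) (*-monoʳ 0≤b′ p)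

  *-nonneg : ∀ {a b} → 0ℚ ≤ a → 0ℚ ≤ b → 0ℚ ≤ a * b
  *-nonneg {a} p q = ≤-resp (*-zeroʳ a) refl (*-monoˡ p q)

  private
    opaque
      unfolding _+_
      sub-eq : ∀ a b → b ≡ a + (b - a)
      sub-eq = solve-∀ ℚ-ring

  -- Most polynomial inequalities below are proved by exhibiting the nonnegative slack `s`; what
  -- remains is an identity for the ring solver.
  ≤-cert : ∀ {a b s} → 0ℚ ≤ s → b ≡ a + s → a ≤ b
  ≤-cert {a} 0≤s refl = ≤-resp (+-identityʳ a) refl (+-monoʳ-≤ a 0≤s)

  sub-nonneg : ∀ {a b} → a ≤ b → 0ℚ ≤ b - a
  sub-nonneg {a} p = ≤-resp (+-inverseʳ a) refl (sub-mono p ≤-refl)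

  nonneg-sub : ∀ {a b} → 0ℚ ≤ b - a → a ≤ b
  nonneg-sub {a} {b} p = ≤-cert p (sub-eq a b)

  ≤-+ʳ : ∀ {a b} → 0ℚ ≤ b → a ≤ a + b
  ≤-+ʳ p = ≤-cert p refl

  sub-≤ : ∀ {a b} → 0ℚ ≤ b → a - b ≤ a
  sub-≤ {a} {b} p = ≤-cert p (eq a b)
    where
    opaque
      unfolding _+_
      eq : ∀ a b → a ≡ a - b + b
      eq = solve-∀ ℚ-ring

  square-nonneg : ∀ a → 0ℚ ≤ a * a
  square-nonneg a with ℚₚ.≤-total 0ℚ a
  ... | inj₁ p = *-nonneg p p
  ... | inj₂ p = ≤-resp refl (eq a) (*-nonneg (sub-nonneg p) (sub-nonneg p))
    where
    opaque
      unfolding _+_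
      eq : ∀ a → (0ℚ - a) * (0ℚ - a) ≡ a * a
      eq = solve-∀ ℚ-ring

  inv-nonneg : ∀ {p} → 0ℚ < p → 0ℚ ≤ inv p
  inv-nonneg {p} 0<p = *-cancelˡ 0<p
    (≤-resp (sym (*-zeroʳ p)) (sym (*-inv 0<p)) 0≤1)

  inv-pos : ∀ {p} → 0ℚ < p → 0ℚ < inv p
  inv-pos {p} 0<p with ℚₚ.<-cmp 0ℚ (inv p)
  ... | tri< a _ _ = a
  ... | tri≈ _ b _ = ⊥-elim (ℚₚ.<-irrefl
    (trans (sym (*-zeroʳ p)) (trans (cong (p *_) b) (*-inv 0<p))) 0<1)
  ... | tri> _ _ c = ⊥-elim (ℚₚ.<-irrefl refl (ℚₚ.<-≤-trans c (inv-nonneg 0<p)))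

  inv-≤ : ∀ {p c} → 0ℚ < p → 1ℚ ≤ p * c → inv p ≤ c
  inv-≤ {p} 0<p h = *-cancelˡ 0<p (≤-resp (sym (*-inv 0<p)) refl h)

  infixr 8 _↑_
  _↑_ : ℚ → ℕ → ℚ
  p ↑ zero = 1ℚ
  p ↑ suc n = p * p ↑ n

  ^-nonneg : ∀ {p} n → 0ℚ ≤ p → 0ℚ ≤ p ↑ n
  ^-nonneg zero _ = 0≤1
  ^-nonneg (suc n) h = *-nonneg h (^-nonneg n h)

  ^-pos : ∀ {p} n → 0ℚ < p → 0ℚ < p ↑ n
  ^-pos zero _ = 0<1
  ^-pos (suc n) h = *-pos h (^-pos n h)

  ^-+ : ∀ p m n → p ↑ (m ℕ.+ n) ≡ p ↑ m * p ↑ n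
  ^-+ p zero n = sym (*-identityˡ _)
  ^-+ p (suc m) n = trans (cong (p *_) (^-+ p m n)) (sym (*-assoc p _ _))

  ^-* : ∀ p q n → (p * q) ↑ n ≡ p ↑ n * q ↑ n
  ^-* p q zero = sym (*-identityˡ 1ℚ)
  ^-* p q (suc n) = trans (cong ((p * q) *_) (^-* p q n)) (eq p q _ _)
    where
    opaque
      unfolding _+_
      eq : ∀ p q a b → p * q * (a * b) ≡ p * a * (q * b)
      eq = solve-∀ ℚ-ring

  ^-mono : ∀ {p q} n → 0ℚ ≤ p → p ≤ q → p ↑ n ≤ q ↑ n
  ^-mono zero _ _ = ≤-refl
  ^-mono (suc n) 0≤p p≤q = *-mono 0≤p (^-nonneg n (≤-trans 0≤p p≤q)) p≤q (^-mono n 0≤p p≤q)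

  1^ : ∀ n → 1ℚ ↑ n ≡ 1ℚ
  1^ zero = refl
  1^ (suc n) = trans (*-identityˡ _) (1^ n)

  ^-≤1 : ∀ {p} n → 0ℚ ≤ p → p ≤ 1ℚ → p ↑ n ≤ 1ℚ
  ^-≤1 n h p≤1 = ≤-resp refl (1^ n) (^-mono n h p≤1)

  private
    fromℕ-ᵘ : ∀ m → ℚ.toℚᵘ (ℕ→ℚ m) ℚᵘ.≃ ℚᵘ.mkℚᵘ (ℤ.+ m) 0
    fromℕ-ᵘ m = ℚₚ.toℚᵘ-fromℚᵘ (ℚᵘ.mkℚᵘ (ℤ.+ m) 0)

    +ᵘ : ∀ m n → ℚᵘ.mkℚᵘ (ℤ.+ (m ℕ.+ n)) 0 ℚᵘ.≃ ℚᵘ.mkℚᵘ (ℤ.+ m) 0 ℚᵘ.+ ℚᵘ.mkℚᵘ (ℤ.+ n) 0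
    +ᵘ m n = ℚᵘ.*≡* (cong (ℤ._* ℤ.+ 1) (trans (ℤₚ.pos-+ m n)
      (sym (cong₂ ℤ._+_ (ℤₚ.*-identityʳ (ℤ.+ m)) (ℤₚ.*-identityʳ (ℤ.+ n))))))

    *ᵘ : ∀ m n → ℚᵘ.mkℚᵘ (ℤ.+ (m ℕ.* n)) 0 ℚᵘ.≃ ℚᵘ.mkℚᵘ (ℤ.+ m) 0 ℚᵘ.* ℚᵘ.mkℚᵘ (ℤ.+ n) 0
    *ᵘ m n = ℚᵘ.*≡* (cong (ℤ._* ℤ.+ 1) (ℤₚ.pos-* m n))

  -- Opaque for the same reason.
  opaque
    unfolding _+_

    ♯ : ℕ → ℚ
    ♯ = ℕ→ℚ

    ♯-0 : ♯ 0 ≡ 0ℚ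
    ♯-0 = refl

    ♯-1 : ♯ 1 ≡ 1ℚ
    ♯-1 = refl

    ♯-+ : ∀ m n → ♯ (m ℕ.+ n) ≡ ♯ m + ♯ n
    ♯-+ m n = ℚₚ.toℚᵘ-injective (ℚᵘₚ.≃-trans (fromℕ-ᵘ (m ℕ.+ n)) (ℚᵘₚ.≃-trans (+ᵘ m n)
      (ℚᵘₚ.≃-sym (ℚᵘₚ.≃-trans (ℚₚ.toℚᵘ-homo-+ (♯ m) (♯ n))
        (ℚᵘₚ.+-cong (fromℕ-ᵘ m) (fromℕ-ᵘ n))))))

    ♯-* : ∀ m n → ♯ (m ℕ.* n) ≡ ♯ m * ♯ n
    ♯-* m n = ℚₚ.toℚᵘ-injective (ℚᵘₚ.≃-trans (fromℕ-ᵘ (m ℕ.* n)) (ℚᵘₚ.≃-trans (*ᵘ m n)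
      (ℚᵘₚ.≃-sym (ℚᵘₚ.≃-trans (ℚₚ.toℚᵘ-homo-* (♯ m) (♯ n))
        (ℚᵘₚ.*-cong (fromℕ-ᵘ m) (fromℕ-ᵘ n))))))

  ♯-suc : ∀ n → ♯ (suc n) ≡ 1ℚ + ♯ n
  ♯-suc n = trans (♯-+ 1 n) (cong (_+ ♯ n) ♯-1)

  ♯-nonneg : ∀ n → 0ℚ ≤ ♯ n
  ♯-nonneg zero = ≤-reflexive (sym ♯-0)
  ♯-nonneg (suc n) = ≤-resp refl (sym (♯-suc n)) (+-nonneg 0≤1 (♯-nonneg n))

  ♯-mono : ∀ {m n} → m ℕ.≤ n → ♯ m ≤ ♯ n
  ♯-mono {m} {n} m≤n = ≤-cert (♯-nonneg (n ℕ.∸ m))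
    (trans (cong ♯ (sym (ℕₚ.m+[n∸m]≡n m≤n))) (♯-+ m (n ℕ.∸ m)))

  ♯-pos : ∀ n → 0ℚ < ♯ (suc n)
  ♯-pos n = ℚₚ.<-≤-trans 0<1 (≤-resp ♯-1 refl (♯-mono (ℕ.s≤s ℕ.z≤n)))

  opaque
    unfolding ♯

    -- The absolute value of the numerator works, as the denominator is at least 1.
    archimedean : ∀ x → ∃ λ n → x ≤ ♯ n
    archimedean x@record{} = ℤ.∣ ℚ.↥ x ∣ , ℚₚ.toℚᵘ-cancel-≤ (ℚᵘₚ.≤-respʳ-≃ (ℚᵘₚ.≃-sym (fromℕ-ᵘ ℤ.∣ ℚ.↥ x ∣))
      (ℚᵘ.*≤* (ℤₚ.≤-trans (ℤₚ.≤-reflexive (ℤₚ.*-identityʳ (ℚ.↥ x))) (ℤₚ.≤-trans (i≤∣i∣ (ℚ.↥ x))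
        (ℤₚ.≤-trans (ℤ.+≤+ (ℕₚ.m≤m*n ℤ.∣ ℚ.↥ x ∣ (ℚ.↧ₙ x))) (ℤₚ.≤-reflexive (ℤₚ.pos-* ℤ.∣ ℚ.↥ x ∣ (ℚ.↧ₙ x))))))))
      where
      i≤∣i∣ : ∀ i → i ℤ.≤ ℤ.+ ℤ.∣ i ∣
      i≤∣i∣ (ℤ.+ n) = ℤₚ.≤-refl
      i≤∣i∣ ℤ.-[1+ n ] = ℤ.-≤+

  -- Indicators and finite sums over lists.

  𝟙 : Bool → ℚ
  𝟙 true = 1ℚ
  𝟙 false = 0ℚ

  𝟙-nonneg : ∀ b → 0ℚ ≤ 𝟙 b
  𝟙-nonneg true = 0≤1
  𝟙-nonneg false = ≤-refl

  𝟙-≤1 : ∀ b → 𝟙 b ≤ 1ℚ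
  𝟙-≤1 true = ≤-refl
  𝟙-≤1 false = 0≤1

  𝟙-∧ : ∀ a b → 𝟙 (a ∧ b) ≡ 𝟙 a * 𝟙 b
  𝟙-∧ true b = sym (*-identityˡ _)
  𝟙-∧ false b = sym (*-zeroˡ (𝟙 b))

  𝟙-not : ∀ b → 𝟙 (not b) ≡ 1ℚ - 𝟙 b
  𝟙-not true = sym (+-inverseʳ 1ℚ)
  𝟙-not false = eq
    where
    opaque
      unfolding _+_
      eq : 1ℚ ≡ 1ℚ - 0ℚ
      eq = solve-∀ ℚ-ring

  private
    variable
      A B : Set

  ∑ : List A → (A → ℚ) → ℚ
  ∑ [] f = 0ℚ
  ∑ (x ∷ xs) f = f x + ∑ xs f

  ∑-cong∈ : ∀ (L : List A) {f g} → (∀ x → x ∈ L → f x ≡ g x) → ∑ L f ≡ ∑ L g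
  ∑-cong∈ [] h = refl
  ∑-cong∈ (x ∷ L) h = cong₂ _+_ (h x (here refl)) (∑-cong∈ L (λ y y∈ → h y (there y∈)))

  ∑-cong : ∀ (L : List A) {f g} → (∀ x → f x ≡ g x) → ∑ L f ≡ ∑ L g
  ∑-cong L h = ∑-cong∈ L (λ x _ → h x)

  ∑-mono∈ : ∀ (L : List A) {f g} → (∀ x → x ∈ L → f x ≤ g x) → ∑ L f ≤ ∑ L g
  ∑-mono∈ [] h = ≤-refl
  ∑-mono∈ (x ∷ L) h = +-mono-≤ (h x (here refl)) (∑-mono∈ L (λ y y∈ → h y (there y∈)))

  ∑-mono : ∀ (L : List A) {f g} → (∀ x → f x ≤ g x) → ∑ L f ≤ ∑ L g
  ∑-mono L h = ∑-mono∈ L (λ x _ → h x)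

  ∑-0 : ∀ (L : List A) → ∑ L (λ _ → 0ℚ) ≡ 0ℚ
  ∑-0 [] = refl
  ∑-0 (x ∷ L) = trans (+-identityˡ _) (∑-0 L)

  ∑-nonneg : ∀ (L : List A) {f} → (∀ x → 0ℚ ≤ f x) → 0ℚ ≤ ∑ L f
  ∑-nonneg L h = ≤-resp (∑-0 L) refl (∑-mono L h)

  private
    opaque
      unfolding _+_
      swap4 : ∀ a b c d → a + b + (c + d) ≡ a + c + (b + d)
      swap4 = solve-∀ ℚ-ring

  ∑-+ : ∀ (L : List A) f g → ∑ L (λ x → f x + g x) ≡ ∑ L f + ∑ L g
  ∑-+ [] f g = sym (+-identityˡ 0ℚ)
  ∑-+ (x ∷ L) f g = trans (cong ((f x + g x) +_) (∑-+ L f g)) (swap4 (f x) (g x) _ _)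

  ∑-*ˡ : ∀ c (L : List A) f → ∑ L (λ x → c * f x) ≡ c * ∑ L f
  ∑-*ˡ c [] f = sym (*-zeroʳ c)
  ∑-*ˡ c (x ∷ L) f = trans (cong (c * f x +_) (∑-*ˡ c L f)) (sym (*-distribˡ-+ c _ _))

  ∑-*ʳ : ∀ c (L : List A) f → ∑ L (λ x → f x * c) ≡ ∑ L f * c
  ∑-*ʳ c L f = trans (∑-cong L (λ x → *-comm (f x) c)) (trans (∑-*ˡ c L f) (*-comm c _))

  ∑-sub : ∀ (L : List A) f g → ∑ L (λ x → f x - g x) ≡ ∑ L f - ∑ L g
  ∑-sub [] f g = sym (+-inverseʳ 0ℚ)
  ∑-sub (x ∷ L) f g = trans (cong ((f x - g x) +_) (∑-sub L f g)) (eq (f x) (g x) _ _)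
    where
    opaque
      unfolding _+_
      eq : ∀ a b c d → a - b + (c - d) ≡ a + c - (b + d)
      eq = solve-∀ ℚ-ring

  ∑-swap : ∀ (L : List A) (M : List B) (f : A → B → ℚ) →
    ∑ L (λ x → ∑ M (f x)) ≡ ∑ M (λ y → ∑ L (λ x → f x y))
  ∑-swap [] M f = sym (∑-0 M)
  ∑-swap (x ∷ L) M f = trans (cong (∑ M (f x) +_) (∑-swap L M f)) (sym (∑-+ M (f x) _))

  ∑-const : ∀ (L : List A) c → ∑ L (λ _ → c) ≡ ♯ (length L) * c
  ∑-const [] c = sym (trans (cong (_* c) ♯-0) (*-zeroˡ c))
  ∑-const (x ∷ L) c = trans (cong (c +_) (∑-const L c))
    (trans (eq c (♯ (length L))) (cong (_* c) (sym (♯-suc (length L)))))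
    where
    opaque
      unfolding _+_
      eq : ∀ c n → c + n * c ≡ (1ℚ + n) * c
      eq = solve-∀ ℚ-ring

  ∑-++ : ∀ (L M : List A) f → ∑ (L ++ M) f ≡ ∑ L f + ∑ M f
  ∑-++ [] M f = sym (+-identityˡ _)
  ∑-++ (x ∷ L) M f = trans (cong (f x +_) (∑-++ L M f)) (sym (+-assoc (f x) _ _))

  ∑-map : ∀ (g : B → A) (L : List B) f → ∑ (map g L) f ≡ ∑ L (λ x → f (g x))
  ∑-map g [] f = refl
  ∑-map g (x ∷ L) f = cong (f (g x) +_) (∑-map g L f)

  ∑-∈-≤ : ∀ {L : List A} {f x} → (∀ y → 0ℚ ≤ f y) → x ∈ L → f x ≤ ∑ L f
  ∑-∈-≤ {L = _ ∷ L} h (here refl) = ≤-+ʳ (∑-nonneg L h)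
  ∑-∈-≤ {L = y ∷ L} {f} h (there x∈) = ≤-trans (∑-∈-≤ h x∈)
    (≤-cert (h y) (+-comm (f y) _))

-- Weighted uniform hypergraphs and the random greedy process on them.

module RandomGreedy where

  open Arithmetic

  private
    variable
      A : Set

  argmax : (f : A → ℚ) (a : A) (L : List A) → Σ A λ b → f a ≤ f b × (∀ y → y ∈ L → f y ≤ f b)
  argmax f a [] = a , ≤-refl , λ _ ()
  argmax f a (x ∷ L) with argmax f a L
  ... | b , a≤b , h with ℚₚ.≤-total (f x) (f b)
  ... | inj₁ x≤b = b , a≤b , λ { _ (here refl) → x≤b ; y (there y∈) → h y y∈ }
  ... | inj₂ b≤x = x , ≤-trans a≤b b≤x ,
    λ { _ (here refl) → ≤-refl ; y (there y∈) → ≤-trans (h y y∈) b≤x }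

  allᵇ : (A → Bool) → List A → Bool
  allᵇ P [] = true
  allᵇ P (x ∷ L) = P x ∧ allᵇ P L

  allᵇ-true : ∀ {P : A → Bool} {L} → (∀ x → x ∈ L → P x ≡ true) → allᵇ P L ≡ true
  allᵇ-true {L = []} h = refl
  allᵇ-true {L = x ∷ L} h rewrite h x (here refl) = allᵇ-true (λ y y∈ → h y (there y∈))

  allᵇ-false : ∀ {P : A → Bool} {x L} → x ∈ L → P x ≡ false → allᵇ P L ≡ false
  allᵇ-false {P = P} (here refl) e rewrite e = refl
  allᵇ-false {P = P} {L = y ∷ _} (there x∈) e with P y
  ... | true = allᵇ-false x∈ e
  ... | false = refl

  allᵇ-∈ : ∀ {P : A → Bool} {x L} → allᵇ P L ≡ true → x ∈ L → P x ≡ true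
  allᵇ-∈ {P = P} {x} a x∈ with P x in e
  ... | true = refl
  ... | false = case trans (sym a) (allᵇ-false x∈ e) of λ ()

  -- A union bound over the elements that fail `P`.
  𝟙-allᵇ-≥ : ∀ (P : A → Bool) L → 1ℚ - ∑ L (λ x → 𝟙 (not (P x))) ≤ 𝟙 (allᵇ P L)
  𝟙-allᵇ-≥ P [] = sub-≤ ≤-refl
  𝟙-allᵇ-≥ P (x ∷ L) with P x
  ... | true = ≤-resp (cong (λ z → 1ℚ - z) (sym (+-identityˡ _))) refl (𝟙-allᵇ-≥ P L)
  ... | false = ≤-cert (∑-nonneg L (λ y → 𝟙-nonneg (not (P y)))) (eq _)
    where
    opaque
      unfolding _+_
      eq : ∀ s → 0ℚ ≡ 1ℚ - (1ℚ + s) + s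
      eq = solve-∀ ℚ-ring

  module Membership {X : Set} (_≟_ : DecidableEquality X) where

    infix 4 _∈ᵇ_
    _∈ᵇ_ : X → List X → Bool
    x ∈ᵇ [] = false
    x ∈ᵇ (y ∷ L) = ⌊ x ≟ y ⌋ ∨ (x ∈ᵇ L)

    ∈⇒∈ᵇ : ∀ {x L} → x ∈ L → (x ∈ᵇ L) ≡ true
    ∈⇒∈ᵇ {x} {y ∷ L} x∈ with x ≟ y
    ∈⇒∈ᵇ x∈ | yes _ = refl
    ∈⇒∈ᵇ (here refl) | no x≢x = ⊥-elim (x≢x refl)
    ∈⇒∈ᵇ (there x∈) | no _ = ∈⇒∈ᵇ x∈

    ∈ᵇ⇒∈ : ∀ {x L} → (x ∈ᵇ L) ≡ true → x ∈ L
    ∈ᵇ⇒∈ {x} {y ∷ L} e with x ≟ y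
    ... | yes refl = here refl
    ... | no _ = there (∈ᵇ⇒∈ e)

    ∉⇒∈ᵇ : ∀ {x L} → x ∉ L → (x ∈ᵇ L) ≡ false
    ∉⇒∈ᵇ {x} {L} x∉ with x ∈ᵇ L in e
    ... | true = ⊥-elim (x∉ (∈ᵇ⇒∈ e))
    ... | false = refl

    ≟-sym : ∀ x y → ⌊ x ≟ y ⌋ ≡ ⌊ y ≟ x ⌋
    ≟-sym x y with x ≟ y | y ≟ x
    ... | yes _ | yes _ = refl
    ... | no _ | no _ = refl
    ... | yes refl | no n = ⊥-elim (n refl)
    ... | no n | yes refl = ⊥-elim (n refl)

    ∑-∉ : ∀ {V y} (f : X → ℚ) → y ∉ V → ∑ V (λ x → f x * 𝟙 ⌊ x ≟ y ⌋) ≡ 0ℚ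
    ∑-∉ {[]} f y∉ = refl
    ∑-∉ {x ∷ V} {y} f y∉ with x ≟ y
    ... | yes refl = ⊥-elim (y∉ (here refl))
    ... | no _ = trans (cong₂ _+_ (*-zeroʳ (f x)) (∑-∉ f (y∉ ∘ there))) (+-identityʳ 0ℚ)

    ∑-δ : ∀ {V y} (f : X → ℚ) → Unique V → y ∈ V → ∑ V (λ x → f x * 𝟙 ⌊ x ≟ y ⌋) ≡ f y
    ∑-δ {x ∷ V} {y} f (x∉ ∷ u) y∈ with x ≟ y
    ... | yes refl = trans (cong₂ _+_ (*-identityʳ (f x)) (∑-∉ f λ y∈V → All.lookup x∉ y∈V refl))
      (+-identityʳ (f x))
    ∑-δ f (x∉ ∷ u) (here refl) | no n = ⊥-elim (n refl)
    ∑-δ {x ∷ V} f (x∉ ∷ u) (there y∈) | no n = trans (cong₂ _+_ (*-zeroʳ (f x)) (∑-δ f u y∈)) (+-identityˡ _)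

    𝟙-∈ᵇ-∷ : ∀ {x y L} → y ∉ L → 𝟙 (x ∈ᵇ (y ∷ L)) ≡ 𝟙 ⌊ x ≟ y ⌋ + 𝟙 (x ∈ᵇ L)
    𝟙-∈ᵇ-∷ {x} {y} y∉ with x ≟ y
    ... | yes refl rewrite ∉⇒∈ᵇ y∉ = sym (+-identityʳ 1ℚ)
    ... | no _ = sym (+-identityˡ _)

    ∑-∈ᵇ : ∀ {V} (f : X → ℚ) L → Unique V → Unique L → (∀ x → x ∈ L → x ∈ V) →
      ∑ V (λ x → f x * 𝟙 (x ∈ᵇ L)) ≡ ∑ L f
    ∑-∈ᵇ {V} f [] uV uL L⊆V = trans (∑-cong V (λ x → *-zeroʳ (f x))) (∑-0 V)
    ∑-∈ᵇ {V} f (y ∷ L) uV (y∉ ∷ uL) L⊆V = begin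
      ∑ V (λ x → f x * 𝟙 (x ∈ᵇ (y ∷ L)))
        ≡⟨ ∑-cong V (λ x → trans (cong (f x *_) (𝟙-∈ᵇ-∷ {x} (λ y∈ → All.lookup y∉ y∈ refl))) (*-distribˡ-+ (f x) _ _)) ⟩
      ∑ V (λ x → f x * 𝟙 ⌊ x ≟ y ⌋ + f x * 𝟙 (x ∈ᵇ L))
        ≡⟨ ∑-+ V _ _ ⟩
      ∑ V (λ x → f x * 𝟙 ⌊ x ≟ y ⌋) + ∑ V (λ x → f x * 𝟙 (x ∈ᵇ L))
        ≡⟨ cong₂ _+_ (∑-δ f uV (L⊆V y (here refl))) (∑-∈ᵇ f L uV uL (λ x x∈ → L⊆V x (there x∈))) ⟩
      f y + ∑ L f ∎
      where open ≡-Reasoning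

    _∖_ : (X → Bool) → List X → X → Bool
    (U ∖ B) x = U x ∧ not (x ∈ᵇ B)

    meets : List X → List X → Bool
    meets B [] = false
    meets B (x ∷ A) = (x ∈ᵇ B) ∨ meets B A

    meets-singleton : ∀ x A → meets (x ∷ []) A ≡ (x ∈ᵇ A)
    meets-singleton x [] = refl
    meets-singleton x (y ∷ A) = cong₂ _∨_ (trans (Boolₚ.∨-identityʳ _) (≟-sym y x)) (meets-singleton x A)

    allᵇ-∖ : ∀ U B A → allᵇ (U ∖ B) A ≡ allᵇ U A ∧ not (meets B A)
    allᵇ-∖ U B [] = refl
    allᵇ-∖ U B (x ∷ A) rewrite allᵇ-∖ U B A with U x | x ∈ᵇ B
    ... | false | _ = refl
    ... | true | true = sym (Boolₚ.∧-zeroʳ _)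
    ... | true | false = refl

    𝟙-allᵇ-∖ : ∀ U B A → 𝟙 (allᵇ (U ∖ B) A) ≡ 𝟙 (allᵇ U A) * (1ℚ - 𝟙 (meets B A))
    𝟙-allᵇ-∖ U B A = trans (cong 𝟙 (allᵇ-∖ U B A))
      (trans (𝟙-∧ (allᵇ U A) _) (cong (𝟙 (allᵇ U A) *_) (𝟙-not (meets B A))))

  -- Edges are indices in `I`, so one vertex set may occur many times, as it does for the orderings
  -- of a clique. Storing `r-1` keeps the uniformity positive by construction.
  record WeightedHypergraph (X I : Set) : Set where
    field
      _≟_ : DecidableEquality X
      V : List X
      V-unique : Unique V
      E : List I
      el : I → List X
      el-unique : ∀ K → Unique (el K)
      el⊆V : ∀ K x → x ∈ el K → x ∈ V
      r-1 : ℕ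
      el-length : ∀ K → length (el K) ≡ suc r-1
      w : I → ℚ
      w-nonneg : ∀ K → 0ℚ ≤ w K

    open Membership _≟_ public

    field
      κ : ℚ
      κ-nonneg : 0ℚ ≤ κ
      degree : ∀ x → x ∈ V → ∑ E (λ K → w K * 𝟙 (x ∈ᵇ el K)) ≡ 1ℚ
      codegree : ∀ x y → x ≢ y → ∑ E (λ K → w K * (𝟙 (x ∈ᵇ el K) * 𝟙 (y ∈ᵇ el K))) ≤ κ

    IsMatching : List I → Set
    IsMatching = AllPairs (λ K K′ → ∀ x → x ∈ el K → x ∈ el K′ → ⊥)

    record State : Set where
      constructor state
      field
        U : X → Bool
        M : List I
    open State public

    take : I → State → State
    take K s = state (U s ∖ el K) (K ∷ M s)

    drop : X → State → State
    drop x s = state (U s ∖ (x ∷ [])) (M s)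

    load : (I → ℚ) → X → ℚ
    load p x = ∑ E (λ K → p K * 𝟙 (x ∈ᵇ el K))

    -- One random step: the edge K is matched with probability p K and the single vertex x is thrown
    -- away with probability h - load p x, so that every vertex disappears with the same probability h.
    step : ℚ → ((X → Bool) → I → ℚ) → (State → ℚ) → State → ℚ
    step h p f s = f s + (∑ E (λ K → p (U s) K * (f (take K s) - f s))
                        + ∑ V (λ x → (h - load (p (U s)) x) * (f (drop x s) - f s)))

    record Admissible (h : ℚ) (p : (X → Bool) → I → ℚ) : Set where
      field
        p-nonneg : ∀ U K → 0ℚ ≤ p U K
        load-≤ : ∀ U x → load (p U) x ≤ h
        h-≤ : ♯ (length V) * h ≤ 1ℚ
        p-avail : ∀ U K → allᵇ U (el K) ≡ false → p U K ≡ 0ℚ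

    ∑-el : ∀ (f : X → ℚ) K → ∑ V (λ x → f x * 𝟙 (x ∈ᵇ el K)) ≡ ∑ (el K) f
    ∑-el f K = ∑-∈ᵇ f (el K) V-unique (el-unique K) (el⊆V K)

    ∑-V-el : ∀ K → ∑ V (λ x → 𝟙 (x ∈ᵇ el K)) ≡ ♯ (suc r-1)
    ∑-V-el K = begin
      ∑ V (λ x → 𝟙 (x ∈ᵇ el K))        ≡⟨ ∑-cong V (λ x → sym (*-identityˡ _)) ⟩
      ∑ V (λ x → 1ℚ * 𝟙 (x ∈ᵇ el K))   ≡⟨ ∑-el (λ _ → 1ℚ) K ⟩
      ∑ (el K) (λ _ → 1ℚ)              ≡⟨ ∑-const (el K) 1ℚ ⟩
      ♯ (length (el K)) * 1ℚ           ≡⟨ *-identityʳ _ ⟩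
      ♯ (length (el K))                ≡⟨ cong ♯ (el-length K) ⟩
      ♯ (suc r-1)                      ∎
      where open ≡-Reasoning

    ∑-load : ∀ L p → ∑ L (load p) ≡ ∑ E (λ K → p K * ∑ L (λ x → 𝟙 (x ∈ᵇ el K)))
    ∑-load L p = trans (∑-swap L E _) (∑-cong E (λ K → ∑-*ˡ (p K) L _))

    ∑-load-V : ∀ p → ∑ V (load p) ≡ ♯ (suc r-1) * ∑ E p
    ∑-load-V p = trans (∑-load V p) (trans (∑-cong E (λ K → trans (cong (p K *_) (∑-V-el K)) (*-comm (p K) _)))
      (∑-*ˡ _ E p))

    module Steps {h p} (adm : Admissible h p) where
      open Admissible adm

      mass : State → ℚ
      mass s = ∑ E (p (U s)) + ∑ V (λ x → h - load (p (U s)) x)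

      -- Summing the loads over `V` counts each `p K` exactly r times, so the mass is |V| h - (r -
      -- 1) ∑ p. What is missing to 1 is the probability of staying put.
      mass-≤1 : ∀ s → mass s ≤ 1ℚ
      mass-≤1 s = ≤-trans (≤-cert (*-nonneg (♯-nonneg r-1) (∑-nonneg E (p-nonneg (U s))))
          (sym (trans (cong (λ z → ∑ E (p (U s)) + z + _) eqV) (eq (∑ E (p (U s))) (♯ r-1) (♯ (length V) * h))))) h-≤
        where
        eqV : ∑ V (λ x → h - load (p (U s)) x) ≡ ♯ (length V) * h - (1ℚ + ♯ r-1) * ∑ E (p (U s))
        eqV = trans (∑-sub V _ _) (cong₂ _-_ (∑-const V h) (trans (∑-load-V (p (U s))) (cong (_* ∑ E (p (U s))) (♯-suc r-1))))
        opaque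
          unfolding _+_
          eq : ∀ a r n → a + (n - (1ℚ + r) * a) + r * a ≡ n
          eq = solve-∀ ℚ-ring

      slack-nonneg : ∀ s x → 0ℚ ≤ h - load (p (U s)) x
      slack-nonneg s x = sub-nonneg (load-≤ (U s) x)

      step-≤ : ∀ f s b → f s ≤ b → (∀ K → K ∈ E → allᵇ (U s) (el K) ≡ true → f (take K s) ≤ b) →
        (∀ x → x ∈ V → f (drop x s) ≤ b) → step h p f s ≤ b
      step-≤ f s b s≤b take≤b drop≤b = ≤-trans
          (+-monoʳ-≤ (f s) (+-mono-≤ (∑-mono∈ E takeTerm) (∑-mono∈ V dropTerm)))
          (≤-resp (sym (trans (cong (f s +_) (trans (cong₂ _+_ (∑-*ʳ _ E _) (∑-*ʳ _ V _)) (sym (*-distribʳ-+ d _ _)))) refl))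
             (eq (f s) b)
             (+-monoʳ-≤ (f s) (*-monoʳ (sub-nonneg s≤b) (mass-≤1 s))))
        where
        d = b - f s
        takeTerm : ∀ K → K ∈ E → p (U s) K * (f (take K s) - f s) ≤ p (U s) K * d
        takeTerm K K∈ with allᵇ (U s) (el K) in e
        ... | true = *-monoˡ (p-nonneg (U s) K) (sub-mono (take≤b K K∈ e) ≤-refl)
        ... | false rewrite p-avail (U s) K e = ≤-reflexive (trans (*-zeroˡ (f (take K s) - f s)) (sym (*-zeroˡ d)))
        dropTerm : ∀ x → x ∈ V → (h - load (p (U s)) x) * (f (drop x s) - f s) ≤ (h - load (p (U s)) x) * d
        dropTerm x x∈ = *-monoˡ (slack-nonneg s x) (sub-mono (drop≤b x x∈) ≤-refl)
        opaque
          unfolding _+_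
          eq : ∀ a b → a + 1ℚ * (b - a) ≡ b
          eq = solve-∀ ℚ-ring

    step-cong : ∀ h p {f g} → (∀ s → f s ≡ g s) → ∀ s → step h p f s ≡ step h p g s
    step-cong h p e s = cong₂ _+_ (e s) (cong₂ _+_
      (∑-cong E (λ K → cong (p (U s) K *_) (cong₂ _-_ (e (take K s)) (e s))))
      (∑-cong V (λ x → cong ((h - load (p (U s)) x) *_) (cong₂ _-_ (e (drop x s)) (e s)))))

    step-+ : ∀ h p f g s → step h p (λ s → f s + g s) s ≡ step h p f s + step h p g s
    step-+ h p f g s = trans (cong ((f s + g s) +_) (cong₂ _+_
        (trans (∑-cong E (λ K → eq (p (U s) K) (f (take K s)) (g (take K s)) (f s) (g s))) (∑-+ E _ _))
        (trans (∑-cong V (λ x → eq (h - load (p (U s)) x) (f (drop x s)) (g (drop x s)) (f s) (g s))) (∑-+ V _ _))))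
        (eq′ (f s) (g s) _ _ _ _)
      where
      opaque
        unfolding _+_
        eq : ∀ p a b c d → p * ((a + b) - (c + d)) ≡ p * (a - c) + p * (b - d)
        eq = solve-∀ ℚ-ring
        eq′ : ∀ a b c d e f → a + b + ((c + d) + (e + f)) ≡ (a + (c + e)) + (b + (d + f))
        eq′ = solve-∀ ℚ-ring

    step-*ˡ : ∀ h p c f s → step h p (λ s → c * f s) s ≡ c * step h p f s
    step-*ˡ h p c f s = trans (cong ((c * f s) +_) (cong₂ _+_
        (trans (∑-cong E (λ K → eq (p (U s) K) c (f (take K s)) (f s))) (∑-*ˡ c E _))
        (trans (∑-cong V (λ x → eq (h - load (p (U s)) x) c (f (drop x s)) (f s))) (∑-*ˡ c V _))))
        (eq′ c (f s) _ _)
      where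
      opaque
        unfolding _+_
        eq : ∀ p c a b → p * (c * a - c * b) ≡ c * (p * (a - b))
        eq = solve-∀ ℚ-ring
        eq′ : ∀ c a d e → c * a + (c * d + c * e) ≡ c * (a + (d + e))
        eq′ = solve-∀ ℚ-ring

    start : State
    start = state (λ x → x ∈ᵇ V) []

    -- The second half keeps matched vertices out of `U`, which makes the next available edge
    -- disjoint from all earlier ones.
    Valid : State → Set
    Valid s = IsMatching (M s) × (∀ K → K ∈ M s → ∀ x → x ∈ el K → U s x ≡ false)

    start-valid : Valid start
    start-valid = [] , λ _ ()

    drop-valid : ∀ x s → Valid s → Valid (drop x s)
    drop-valid x s (m , d) = m , λ K K∈ y y∈ → cong (_∧ not (y ∈ᵇ (x ∷ []))) (d K K∈ y y∈)

    take-valid : ∀ K s → allᵇ (U s) (el K) ≡ true → Valid s → Valid (take K s)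
    take-valid K s a (m , d) =
        (All.tabulate (λ {K′} K′∈ x x∈ x∈′ → case trans (sym (allᵇ-∈ a x∈)) (d K′ K′∈ x x∈′) of λ ()) ∷ m) ,
        λ { _ (here refl) x x∈ → trans (cong (λ b → U s x ∧ not b) (∈⇒∈ᵇ x∈)) (Boolₚ.∧-zeroʳ (U s x))
          ; K′ (there K′∈) x x∈ → cong (_∧ not (x ∈ᵇ el K)) (d K′ K′∈ x x∈) }

    module Process (h : ℕ → ℚ) (p : ℕ → (X → Bool) → I → ℚ) where

      -- The expectation of f over the state after t steps, computed with the adjoint of the transition.
      𝔼 : ℕ → (State → ℚ) → ℚ
      𝔼 zero f = f start
      𝔼 (suc t) f = 𝔼 t (step (h t) (p t) f)

      𝔼-cong : ∀ t {f g} → (∀ s → f s ≡ g s) → 𝔼 t f ≡ 𝔼 t g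
      𝔼-cong zero e = e start
      𝔼-cong (suc t) e = 𝔼-cong t (step-cong (h t) (p t) e)

      𝔼-+ : ∀ t f g → 𝔼 t (λ s → f s + g s) ≡ 𝔼 t f + 𝔼 t g
      𝔼-+ zero f g = refl
      𝔼-+ (suc t) f g = trans (𝔼-cong t (step-+ (h t) (p t) f g)) (𝔼-+ t _ _)

      𝔼-*ˡ : ∀ t c f → 𝔼 t (λ s → c * f s) ≡ c * 𝔼 t f
      𝔼-*ˡ zero c f = refl
      𝔼-*ˡ (suc t) c f = trans (𝔼-cong t (step-*ˡ (h t) (p t) c f)) (𝔼-*ˡ t c _)

      𝔼-0 : ∀ t → 𝔼 t (λ _ → 0ℚ) ≡ 0ℚ
      𝔼-0 t = trans (𝔼-cong t (λ _ → sym (*-zeroˡ 0ℚ))) (trans (𝔼-*ˡ t 0ℚ (λ _ → 0ℚ)) (*-zeroˡ (𝔼 t (λ _ → 0ℚ))))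

      𝔼-∑ : ∀ t {A : Set} (L : List A) (f : A → State → ℚ) → 𝔼 t (λ s → ∑ L (λ a → f a s)) ≡ ∑ L (λ a → 𝔼 t (f a))
      𝔼-∑ t [] f = 𝔼-0 t
      𝔼-∑ t (a ∷ L) f = trans (𝔼-+ t (f a) _) (cong (𝔼 t (f a) +_) (𝔼-∑ t L f))

      𝔼-sub : ∀ t f g → 𝔼 t (λ s → f s - g s) ≡ 𝔼 t f - 𝔼 t g
      𝔼-sub t f g = trans (𝔼-cong t (λ s → eq (f s) (g s))) (trans (𝔼-+ t f _)
        (trans (cong (𝔼 t f +_) (𝔼-*ˡ t (0ℚ - 1ℚ) g)) (sym (eq (𝔼 t f) (𝔼 t g)))))
        where
        opaque
          unfolding _+_
          eq : ∀ a b → a - b ≡ a + (0ℚ - 1ℚ) * b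
          eq = solve-∀ ℚ-ring

      module _ (T : ℕ) (adm : ∀ t → t ℕ.< T → Admissible (h t) (p t)) where

        -- The method of conditional expectations: induction applied to `step f` gives a state after
        -- t steps, and the best of that state and its successors reaches the average.
        attained : ∀ t → t ℕ.≤ T → ∀ f → ∃ λ s → Valid s × 𝔼 t f ≤ f s
        attained zero _ f = start , start-valid , ≤-refl
        attained (suc t) t<T f with attained t (ℕₚ.<⇒≤ t<T) (step (h t) (p t) f)
        ... | s , vs , le = proj₁ (proj₁ best) , proj₂ (proj₁ best) ,
            ≤-trans le (Steps.step-≤ (adm t t<T) f s _ (proj₁ (proj₂ best)) take≤ drop≤)
          where
          F : Σ State Valid → ℚ
          F (s , _) = f s
          takeV : ∀ K b → allᵇ (U s) (el K) ≡ b → Σ State Valid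
          takeV K true e = take K s , take-valid K s e vs
          takeV K false e = s , vs
          takeV-true : ∀ K b (e : allᵇ (U s) (el K) ≡ b) → b ≡ true → F (takeV K b e) ≡ f (take K s)
          takeV-true K true e refl = refl
          cand : I → Σ State Valid
          cand K = takeV K (allᵇ (U s) (el K)) refl
          candE = map cand E
          candV = map (λ x → drop x s , drop-valid x s vs) V
          best = argmax F (s , vs) (candE ++ candV)
          take≤ : ∀ K → K ∈ E → allᵇ (U s) (el K) ≡ true → f (take K s) ≤ F (proj₁ best)
          take≤ K K∈ e = ≤-resp (takeV-true K _ refl e) refl
            (proj₂ (proj₂ best) (cand K) (∈-++⁺ˡ (∈-map⁺ cand K∈)))
          drop≤ : ∀ x → x ∈ V → f (drop x s) ≤ F (proj₁ best)
          drop≤ x x∈ = proj₂ (proj₂ best) _ (∈-++⁺ʳ candE (∈-map⁺ _ x∈))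

        -- `attained` for the negative of f yields a state where that negative is at least its
        -- expectation, and there it is at most 0.
        𝔼-nonneg : ∀ t → t ℕ.≤ T → ∀ {f} → (∀ s → 0ℚ ≤ f s) → 0ℚ ≤ 𝔼 t f
        𝔼-nonneg t t≤T {f} f≥0 with attained t t≤T (λ s → (0ℚ - 1ℚ) * f s)
        ... | s , _ , le = nonneg-neg (≤-trans (≤-reflexive (sym (𝔼-*ˡ t (0ℚ - 1ℚ) f)))
                (≤-trans le (neg-nonneg (f≥0 s))))
          where
          nonneg-neg : ∀ {a} → (0ℚ - 1ℚ) * a ≤ 0ℚ → 0ℚ ≤ a
          nonneg-neg {a} h = nonneg-sub (≤-resp refl (eq a) (sub-nonneg h))
            where
            opaque
              unfolding _+_
              eq : ∀ a → 0ℚ - (0ℚ - 1ℚ) * a ≡ a - 0ℚ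
              eq = solve-∀ ℚ-ring
          neg-nonneg : ∀ {a} → 0ℚ ≤ a → (0ℚ - 1ℚ) * a ≤ 0ℚ
          neg-nonneg {a} h = ≤-cert h (eq a)
            where
            opaque
              unfolding _+_
              eq : ∀ a → 0ℚ ≡ (0ℚ - 1ℚ) * a + a
              eq = solve-∀ ℚ-ring

        𝔼-mono : ∀ t → t ℕ.≤ T → ∀ {f g} → (∀ s → f s ≤ g s) → 𝔼 t f ≤ 𝔼 t g
        𝔼-mono t t≤T {f} {g} le = nonneg-sub (≤-resp refl (𝔼-sub t g f)
          (𝔼-nonneg t t≤T (λ s → sub-nonneg (le s))))

-- Availability probabilities of bounded vertex sets.

module Correlations where

  open Arithmetic
  open RandomGreedy

  bernoulli-lower : ∀ m {h} → 0ℚ ≤ h → h ≤ 1ℚ → 1ℚ - ♯ m * h ≤ (1ℚ - h) ↑ m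
  bernoulli-lower zero 0≤h _ = sub-≤ (*-nonneg (♯-nonneg 0) 0≤h)
  bernoulli-lower (suc m) {h} 0≤h h≤1 = ≤-trans
      (≤-cert (*-nonneg (♯-nonneg m) (*-nonneg 0≤h 0≤h))
        (trans (eq (♯ m) h) (cong (λ z → 1ℚ - z * h + ♯ m * (h * h)) (sym (♯-suc m)))))
      (*-monoˡ (sub-nonneg h≤1) (bernoulli-lower m 0≤h h≤1))
    where
    opaque
      unfolding _+_
      eq : ∀ m h → (1ℚ - h) * (1ℚ - m * h) ≡ 1ℚ - (1ℚ + m) * h + m * (h * h)
      eq = solve-∀ ℚ-ring

  bernoulli-upper : ∀ m {h} → 0ℚ ≤ h → h ≤ 1ℚ → (1ℚ - h) ↑ m ≤ 1ℚ - ♯ m * h + ♯ m * ♯ m * (h * h)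
  bernoulli-upper zero {h} _ _ = ≤-reflexive (trans (eq h) (cong (λ z → 1ℚ - z * h + z * z * (h * h)) (sym ♯-0)))
    where
    opaque
      unfolding _+_
      eq : ∀ h → 1ℚ ≡ 1ℚ - 0ℚ * h + 0ℚ * 0ℚ * (h * h)
      eq = solve-∀ ℚ-ring
  bernoulli-upper (suc m) {h} 0≤h h≤1 = ≤-trans
      (*-monoˡ (sub-nonneg h≤1) (bernoulli-upper m 0≤h h≤1))
      (≤-cert (+-nonneg (*-nonneg (+-nonneg (♯-nonneg m) 0≤1) hh)
          (*-nonneg (*-nonneg (♯-nonneg m) (♯-nonneg m)) (*-nonneg 0≤h hh)))
        (trans (cong (λ z → 1ℚ - z * h + z * z * (h * h)) (♯-suc m)) (eq (♯ m) h)))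
    where
    hh : 0ℚ ≤ h * h
    hh = *-nonneg 0≤h 0≤h
    opaque
      unfolding _+_
      eq : ∀ m h → 1ℚ - (1ℚ + m) * h + (1ℚ + m) * (1ℚ + m) * (h * h)
         ≡ (1ℚ - h) * (1ℚ - m * h + m * m * (h * h)) + ((m + 1ℚ) * (h * h) + m * m * (h * (h * h)))
      eq = solve-∀ ℚ-ring

  -- `β t` is the intended probability of surviving t steps, `h t` the rate of disappearance, `c t`
  -- the cap on the weighted degree inside the remaining set, and `σ t` the factor from weights to
  -- probabilities. `h≡σc` says that a vertex at the cap may be matched at the full rate.
  record Schedule (N : ℚ) : Set where
    field
      T : ℕ
      β h σ c : ℕ → ℚ
      β-0 : β 0 ≡ 1ℚ
      β-suc : ∀ t → t ℕ.< T → β (suc t) ≡ (1ℚ - h t) * β t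
      β-nonneg : ∀ t → 0ℚ ≤ β t
      β-≤1 : ∀ t → β t ≤ 1ℚ
      h≡σc : ∀ t → h t ≡ σ t * c t
      σ-nonneg : ∀ t → 0ℚ ≤ σ t
      c-nonneg : ∀ t → 0ℚ ≤ c t
      N*h≤1 : ∀ t → t ℕ.< T → N * h t ≤ 1ℚ
      h≤1 : ∀ t → t ℕ.< T → h t ≤ 1ℚ

    h-nonneg : ∀ t → 0ℚ ≤ h t
    h-nonneg t = ≤-resp refl (sym (h≡σc t)) (*-nonneg (σ-nonneg t) (c-nonneg t))

  module Nibble {X I : Set} (H : WeightedHypergraph X I) (S : Schedule (♯ (length (WeightedHypergraph.V H)))) where
    open WeightedHypergraph H
    open Schedule S

    availDeg : (X → Bool) → X → ℚ
    availDeg U x = ∑ E (λ K → w K * (𝟙 (x ∈ᵇ el K) * 𝟙 (allᵇ U (el K))))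

    good : ℕ → (X → Bool) → X → Bool
    good t U x = (availDeg U x ≤ᵇ c t)

    -- Edges through vertices of too large degree are switched off, which keeps every load at most h t.
    p : ℕ → (X → Bool) → I → ℚ
    p t U K = σ t * (w K * (𝟙 (allᵇ U (el K)) * 𝟙 (allᵇ (good t U) (el K))))

    p-≤ : ∀ t U K → p t U K ≤ σ t * w K
    p-≤ t U K = *-monoˡ (σ-nonneg t) (≤-resp refl (*-identityʳ (w K)) (*-monoˡ (w-nonneg K)
      (≤-resp refl (*-identityˡ 1ℚ) (*-mono (𝟙-nonneg (allᵇ U (el K))) 0≤1 (𝟙-≤1 (allᵇ U (el K)))
          (𝟙-≤1 (allᵇ (good t U) (el K)))))))

    p-load : ∀ t U x → load (p t U) x ≤ h t
    p-load t U x with good t U x in bad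
    ... | true = ≤-trans (∑-mono E term) (≤-resp (sym (∑-*ˡ (σ t) E _)) (sym (h≡σc t)) (*-monoˡ (σ-nonneg t) (≤ᵇ-true bad)))
      where
      opaque
        unfolding _+_
        eq : ∀ σ w u g m → σ * (w * (u * g)) * m ≡ (σ * (w * (m * u))) * g
        eq = solve-∀ ℚ-ring
      term : ∀ K → p t U K * 𝟙 (x ∈ᵇ el K) ≤ σ t * (w K * (𝟙 (x ∈ᵇ el K) * 𝟙 (allᵇ U (el K))))
      term K = ≤-resp (sym (eq (σ t) (w K) (𝟙 (allᵇ U (el K))) _ _)) (*-identityʳ _)
        (*-monoˡ (*-nonneg (σ-nonneg t) (*-nonneg (w-nonneg K) (*-nonneg (𝟙-nonneg (x ∈ᵇ el K)) (𝟙-nonneg (allᵇ U (el K))))))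
          (𝟙-≤1 (allᵇ (good t U) (el K))))
    ... | false = ≤-resp (sym (trans (∑-cong E term) (∑-0 E))) refl (h-nonneg t)
      where
      opaque
        unfolding _+_
        zero₁ : ∀ σ w u m → σ * (w * (u * 0ℚ)) * m ≡ 0ℚ
        zero₁ = solve-∀ ℚ-ring
      term : ∀ K → p t U K * 𝟙 (x ∈ᵇ el K) ≡ 0ℚ
      term K with x ∈ᵇ el K in x∈
      ... | false = *-zeroʳ _
      ... | true = trans (cong (λ b → σ t * (w K * (𝟙 (allᵇ U (el K)) * 𝟙 b)) * 1ℚ)
        (allᵇ-false {P = good t U} (∈ᵇ⇒∈ {x} {el K} x∈) bad)) (zero₁ (σ t) (w K) _ 1ℚ)

    admissible : ∀ t → t ℕ.< T → Admissible (h t) (p t)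
    admissible t t<T = record
      { p-nonneg = λ U K → *-nonneg (σ-nonneg t) (*-nonneg (w-nonneg K)
          (*-nonneg (𝟙-nonneg (allᵇ U (el K))) (𝟙-nonneg (allᵇ (good t U) (el K)))))
      ; load-≤ = p-load t
      ; h-≤ = N*h≤1 t t<T
      ; p-avail = λ U K e → trans (cong (λ b → σ t * (w K * (𝟙 b * 𝟙 (allᵇ (good t U) (el K))))) e) (zero₂ (σ t) (w K) _)
      }
      where
      opaque
        unfolding _+_
        zero₂ : ∀ σ w g → σ * (w * (0ℚ * g)) ≡ 0ℚ
        zero₂ = solve-∀ ℚ-ring

    open Process h p

    avail : List X → State → ℚ
    avail A s = 𝟙 (allᵇ (U s) A)

    common : List X → I → ℚ
    common A K = ∑ A (λ x → 𝟙 (x ∈ᵇ el K))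

    -- The overcount at `K` when the events of hitting the single elements of `A` are simply added
    -- up.
    excess : List X → I → ℚ
    excess A K = common A K - 𝟙 (meets (el K) A)

    meets-≤ : ∀ A K → 𝟙 (meets (el K) A) ≤ common A K
    meets-≤ [] K = ≤-refl
    meets-≤ (x ∷ A) K with x ∈ᵇ el K
    ... | true = ≤-+ʳ (∑-nonneg A (λ y → 𝟙-nonneg (y ∈ᵇ el K)))
    ... | false = ≤-resp refl (sym (+-identityˡ _)) (meets-≤ A K)

    -- The overcount grows only if `K` contains x and also some element of `A`.
    excess-∷ : ∀ x A K → excess (x ∷ A) K ≤ excess A K + ∑ A (λ y → 𝟙 (x ∈ᵇ el K) * 𝟙 (y ∈ᵇ el K))
    excess-∷ x A K with x ∈ᵇ el K
    ... | true = ≤-cert (sub-nonneg (meets-≤ A K)) (trans (cong (excess A K +_) (trans (∑-*ˡ 1ℚ A _) (*-identityˡ _)))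
        (eq _ _))
      where
      opaque
        unfolding _+_
        eq : ∀ c m → c - m + c ≡ 1ℚ + c - 1ℚ + (c - m)
        eq = solve-∀ ℚ-ring
    ... | false = ≤-cert (∑-nonneg A (λ y → *-nonneg ≤-refl (𝟙-nonneg (y ∈ᵇ el K))))
        (cong (λ z → z - 𝟙 (meets (el K) A) + ∑ A (λ y → 0ℚ * 𝟙 (y ∈ᵇ el K))) (sym (+-identityˡ _)))

    -- By the equalisation, the probabilities of hitting the single vertices of `A` add up to
    -- exactly |A| h in every state; `excess` corrects for edges that hit several at once.
    step-avail : ∀ h p A → Unique A → (∀ x → x ∈ A → x ∈ V) → ∀ s →
      step h p (avail A) s ≡ avail A s * (1ℚ - ♯ (length A) * h + ∑ E (λ K → p (U s) K * excess A K))
    step-avail h p A uA A⊆V s = begin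
      step h p (avail A) s
        ≡⟨ cong (a +_) (cong₂ _+_
             (trans (∑-cong E (λ K → trans (cong (λ z → p (U s) K * (z - a)) (𝟙-allᵇ-∖ (U s) (el K) A))
                 (eq₁ (p (U s) K) a _))) (∑-*ˡ (0ℚ - a) E _))
             (trans (∑-cong V (λ x → trans (cong (λ z → q x * (z - a))
                 (trans (𝟙-allᵇ-∖ (U s) (x ∷ []) A) (cong (λ b → a * (1ℚ - 𝟙 b)) (meets-singleton x A)))) (eq₁ (q x) a _)))
                 (∑-*ˡ (0ℚ - a) V _))) ⟩
      a + ((0ℚ - a) * M₁ + (0ℚ - a) * ∑ V (λ x → q x * 𝟙 (x ∈ᵇ A)))
        ≡⟨ cong (λ z → a + ((0ℚ - a) * M₁ + (0ℚ - a) * z)) (trans (∑-∈ᵇ q A V-unique uA A⊆V)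
             (trans (∑-sub A _ _) (cong₂ _-_ (∑-const A h) (∑-load A (p (U s)))))) ⟩
      a + ((0ℚ - a) * M₁ + (0ℚ - a) * (♯ (length A) * h - Γ))
        ≡⟨ eq₂ a M₁ (♯ (length A) * h) Γ ⟩
      a * (1ℚ - ♯ (length A) * h + (Γ - M₁))
        ≡⟨ cong (λ z → a * (1ℚ - ♯ (length A) * h + z)) (sym (trans (∑-cong E (λ K → eq₃ (p (U s) K) _ _)) (∑-sub E _ _))) ⟩
      a * (1ℚ - ♯ (length A) * h + ∑ E (λ K → p (U s) K * excess A K)) ∎
      where
      open ≡-Reasoning
      a = avail A s
      q : X → ℚ
      q x = h - load (p (U s)) x
      M₁ = ∑ E (λ K → p (U s) K * 𝟙 (meets (el K) A))
      Γ = ∑ E (λ K → p (U s) K * common A K)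
      opaque
        unfolding _+_
        eq₁ : ∀ p a m → p * (a * (1ℚ - m) - a) ≡ (0ℚ - a) * (p * m)
        eq₁ = solve-∀ ℚ-ring
        eq₂ : ∀ a m l c → a + ((0ℚ - a) * m + (0ℚ - a) * (l - c)) ≡ a * (1ℚ - l + (c - m))
        eq₂ = solve-∀ ℚ-ring
        eq₃ : ∀ p c m → p * (c - m) ≡ p * c - p * m
        eq₃ = solve-∀ ℚ-ring

    module _ (t : ℕ) (V₀ : X → Bool) where
      private
        P = p t V₀
        P-nonneg : ∀ K → 0ℚ ≤ P K
        P-nonneg K = *-nonneg (σ-nonneg t) (*-nonneg (w-nonneg K)
            (*-nonneg (𝟙-nonneg (allᵇ V₀ (el K))) (𝟙-nonneg (allᵇ (good t V₀) (el K)))))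
      excess-sum-nonneg : ∀ A → 0ℚ ≤ ∑ E (λ K → P K * excess A K)
      excess-sum-nonneg A = ∑-nonneg E (λ K → *-nonneg (P-nonneg K) (sub-nonneg (meets-≤ A K)))

      pair-≤ : ∀ x y → x ≢ y → ∑ E (λ K → P K * (𝟙 (x ∈ᵇ el K) * 𝟙 (y ∈ᵇ el K))) ≤ σ t * κ
      pair-≤ x y x≢y = ≤-trans (∑-mono E (λ K → ≤-trans
          (*-monoʳ (*-nonneg (𝟙-nonneg (x ∈ᵇ el K)) (𝟙-nonneg (y ∈ᵇ el K))) (p-≤ t V₀ K))
          (≤-reflexive (*-assoc (σ t) (w K) _))))
        (≤-resp (sym (∑-*ˡ (σ t) E _)) refl (*-monoˡ (σ-nonneg t) (codegree x y x≢y)))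

      excess-sum-≤ : ∀ A → Unique A → ∑ E (λ K → P K * excess A K) ≤ ♯ (length A) * ♯ (length A) * (σ t * κ)
      excess-sum-≤ [] _ = ≤-reflexive (trans (∑-cong E (λ K → trans (cong (P K *_) (+-inverseʳ 0ℚ)) (*-zeroʳ _)))
         (trans (∑-0 E) (sym (trans (cong (λ z → z * z * (σ t * κ)) ♯-0) (eq (σ t * κ))))))
        where
        opaque
          unfolding _+_
          eq : ∀ a → 0ℚ * 0ℚ * a ≡ 0ℚ
          eq = solve-∀ ℚ-ring
      excess-sum-≤ (x ∷ A) (x∉ ∷ uA) = begin
        ∑ E (λ K → P K * excess (x ∷ A) K)
          ≤⟨ ∑-mono E (λ K → *-monoˡ (P-nonneg K) (excess-∷ x A K)) ⟩
        ∑ E (λ K → P K * (excess A K + ∑ A (λ y → 𝟙 (x ∈ᵇ el K) * 𝟙 (y ∈ᵇ el K))))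
          ≡⟨ trans (∑-cong E (λ K → *-distribˡ-+ (P K) _ _)) (∑-+ E _ _) ⟩
        ∑ E (λ K → P K * excess A K) + ∑ E (λ K → P K * ∑ A (λ y → 𝟙 (x ∈ᵇ el K) * 𝟙 (y ∈ᵇ el K)))
          ≡⟨ cong (∑ E (λ K → P K * excess A K) +_) (trans (∑-cong E (λ K → sym (∑-*ˡ (P K) A _))) (∑-swap E A _)) ⟩
        ∑ E (λ K → P K * excess A K) + ∑ A (λ y → ∑ E (λ K → P K * (𝟙 (x ∈ᵇ el K) * 𝟙 (y ∈ᵇ el K))))
          ≤⟨ +-mono-≤ (excess-sum-≤ A uA) (∑-mono∈ A (λ y y∈ → pair-≤ x y (All.lookup x∉ y∈))) ⟩
        ♯ (length A) * ♯ (length A) * (σ t * κ) + ∑ A (λ _ → σ t * κ)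
          ≡⟨ cong (♯ (length A) * ♯ (length A) * (σ t * κ) +_) (∑-const A (σ t * κ)) ⟩
        ♯ (length A) * ♯ (length A) * (σ t * κ) + ♯ (length A) * (σ t * κ)
          ≤⟨ ≤-cert (*-nonneg (+-nonneg 0≤1 (♯-nonneg (length A))) (*-nonneg (σ-nonneg t) κ-nonneg))
               (trans (cong (λ z → z * z * (σ t * κ)) (♯-suc (length A))) (eq (♯ (length A)) (σ t * κ))) ⟩
        ♯ (suc (length A)) * ♯ (suc (length A)) * (σ t * κ) ∎
        where
        open ℚₚ.≤-Reasoning
        opaque
          unfolding _+_
          eq : ∀ m s → (1ℚ + m) * (1ℚ + m) * s ≡ m * m * s + m * s + (1ℚ + m) * s
          eq = solve-∀ ℚ-ring

    𝔼-≤1 : ∀ t → t ℕ.≤ T → ∀ A → 𝔼 t (avail A) ≤ 1ℚ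
    𝔼-≤1 t t≤T A with attained T admissible t t≤T (avail A)
    ... | s , _ , le = ≤-trans le (𝟙-≤1 (allᵇ (U s) A))

    -- Only the edges meeting A in at least two vertices disturb the independence of the events x ∈ U,
    -- and by the codegree bound they carry little weight.
    module _ (A : List X) (uA : Unique A) (A⊆V : ∀ x → x ∈ A → x ∈ V) (e : ℚ)
      (m*h≤1 : ∀ t → t ℕ.< T → ♯ (length A) * h t ≤ 1ℚ)
      (e-≥ : ∀ t → t ℕ.< T → ♯ (length A) * ♯ (length A) * (h t * h t) + ♯ (length A) * ♯ (length A) * (σ t * κ) ≤ e) where

      private
        m = length A
        P : ℕ → ℚ
        P t = 𝔼 t (avail A)

        start-avail : avail A start ≡ 1ℚ
        start-avail = cong 𝟙 (allᵇ-true (λ x x∈ → ∈⇒∈ᵇ (A⊆V x x∈)))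

        e₁ : ∀ t → t ℕ.< T → ♯ m * ♯ m * (h t * h t) ≤ e
        e₁ t t<T = ≤-trans (≤-+ʳ (*-nonneg (*-nonneg (♯-nonneg m) (♯-nonneg m)) (*-nonneg (σ-nonneg t) κ-nonneg))) (e-≥ t t<T)

        e₂ : ∀ t → t ℕ.< T → ♯ m * ♯ m * (σ t * κ) ≤ e
        e₂ t t<T = ≤-trans (≤-cert (*-nonneg (*-nonneg (♯-nonneg m) (♯-nonneg m)) (*-nonneg (h-nonneg t) (h-nonneg t)))
            (+-comm _ _)) (e-≥ t t<T)

        0≤mm : 0ℚ ≤ ♯ m * ♯ m
        0≤mm = *-nonneg (♯-nonneg m) (♯-nonneg m)

        0≤1-mh : ∀ t → t ℕ.< T → 0ℚ ≤ 1ℚ - ♯ m * h t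
        0≤1-mh t t<T = sub-nonneg (m*h≤1 t t<T)

        β^-suc : ∀ t → t ℕ.< T → β (suc t) ↑ m ≡ (1ℚ - h t) ↑ m * β t ↑ m
        β^-suc t t<T = trans (cong (_↑ m) (β-suc t t<T)) (^-* (1ℚ - h t) (β t) m)

      -- Here 1 - m h ≤ (1 - h)^m goes in the right direction, so each step loses only the
      -- overcount, which is at most `e`.
      P-upper : ∀ t → t ℕ.≤ T → P t ≤ β t ↑ m + ♯ t * e
      P-upper zero _ = ≤-reflexive (trans start-avail (sym (trans (cong₂ (λ x y → x ↑ m + y * e) β-0 ♯-0)
        (trans (cong₂ _+_ (1^ m) (*-zeroˡ e)) (+-identityʳ 1ℚ)))))
      P-upper (suc t) t<T = begin
        𝔼 t (step (h t) (p t) (avail A))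
          ≤⟨ 𝔼-mono T admissible t (ℕₚ.<⇒≤ t<T) (λ s → ≤-trans (≤-reflexive (step-avail (h t) (p t) A uA A⊆V s))
               (≤-trans (*-monoˡ (𝟙-nonneg (allᵇ (U s) A)) (+-monoʳ-≤ (1ℚ - ♯ m * h t)
                   (≤-trans (excess-sum-≤ t (U s) A uA) (e₂ t t<T))))
                 (≤-reflexive (eq₀ (avail A s) (1ℚ - ♯ m * h t) e)))) ⟩
        𝔼 t (λ s → (1ℚ - ♯ m * h t) * avail A s + e * avail A s)
          ≡⟨ trans (𝔼-+ t _ _) (cong₂ _+_ (𝔼-*ˡ t _ _) (𝔼-*ˡ t _ _)) ⟩
        (1ℚ - ♯ m * h t) * P t + e * P t
          ≤⟨ +-mono-≤ (*-monoˡ (0≤1-mh t t<T) (P-upper t (ℕₚ.<⇒≤ t<T))) (*-monoˡ 0≤e (𝔼-≤1 t (ℕₚ.<⇒≤ t<T) A)) ⟩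
        (1ℚ - ♯ m * h t) * (β t ↑ m + ♯ t * e) + e * 1ℚ
          ≤⟨ ≤-cert (+-nonneg (*-nonneg (sub-nonneg (bernoulli-lower m (h-nonneg t) (h≤1 t t<T))) (^-nonneg m (β-nonneg t)))
                 (*-nonneg (*-nonneg (♯-nonneg m) (h-nonneg t)) (*-nonneg (♯-nonneg t) 0≤e)))
               (trans (cong₂ (λ x y → x + y * e) (β^-suc t t<T) (♯-suc t))
                   (eq₁ (♯ m * h t) (β t ↑ m) ((1ℚ - h t) ↑ m) (♯ t) e)) ⟩
        β (suc t) ↑ m + ♯ (suc t) * e ∎
        where
        open ℚₚ.≤-Reasoning
        0≤e : 0ℚ ≤ e
        0≤e = ≤-trans (*-nonneg 0≤mm (*-nonneg (σ-nonneg t) κ-nonneg)) (e₂ t t<T)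
        opaque
          unfolding _+_
          eq₀ : ∀ a b e → a * (b + e) ≡ b * a + e * a
          eq₀ = solve-∀ ℚ-ring
          eq₁ : ∀ mh b c t e → c * b + (1ℚ + t) * e ≡ (1ℚ - mh) * (b + t * e) + e * 1ℚ + ((c - (1ℚ - mh)) * b + mh * (t * e))
          eq₁ = solve-∀ ℚ-ring

      -- The overcount is nonnegative and is dropped; the loss is now the quadratic Bernoulli error
      -- m² h², again at most `e`.
      P-lower : ∀ t → t ℕ.≤ T → β t ↑ m - ♯ t * e ≤ P t
      P-lower zero _ = ≤-reflexive (sym (trans start-avail (sym (trans (cong₂ (λ x y → x ↑ m - y * e) β-0 ♯-0)
        (trans (cong₂ _-_ (1^ m) (*-zeroˡ e)) (eq₀))))))
        where
        opaque
          unfolding _+_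
          eq₀ : 1ℚ - 0ℚ ≡ 1ℚ
          eq₀ = solve-∀ ℚ-ring
      P-lower (suc t) t<T = begin
        β (suc t) ↑ m - ♯ (suc t) * e
          ≤⟨ ≤-cert (+-nonneg (+-nonneg
                 (*-nonneg (sub-nonneg (bernoulli-upper m (h-nonneg t) (h≤1 t t<T))) (^-nonneg m (β-nonneg t)))
                 (*-nonneg (*-nonneg 0≤mm (*-nonneg (h-nonneg t) (h-nonneg t))) (sub-nonneg (^-≤1 m (β-nonneg t) (β-≤1 t)))))
                 (+-nonneg (sub-nonneg (e₁ t t<T)) (*-nonneg (*-nonneg (♯-nonneg m) (h-nonneg t))
                     (*-nonneg (♯-nonneg t) 0≤e))))
               (trans (eq₁ (♯ m * h t) (β t ↑ m) ((1ℚ - h t) ↑ m) (♯ t) e (♯ m * ♯ m * (h t * h t)))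
                 (cong₂ _+_ (cong₂ (λ x y → x - y * e) (sym (β^-suc t t<T)) (sym (♯-suc t))) refl)) ⟩
        (1ℚ - ♯ m * h t) * (β t ↑ m - ♯ t * e)
          ≤⟨ *-monoˡ (0≤1-mh t t<T) (P-lower t (ℕₚ.<⇒≤ t<T)) ⟩
        (1ℚ - ♯ m * h t) * P t
          ≡⟨ sym (𝔼-*ˡ t _ _) ⟩
        𝔼 t (λ s → (1ℚ - ♯ m * h t) * avail A s)
          ≤⟨ 𝔼-mono T admissible t (ℕₚ.<⇒≤ t<T) (λ s → ≤-trans (≤-reflexive (*-comm _ (avail A s)))
               (≤-trans (*-monoˡ (𝟙-nonneg (allᵇ (U s) A)) (≤-+ʳ (excess-sum-nonneg t (U s) A)))
                 (≤-reflexive (sym (step-avail (h t) (p t) A uA A⊆V s))))) ⟩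
        𝔼 t (step (h t) (p t) (avail A)) ∎
        where
        open ℚₚ.≤-Reasoning
        0≤e : 0ℚ ≤ e
        0≤e = ≤-trans (*-nonneg 0≤mm (*-nonneg (σ-nonneg t) κ-nonneg)) (e₂ t t<T)
        opaque
          unfolding _+_
          eq₁ : ∀ mh b c t e d → (1ℚ - mh) * (b - t * e) ≡ c * b - (1ℚ + t) * e
              + ((((1ℚ - mh + d) - c) * b + d * (1ℚ - b)) + ((e - d) + mh * (t * e)))
          eq₁ = solve-∀ ℚ-ring

-- Second moments of the degrees inside U and the expected size of the matching.

module ExpectedSize where

  open Arithmetic
  open RandomGreedy
  open Correlations

  -- A pointwise form of Chebyshev's inequality: a value above (1 + θ) μ is charged to its squared
  -- deviation. In terms of s = d - (1 + θ) μ the slack is a polynomial in s, μ, θ with nonnegative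
  -- coefficients.
  overshoot : ∀ θ μ d → 0ℚ ≤ θ → 0ℚ ≤ μ → (1ℚ + θ) * μ ≤ d → θ * θ * μ * d ≤ (1ℚ + θ) * ((d - μ) * (d - μ))
  overshoot θ μ d 0≤θ 0≤μ h = ≤-cert
      (+-nonneg (*-nonneg 0≤s (*-nonneg 0≤μ (+-nonneg (+-nonneg 0≤θ 0≤θ) (*-nonneg 0≤θ 0≤θ))))
                (*-nonneg (+-nonneg 0≤1 0≤θ) (*-nonneg 0≤s 0≤s)))
      (eq θ μ d)
    where
    0≤s = sub-nonneg h
    opaque
      unfolding _+_
      eq : ∀ θ μ d → (1ℚ + θ) * ((d - μ) * (d - μ)) ≡ θ * θ * μ * d
         + ((d - (1ℚ + θ) * μ) * (μ * (θ + θ + θ * θ)) + (1ℚ + θ) * ((d - (1ℚ + θ) * μ) * (d - (1ℚ + θ) * μ)))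
      eq = solve-∀ ℚ-ring

  module _ {X : Set} (_≟_ : DecidableEquality X) where
    open Membership _≟_

    filter-≢-length : ∀ {x L} → Unique L → x ∈ L → suc (length (filter (λ y → ¬? (y ≟ x)) L)) ≡ length L
    filter-≢-length {x} {y ∷ L} (y∉ ∷ u) x∈ with y ≟ x
    ... | yes refl = cong suc (cong length (Listₚ.filter-all (λ z → ¬? (z ≟ y)) (All.map (λ y≢z z≡y → y≢z (sym z≡y)) y∉)))
    filter-≢-length (y∉ ∷ u) (here refl) | no y≢x = ⊥-elim (y≢x refl)
    filter-≢-length (y∉ ∷ u) (there x∈) | no y≢x = cong suc (filter-≢-length u x∈)

    shareOther : ∀ x (K L : List X) →
      (∃ λ y → y ∈ K × y ≢ x × y ∈ L) ⊎ (∀ y → y ∈ K → y ≢ x → y ∉ L)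
    shareOther x [] L = inj₂ (λ _ ())
    shareOther x (z ∷ K) L with shareOther x K L
    ... | inj₁ (y , y∈ , rest) = inj₁ (y , there y∈ , rest)
    ... | inj₂ h with z ≟ x | z ∈ᵇ L in z∈
    ... | yes z≡x | _ = inj₂ λ { _ (here refl) z≢x → ⊥-elim (z≢x z≡x) ; y (there y∈) → h y y∈ }
    ... | no z≢x | true = inj₁ (z , here refl , z≢x , ∈ᵇ⇒∈ z∈)
    ... | no z≢x | false = inj₂ λ
      { _ (here refl) _ z∈L → case trans (sym z∈) (∈⇒∈ᵇ z∈L) of λ ()
      ; y (there y∈) → h y y∈ }

  module Gain {X I : Set} (H : WeightedHypergraph X I) (S : Schedule (♯ (length (WeightedHypergraph.V H)))) where
    open WeightedHypergraph H
    open Schedule S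
    open Nibble H S
    open Process h p

    r N : ℚ
    r = ♯ (suc r-1)
    N = ♯ (length V)

    size : State → ℚ
    size s = ♯ (length (M s))

    step-size : ∀ h p s → step h p size s ≡ size s + ∑ E (p (U s))
    step-size h p s = cong (size s +_) (trans (cong₂ _+_
        (∑-cong E (λ K → trans (cong (λ z → p (U s) K * (z - size s)) (♯-suc (length (M s)))) (eq (p (U s) K) (size s))))
        (trans (∑-cong V (λ x → trans (cong ((h - load (p (U s)) x) *_) (+-inverseʳ (size s))) (*-zeroʳ _))) (∑-0 V)))
      (+-identityʳ _))
      where
      opaque
        unfolding _+_
        eq : ∀ p n → p * (1ℚ + n - n) ≡ p
        eq = solve-∀ ℚ-ring

    bad : ℕ → (X → Bool) → X → ℚ
    bad t U x = 𝟙 (not (good t U x))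

    -- A union bound over the bad vertices of each edge; exchanging the sums turns the loss into the
    -- degrees of the bad vertices.
    p-sum-≥ : ∀ t U → σ t * (∑ E (λ K → w K * 𝟙 (allᵇ U (el K))) - ∑ V (λ x → bad t U x * availDeg U x)) ≤ ∑ E (p t U)
    p-sum-≥ t U = ≤-resp (cong (σ t *_) (trans (∑-sub E _ _) (cong (∑ E (λ K → w K * a K) -_) swapped)))
        (sym (∑-*ˡ (σ t) E _))
        (*-monoˡ (σ-nonneg t) (∑-mono E term))
      where
      a : I → ℚ
      a K = 𝟙 (allᵇ U (el K))
      opaque
        unfolding _+_
        eq : ∀ w a b → w * (a * (1ℚ - b)) ≡ w * a - w * a * b
        eq = solve-∀ ℚ-ring
      term : ∀ K → w K * a K - w K * a K * ∑ (el K) (bad t U) ≤ w K * (a K * 𝟙 (allᵇ (good t U) (el K)))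
      term K = ≤-trans (≤-reflexive (sym (eq (w K) (a K) _)))
        (*-monoˡ (w-nonneg K) (*-monoˡ (𝟙-nonneg (allᵇ U (el K))) (𝟙-allᵇ-≥ (good t U) (el K))))
      opaque
        unfolding _+_
        eq₂ : ∀ w a b m → w * a * (b * m) ≡ b * (w * (m * a))
        eq₂ = solve-∀ ℚ-ring
      swapped : ∑ E (λ K → w K * a K * ∑ (el K) (bad t U)) ≡ ∑ V (λ x → bad t U x * availDeg U x)
      swapped = begin
        ∑ E (λ K → w K * a K * ∑ (el K) (bad t U))
          ≡⟨ ∑-cong E (λ K → trans (cong (w K * a K *_) (sym (∑-el (bad t U) K))) (sym (∑-*ˡ _ V _))) ⟩
        ∑ E (λ K → ∑ V (λ x → w K * a K * (bad t U x * 𝟙 (x ∈ᵇ el K))))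
          ≡⟨ ∑-swap E V _ ⟩
        ∑ V (λ x → ∑ E (λ K → w K * a K * (bad t U x * 𝟙 (x ∈ᵇ el K))))
          ≡⟨ ∑-cong V (λ x → trans (∑-cong E (λ K → eq₂ (w K) (a K) (bad t U x) _)) (∑-*ˡ _ E _)) ⟩
        ∑ V (λ x → bad t U x * availDeg U x) ∎
        where open ≡-Reasoning

    r*∑w : r * ∑ E w ≡ N
    r*∑w = begin
      r * ∑ E w                                        ≡⟨ sym (∑-load-V w) ⟩
      ∑ V (load w)                                     ≡⟨ ∑-cong∈ V (λ x x∈ → degree x x∈) ⟩
      ∑ V (λ _ → 1ℚ)                                   ≡⟨ trans (∑-const V 1ℚ) (*-identityʳ _) ⟩
      N                                                ∎
      where open ≡-Reasoning

    availDeg-unavail : ∀ U x → U x ≡ false → availDeg U x ≡ 0ℚ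
    availDeg-unavail U x e = trans (∑-cong E term) (∑-0 E)
      where
      opaque
        unfolding _+_
        zero₁ : ∀ w b → w * (0ℚ * b) ≡ 0ℚ
        zero₁ = solve-∀ ℚ-ring
        zero₂ : ∀ w b → w * (b * 0ℚ) ≡ 0ℚ
        zero₂ = solve-∀ ℚ-ring
      term : ∀ K → w K * (𝟙 (x ∈ᵇ el K) * 𝟙 (allᵇ U (el K))) ≡ 0ℚ
      term K with x ∈ᵇ el K in x∈
      ... | false = zero₁ (w K) _
      ... | true = trans (cong (λ b → w K * (1ℚ * 𝟙 b)) (allᵇ-false {P = U} (∈ᵇ⇒∈ {x} {el K} x∈) e)) (zero₂ (w K) 1ℚ)

    availDeg-nonneg : ∀ U x → 0ℚ ≤ availDeg U x
    availDeg-nonneg U x = ∑-nonneg E (λ K → *-nonneg (w-nonneg K)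
        (*-nonneg (𝟙-nonneg (x ∈ᵇ el K)) (𝟙-nonneg (allᵇ U (el K)))))

    -- The bound 2r - 1 on the length is the size of the union of two edges that share exactly one
    -- vertex.
    module _ (θ Γ τ : ℚ) (0≤θ : 0ℚ ≤ θ) (0≤C : 0ℚ ≤ Γ) (0≤τ : 0ℚ ≤ τ)
      (c≡ : ∀ t → c t ≡ (1ℚ + θ) * β t ↑ r-1)
      (C≥ : ∀ t → 1ℚ + θ ≤ Γ * (θ * θ * β t ↑ r-1))
      (upper : ∀ t → t ℕ.< T → ∀ A → Unique A → (∀ x → x ∈ A → x ∈ V) → length A ℕ.≤ suc r-1 ℕ.+ r-1 →
        𝔼 t (avail A) ≤ β t ↑ length A + τ)
      (lower : ∀ t → t ℕ.< T → ∀ A → Unique A → (∀ x → x ∈ A → x ∈ V) → length A ℕ.≤ suc r-1 ℕ.+ r-1 →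
        β t ↑ length A - τ ≤ 𝔼 t (avail A)) where

      μ : ℕ → ℚ
      μ t = β t ↑ r-1

      -- The right side is Γ times the squared deviation from μ, counted only for x in `U`: outside,
      -- the degree vanishes, and the indicator at μ² removes what would remain.
      bad-≤ : ∀ t s x → bad t (U s) x * availDeg (U s) x ≤
        Γ * (availDeg (U s) x * availDeg (U s) x - (μ t + μ t) * availDeg (U s) x + μ t * μ t * avail (x ∷ []) s)
      bad-≤ t s x with U s x in u
      ... | false = vanish (availDeg-unavail (U s) x u)
        where
        vanish : ∀ {b d} → d ≡ 0ℚ → b * d ≤ Γ * (d * d - (μ t + μ t) * d + μ t * μ t * 0ℚ)
        vanish {b} refl = ≤-reflexive (eq b Γ (μ t))
          where
          opaque
            unfolding _+_
            eq : ∀ b Γ μ → b * 0ℚ ≡ Γ * (0ℚ * 0ℚ - (μ + μ) * 0ℚ + μ * μ * 0ℚ)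
            eq = solve-∀ ℚ-ring
      ... | true with good t (U s) x in g
      ... | true = ≤-resp (sym (*-zeroˡ _)) (cong (Γ *_) (eq (availDeg (U s) x) (μ t)))
             (*-nonneg 0≤C (square-nonneg (availDeg (U s) x - μ t)))
        where
        opaque
          unfolding _+_
          eq : ∀ d μ → (d - μ) * (d - μ) ≡ d * d - (μ + μ) * d + μ * μ * 1ℚ
          eq = solve-∀ ℚ-ring
      ... | false = *-cancelˡ 0<1+θ (begin
          (1ℚ + θ) * (1ℚ * d)                ≤⟨ *-monoʳ (≤-resp refl (sym (*-identityˡ d)) (availDeg-nonneg (U s) x)) (C≥ t) ⟩
          Γ * (θ * θ * μ t) * (1ℚ * d)       ≡⟨ eq₁ Γ (θ * θ * μ t) d ⟩
          Γ * (θ * θ * μ t * d)              ≤⟨ *-monoˡ 0≤C (overshoot θ (μ t) d 0≤θ (^-nonneg r-1 (β-nonneg t)) c≤d) ⟩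
          Γ * ((1ℚ + θ) * ((d - μ t) * (d - μ t))) ≡⟨ eq₂ Γ θ d (μ t) ⟩
          (1ℚ + θ) * (Γ * (d * d - (μ t + μ t) * d + μ t * μ t * 1ℚ)) ∎)
        where
        open ℚₚ.≤-Reasoning
        d = availDeg (U s) x
        0<1+θ : 0ℚ < 1ℚ + θ
        0<1+θ = ℚₚ.<-≤-trans 0<1 (≤-+ʳ 0≤θ)
        c≤d : (1ℚ + θ) * μ t ≤ d
        c≤d = ≤-resp (c≡ t) refl (ℚₚ.<⇒≤ (≤ᵇ-false g))
        opaque
          unfolding _+_
          eq₁ : ∀ Γ a d → Γ * a * (1ℚ * d) ≡ Γ * (a * d)
          eq₁ = solve-∀ ℚ-ring
          eq₂ : ∀ Γ θ d μ → Γ * ((1ℚ + θ) * ((d - μ) * (d - μ))) ≡ (1ℚ + θ) * (Γ * (d * d - (μ + μ) * d + μ * μ * 1ℚ))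
          eq₂ = solve-∀ ℚ-ring

      module _ (t : ℕ) (t<T : t ℕ.< T) where
        private
          t≤T = ℕₚ.<⇒≤ t<T

        avail-el-≥ : ∀ K → β t ↑ suc r-1 - τ ≤ 𝔼 t (avail (el K))
        avail-el-≥ K = ≤-resp (cong (λ m → β t ↑ m - τ) (el-length K)) refl
          (lower t t<T (el K) (el-unique K) (el⊆V K) (ℕₚ.≤-trans (ℕₚ.≤-reflexive (el-length K)) (ℕₚ.m≤m+n (suc r-1) r-1)))

        mean : ∀ x → x ∈ V → β t ↑ suc r-1 - τ ≤ 𝔼 t (λ s → availDeg (U s) x)
        mean x x∈ = begin
          b                                                             ≡⟨ sym (*-identityˡ b) ⟩
          1ℚ * b                                                        ≡⟨ cong (_* b) (sym (degree x x∈)) ⟩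
          ∑ E (λ K → w K * 𝟙 (x ∈ᵇ el K)) * b                           ≡⟨ sym (∑-*ʳ b E _) ⟩
          ∑ E (λ K → w K * 𝟙 (x ∈ᵇ el K) * b)
            ≤⟨ ∑-mono E (λ K → *-monoˡ (*-nonneg (w-nonneg K) (𝟙-nonneg (x ∈ᵇ el K))) (avail-el-≥ K)) ⟩
          ∑ E (λ K → w K * 𝟙 (x ∈ᵇ el K) * 𝔼 t (avail (el K)))
            ≡⟨ ∑-cong E (λ K → sym (trans (𝔼-cong t (λ s → sym (*-assoc (w K) _ _))) (𝔼-*ˡ t _ _))) ⟩
          ∑ E (λ K → 𝔼 t (λ s → w K * (𝟙 (x ∈ᵇ el K) * avail (el K) s))) ≡⟨ sym (𝔼-∑ t E _) ⟩
          𝔼 t (λ s → availDeg (U s) x)                                  ∎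
          where
          open ℚₚ.≤-Reasoning
          b = β t ↑ suc r-1 - τ

        Bound : ℚ
        Bound = β t ↑ (suc r-1 ℕ.+ r-1) + τ

        private
          0≤Bound : 0ℚ ≤ Bound
          0≤Bound = +-nonneg (^-nonneg (suc r-1 ℕ.+ r-1) (β-nonneg t)) 0≤τ

        others : X → I → I → ℚ
        others x K K′ = ∑ (el K) (λ y → 𝟙 (not ⌊ y ≟ x ⌋) * 𝟙 (y ∈ᵇ el K′))

        others-term-nonneg : ∀ x K′ y → 0ℚ ≤ 𝟙 (not ⌊ y ≟ x ⌋) * 𝟙 (y ∈ᵇ el K′)
        others-term-nonneg x K′ y = *-nonneg (𝟙-nonneg (not ⌊ y ≟ x ⌋)) (𝟙-nonneg (y ∈ᵇ el K′))

        -- Either the edges meet in a second vertex, and the trivial bound 1 is charged to `others`,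
        -- or their union has exactly 2r - 1 vertices and `upper` applies.
        pair : ∀ x K K′ → x ∈ el K → x ∈ el K′ → 𝔼 t (λ s → avail (el K) s * avail (el K′) s) ≤ Bound + others x K K′
        pair x K K′ x∈ x∈′ with shareOther _≟_ x (el K) (el K′)
        ... | inj₁ (y , y∈ , y≢x , y∈′) = begin
          𝔼 t (λ s → avail (el K) s * avail (el K′) s)
            ≤⟨ 𝔼-mono T admissible t t≤T (λ s → ≤-trans (*-monoˡ (𝟙-nonneg (allᵇ (U s) (el K))) (𝟙-≤1 (allᵇ (U s) (el K′))))
                (≤-reflexive (*-identityʳ _))) ⟩
          𝔼 t (avail (el K))          ≤⟨ 𝔼-≤1 t t≤T (el K) ⟩
          1ℚ                          ≤⟨ ≤-resp one refl (∑-∈-≤ (others-term-nonneg x K′) y∈) ⟩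
          others x K K′               ≤⟨ ≤-cert 0≤Bound (+-comm Bound _) ⟩
          Bound + others x K K′       ∎
          where
          open ℚₚ.≤-Reasoning
          one : 𝟙 (not ⌊ y ≟ x ⌋) * 𝟙 (y ∈ᵇ el K′) ≡ 1ℚ
          one with y ≟ x
          ... | yes y≡x = ⊥-elim (y≢x y≡x)
          ... | no _ = trans (cong (λ b → 1ℚ * 𝟙 b) (∈⇒∈ᵇ y∈′)) (*-identityˡ 1ℚ)
        ... | inj₂ dis = begin
          𝔼 t (λ s → avail (el K) s * avail (el K′) s)
            ≤⟨ 𝔼-mono T admissible t t≤T both ⟩
          𝔼 t (avail A)               ≤⟨ upper t t<T A uA A⊆V (ℕₚ.≤-reflexive lenA) ⟩
          β t ↑ length A + τ          ≡⟨ cong (λ m → β t ↑ m + τ) lenA ⟩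
          Bound                       ≤⟨ ≤-+ʳ (∑-nonneg (el K) (others-term-nonneg x K′)) ⟩
          Bound + others x K K′       ∎
          where
          open ℚₚ.≤-Reasoning
          x? : ∀ y → Dec (y ≢ x)
          x? y = ¬? (y ≟ x)
          rest = filter x? (el K′)
          A = el K ++ rest
          uA : Unique A
          uA = Uniqueₚ.++⁺ (el-unique K) (Uniqueₚ.filter⁺ x? (el-unique K′))
            λ { {y} (y∈ , y∈rest) → case ∈-filter⁻ x? y∈rest of λ { (y∈′ , y≢x) → dis y y∈ y≢x y∈′ } }
          A⊆V : ∀ y → y ∈ A → y ∈ V
          A⊆V y y∈ with ∈-++⁻ (el K) y∈
          ... | inj₁ y∈K = el⊆V K y y∈K
          ... | inj₂ y∈rest = el⊆V K′ y (proj₁ (∈-filter⁻ x? y∈rest))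
          lenA : length A ≡ suc r-1 ℕ.+ r-1
          lenA = trans (Listₚ.length-++ (el K)) (cong₂ ℕ._+_ (el-length K)
            (ℕₚ.suc-injective (trans (filter-≢-length _≟_ (el-unique K′) x∈′) (el-length K′))))
          both : ∀ s → avail (el K) s * avail (el K′) s ≤ avail A s
          both s with allᵇ (U s) (el K) in a | allᵇ (U s) (el K′) in a′
          ... | false | _ = ≤-resp (sym (*-zeroˡ _)) refl (𝟙-nonneg (allᵇ (U s) A))
          ... | true | false = ≤-resp (sym (*-zeroʳ _)) refl (𝟙-nonneg (allᵇ (U s) A))
          ... | true | true = ≤-reflexive (trans (*-identityˡ 1ℚ) (cong 𝟙 (sym (allᵇ-true {P = U s} {A} avail-A))))
            where
            avail-A : ∀ y → y ∈ A → U s y ≡ true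
            avail-A y y∈ with ∈-++⁻ (el K) y∈
            ... | inj₁ y∈K = allᵇ-∈ a y∈K
            ... | inj₂ y∈rest = allᵇ-∈ {P = U s} {y} {el K′} a′ (proj₁ (∈-filter⁻ x? y∈rest))

        private
          g : X → I → ℚ
          g x K = w K * 𝟙 (x ∈ᵇ el K)

          g-nonneg : ∀ x K → 0ℚ ≤ g x K
          g-nonneg x K = *-nonneg (w-nonneg K) (𝟙-nonneg (x ∈ᵇ el K))

        others-sum : ∀ x K → ∑ E (λ K′ → g x K′ * others x K K′) ≤ r * κ
        others-sum x K = begin
          ∑ E (λ K′ → g x K′ * others x K K′)
            ≡⟨ trans (∑-cong E (λ K′ → sym (∑-*ˡ (g x K′) (el K) _))) (∑-swap E (el K) _) ⟩
          ∑ (el K) (λ y → ∑ E (λ K′ → g x K′ * (𝟙 (not ⌊ y ≟ x ⌋) * 𝟙 (y ∈ᵇ el K′))))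
            ≤⟨ ∑-mono (el K) term ⟩
          ∑ (el K) (λ _ → κ)          ≡⟨ ∑-const (el K) κ ⟩
          ♯ (length (el K)) * κ       ≡⟨ cong (λ m → ♯ m * κ) (el-length K) ⟩
          r * κ                       ∎
          where
          open ℚₚ.≤-Reasoning
          opaque
            unfolding _+_
            eq₀ : ∀ g m → g * (0ℚ * m) ≡ 0ℚ
            eq₀ = solve-∀ ℚ-ring
            eq₁ : ∀ w a b → w * a * (1ℚ * b) ≡ w * (a * b)
            eq₁ = solve-∀ ℚ-ring
          term : ∀ y → ∑ E (λ K′ → g x K′ * (𝟙 (not ⌊ y ≟ x ⌋) * 𝟙 (y ∈ᵇ el K′))) ≤ κ
          term y with y ≟ x
          ... | yes _ = ≤-resp (sym (trans (∑-cong E (λ K′ → eq₀ (g x K′) _)) (∑-0 E))) refl κ-nonneg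
          ... | no y≢x = ≤-resp (∑-cong E (λ K′ → sym (eq₁ (w K′) _ _))) refl (codegree x y (y≢x ∘ sym))

        second-moment : ∀ x → x ∈ V → 𝔼 t (λ s → availDeg (U s) x * availDeg (U s) x) ≤ Bound + r * κ
        second-moment x x∈V = begin
          𝔼 t (λ s → availDeg (U s) x * availDeg (U s) x)
            ≡⟨ 𝔼-cong t expand ⟩
          𝔼 t (λ s → ∑ E (λ K → ∑ E (λ K′ → (g x K * g x K′) * (avail (el K) s * avail (el K′) s))))
            ≡⟨ trans (𝔼-∑ t E _) (∑-cong E (λ K → trans (𝔼-∑ t E _) (∑-cong E (λ K′ → 𝔼-*ˡ t _ _)))) ⟩
          ∑ E (λ K → ∑ E (λ K′ → (g x K * g x K′) * Q K K′))
            ≤⟨ ∑-mono E (λ K → ∑-mono E (λ K′ → term K K′)) ⟩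
          ∑ E (λ K → ∑ E (λ K′ → g x K * (g x K′ * Bound + g x K′ * others x K K′)))
            ≡⟨ ∑-cong E (λ K → trans (∑-*ˡ (g x K) E _) (cong (g x K *_)
                (trans (∑-+ E _ _) (cong (_+ ∑ E (λ K′ → g x K′ * others x K K′))
                 (trans (∑-*ʳ Bound E _) (trans (cong (_* Bound) (degree x x∈V)) (*-identityˡ Bound))))))) ⟩
          ∑ E (λ K → g x K * (Bound + ∑ E (λ K′ → g x K′ * others x K K′)))
            ≤⟨ ∑-mono E (λ K → *-monoˡ (g-nonneg x K) (+-monoʳ-≤ Bound (others-sum x K))) ⟩
          ∑ E (λ K → g x K * (Bound + r * κ))
            ≡⟨ trans (∑-*ʳ _ E _) (trans (cong (_* (Bound + r * κ)) (degree x x∈V)) (*-identityˡ _)) ⟩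
          Bound + r * κ ∎
          where
          open ℚₚ.≤-Reasoning
          Q : I → I → ℚ
          Q K K′ = 𝔼 t (λ s → avail (el K) s * avail (el K′) s)
          opaque
            unfolding _+_
            eq : ∀ w m a w′ m′ a′ → w * (m * a) * (w′ * (m′ * a′)) ≡ w * m * (w′ * m′) * (a * a′)
            eq = solve-∀ ℚ-ring
          expand : ∀ s → availDeg (U s) x * availDeg (U s) x ≡ ∑ E
              (λ K → ∑ E (λ K′ → (g x K * g x K′) * (avail (el K) s * avail (el K′) s)))
          expand s = trans (sym (∑-*ʳ _ E _)) (∑-cong E (λ K → trans (sym (∑-*ˡ _ E _))
            (∑-cong E (λ K′ → eq (w K) (𝟙 (x ∈ᵇ el K)) (avail (el K) s) (w K′) (𝟙 (x ∈ᵇ el K′)) (avail (el K′) s)))))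
          opaque
            unfolding _+_
            eq₂ : ∀ a b c d → a * b * (c + d) ≡ a * (b * c + b * d)
            eq₂ = solve-∀ ℚ-ring
            z₁ : ∀ w b c → w * 0ℚ * b * c ≡ 0ℚ
            z₁ = solve-∀ ℚ-ring
            z₂ : ∀ w b c → b * (w * 0ℚ) * c ≡ 0ℚ
            z₂ = solve-∀ ℚ-ring
          term : ∀ K K′ → (g x K * g x K′) * Q K K′ ≤ g x K * (g x K′ * Bound + g x K′ * others x K K′)
          term K K′ = ≤-trans (step₁ K K′) (≤-reflexive (eq₂ (g x K) (g x K′) Bound (others x K K′)))
            where
            step₁ : ∀ K K′ → (g x K * g x K′) * Q K K′ ≤ (g x K * g x K′) * (Bound + others x K K′)
            step₁ K K′ with x ∈ᵇ el K in x∈ | x ∈ᵇ el K′ in x∈′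
            ... | false | _ = ≤-reflexive (trans (z₁ (w K) _ _) (sym (z₁ (w K) _ _)))
            ... | true | false = ≤-reflexive (trans (z₂ (w K′) _ _) (sym (z₂ (w K′) _ _)))
            ... | true | true = *-monoˡ (*-nonneg (*-nonneg (w-nonneg K) 0≤1) (*-nonneg (w-nonneg K′) 0≤1))
                    (pair x K K′ (∈ᵇ⇒∈ x∈) (∈ᵇ⇒∈ x∈′))

        Error : ℚ
        Error = τ + r * κ + (1ℚ + 1ℚ) * τ + τ

        -- With μ = β^(r-1) the main terms β^(2r-1) - 2 μ β^r + μ² β cancel, which leaves only
        -- errors.
        expected-bad : ∀ x → x ∈ V → 𝔼 t (λ s → bad t (U s) x * availDeg (U s) x) ≤ Γ * Error
        expected-bad x x∈ = begin
          𝔼 t (λ s → bad t (U s) x * availDeg (U s) x)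
            ≤⟨ 𝔼-mono T admissible t t≤T (λ s → bad-≤ t s x) ⟩
          𝔼 t (λ s → Γ * (availDeg (U s) x * availDeg (U s) x - (m + m) * availDeg (U s) x + m * m * avail (x ∷ []) s))
            ≡⟨ trans (𝔼-*ˡ t Γ _) (cong (Γ *_) (trans (𝔼-+ t _ _)
                (cong₂ _+_ (trans (𝔼-sub t _ _) (cong₂ _-_ refl (𝔼-*ˡ t (m + m) _))) (𝔼-*ˡ t (m * m) _)))) ⟩
          Γ * (𝔼 t (λ s → availDeg (U s) x * availDeg (U s) x) - (m + m) * 𝔼 t (λ s → availDeg (U s) x) + m * m * 𝔼 t
              (avail (x ∷ [])))
            ≤⟨ *-monoˡ 0≤C (+-mono-≤ (sub-mono (second-moment x x∈) (*-monoˡ (+-nonneg 0≤m 0≤m) (mean x x∈)))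
                 (*-monoˡ (*-nonneg 0≤m 0≤m) single)) ⟩
          Γ * (Bound + r * κ - (m + m) * (β t ↑ suc r-1 - τ) + m * m * (β t * 1ℚ + τ))
            ≤⟨ *-monoˡ 0≤C (≤-cert (+-nonneg (*-nonneg (+-nonneg 1-m 1-m) 0≤τ)
                (*-nonneg (sub-nonneg (≤-resp refl (*-identityˡ 1ℚ) (*-mono 0≤m 0≤1 m≤1 m≤1))) 0≤τ))
                 (trans (eq (β t) m τ (r * κ)) (cong (λ z → (z + τ) + r * κ - (m + m) * (β t ↑ suc r-1 - τ) + m * m * (β
                     t * 1ℚ + τ)
                   + ((1ℚ - m + (1ℚ - m)) * τ + (1ℚ - m * m) * τ)) (sym (^-+ (β t) (suc r-1) r-1))))) ⟩
          Γ * Error ∎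
          where
          open ℚₚ.≤-Reasoning
          m = μ t
          0≤m : 0ℚ ≤ m
          0≤m = ^-nonneg r-1 (β-nonneg t)
          m≤1 : m ≤ 1ℚ
          m≤1 = ^-≤1 r-1 (β-nonneg t) (β-≤1 t)
          1-m : 0ℚ ≤ 1ℚ - m
          1-m = sub-nonneg m≤1
          single : 𝔼 t (avail (x ∷ [])) ≤ β t * 1ℚ + τ
          single = upper t t<T (x ∷ []) ([] ∷ []) (λ { _ (here refl) → x∈ }) (ℕ.s≤s ℕ.z≤n)
          opaque
            unfolding _+_
            eq : ∀ b m τ k → τ + k + (1ℚ + 1ℚ) * τ + τ ≡ (b * m * m + τ) + k - (m + m) * (b * m - τ) + m * m * (b * 1ℚ + τ)
               + ((1ℚ - m + (1ℚ - m)) * τ + (1ℚ - m * m) * τ)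
            eq = solve-∀ ℚ-ring

        -- The total weight of the edges is N / r, and each edge is available with probability at
        -- least β^r - τ.
        expected-gain : σ t * (N * (β t ↑ suc r-1 - τ - r * (Γ * Error))) ≤ r * 𝔼 t (λ s → ∑ E (p t (U s)))
        expected-gain = begin
          σ t * (N * (b - r * (Γ * Error)))
            ≡⟨ eq (σ t) N b r (Γ * Error) ⟩
          σ t * (N * b - r * (N * (Γ * Error)))
            ≡⟨ cong (λ z → σ t * (z * b - r * (N * (Γ * Error)))) (sym r*∑w) ⟩
          σ t * (r * ∑ E w * b - r * (N * (Γ * Error)))
            ≡⟨ eq₂ (σ t) r (∑ E w) b (N * (Γ * Error)) ⟩
          r * (σ t * (∑ E w * b - N * (Γ * Error)))
            ≤⟨ *-monoˡ (♯-nonneg (suc r-1)) (*-monoˡ (σ-nonneg t) (sub-mono first second)) ⟩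
          r * (σ t * (𝔼 t (λ s → ∑ E (λ K → w K * 𝟙 (allᵇ (U s) (el K)))) - 𝔼 t
              (λ s → ∑ V (λ x → bad t (U s) x * availDeg (U s) x))))
            ≡⟨ cong (r *_) (sym (trans (𝔼-*ˡ t (σ t) _) (cong (σ t *_) (𝔼-sub t _ _)))) ⟩
          r * 𝔼 t (λ s → σ t * (∑ E (λ K → w K * 𝟙 (allᵇ (U s) (el K))) - ∑ V (λ x → bad t (U s) x * availDeg (U s) x)))
            ≤⟨ *-monoˡ (♯-nonneg (suc r-1)) (𝔼-mono T admissible t t≤T (λ s → p-sum-≥ t (U s))) ⟩
          r * 𝔼 t (λ s → ∑ E (p t (U s))) ∎
          where
          open ℚₚ.≤-Reasoning
          b = β t ↑ suc r-1 - τ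
          first : ∑ E w * b ≤ 𝔼 t (λ s → ∑ E (λ K → w K * 𝟙 (allᵇ (U s) (el K))))
          first = ≤-resp (∑-*ʳ b E w) (sym (trans (𝔼-∑ t E _) (∑-cong E (λ K → 𝔼-*ˡ t (w K) _))))
            (∑-mono E (λ K → *-monoˡ (w-nonneg K) (avail-el-≥ K)))
          second : 𝔼 t (λ s → ∑ V (λ x → bad t (U s) x * availDeg (U s) x)) ≤ N * (Γ * Error)
          second = ≤-resp (sym (𝔼-∑ t V _)) (∑-const V (Γ * Error)) (∑-mono∈ V expected-bad)
          opaque
            unfolding _+_
            eq : ∀ s n b r e → s * (n * (b - r * e)) ≡ s * (n * b - r * (n * e))
            eq = solve-∀ ℚ-ring
            eq₂ : ∀ s r w b e → s * (r * w * b - r * e) ≡ r * (s * (w * b - e))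
            eq₂ = solve-∀ ℚ-ring

      expected-size : ∀ γ → (∀ t → t ℕ.< T → γ ≤ σ t * (β t ↑ suc r-1 - τ - r * (Γ * (τ + r * κ + (1ℚ + 1ℚ) * τ + τ)))) →
        ∀ t → t ℕ.≤ T → ♯ t * (γ * N) ≤ r * 𝔼 t size
      expected-size γ γ≤ zero _ = ≤-reflexive (trans (cong (_* (γ * N)) ♯-0)
          (trans (*-zeroˡ _) (sym (trans (cong (r *_) ♯-0) (*-zeroʳ r)))))
      expected-size γ γ≤ (suc t) t<T = begin
        ♯ (suc t) * (γ * N)                           ≡⟨ trans (cong (_* (γ * N)) (♯-suc t)) (eq (♯ t) (γ * N)) ⟩
        ♯ t * (γ * N) + γ * N                         ≤⟨ +-mono-≤ (expected-size γ γ≤ t (ℕₚ.<⇒≤ t<T))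
            (*-monoʳ (♯-nonneg (length V)) (γ≤ t t<T)) ⟩
        r * 𝔼 t size + σ t * _ * N                     ≤⟨ +-monoʳ-≤ _
            (≤-trans (≤-reflexive (eq₂ (σ t) _ N)) (expected-gain t t<T)) ⟩
        r * 𝔼 t size + r * 𝔼 t (λ s → ∑ E (p t (U s)))  ≡⟨ sym (*-distribˡ-+ r _ _) ⟩
        r * (𝔼 t size + 𝔼 t (λ s → ∑ E (p t (U s))))    ≡⟨ cong (r *_)
            (sym (trans (𝔼-cong t (step-size (h t) (p t))) (𝔼-+ t _ _))) ⟩
        r * 𝔼 t (step (h t) (p t) size)                ∎
        where
        open ℚₚ.≤-Reasoning
        opaque
          unfolding _+_
          eq : ∀ t g → (1ℚ + t) * g ≡ t * g + g
          eq = solve-∀ ℚ-ring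
          eq₂ : ∀ s e n → s * e * n ≡ s * (n * e)
          eq₂ = solve-∀ ℚ-ring

      matching : ∀ γ → (∀ t → t ℕ.< T → γ ≤ σ t * (β t ↑ suc r-1 - τ - r * (Γ * (τ + r * κ + (1ℚ + 1ℚ) * τ + τ)))) →
        ∃ λ M → IsMatching M × ♯ T * (γ * N) ≤ r * ♯ (length M)
      matching γ γ≤ with attained T admissible T ℕₚ.≤-refl size
      ... | s , (m , _) , le = M s , m , ≤-trans (expected-size γ γ≤ T ℕₚ.≤-refl) (*-monoˡ (♯-nonneg (suc r-1)) le)

-- Choice of the parameters: nearly perfect matchings under small codegrees.

module NibbleLemma where

  open Arithmetic
  open RandomGreedy
  open Correlations
  open ExpectedSize

  six : ℚ
  six = 1ℚ + (1ℚ + 1ℚ + 1ℚ + 1ℚ + 1ℚ)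

  -- In r-uniform hypergraphs, r = suc r-1, codegrees up to 1 / threshold are allowed for a loss of 3 / q,
  -- q = suc q-1.
  threshold : ℕ → ℕ → ℚ
  threshold r-1 q-1 = Q * (Q ↑ R * (six * (♯ R * ((1ℚ + 1ℚ) * (Q * Q) * Q ↑
      r-1 * ((1ℚ + 1ℚ) * (♯ (R ℕ.+ R) * ♯ (R ℕ.+ R) * Q ↑ R))))))
    where
    R : ℕ
    R = suc r-1
    Q : ℚ
    Q = ♯ (suc q-1)

  module NibbleTheorem {X I : Set} (H : WeightedHypergraph X I) (q-1 : ℕ) where
    open WeightedHypergraph H

    private
      R : ℕ
      R = suc r-1
      Q ι r R₂ N Γ : ℚ
      Q = ♯ (suc q-1)
      ι = inv Q
      r = ♯ R
      R₂ = ♯ (R ℕ.+ R)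
      N = ♯ (length V)
      Γ = (1ℚ + 1ℚ) * (Q * Q) * Q ↑ r-1

    private
      smallness = threshold r-1 q-1

    private
      0<Q : 0ℚ < Q
      0<Q = ♯-pos q-1
      0≤Q = ℚₚ.<⇒≤ 0<Q
      Qι : Q * ι ≡ 1ℚ
      Qι = *-inv 0<Q
      0<ι : 0ℚ < ι
      0<ι = inv-pos 0<Q
      0≤ι = ℚₚ.<⇒≤ 0<ι
      1≤Q : 1ℚ ≤ Q
      1≤Q = ≤-resp ♯-1 refl (♯-mono (ℕ.s≤s ℕ.z≤n))
      ι≤1 : ι ≤ 1ℚ
      ι≤1 = inv-≤ 0<Q (≤-resp refl (sym (*-identityʳ Q)) 1≤Q)
      1≤Q^ : ∀ n → 1ℚ ≤ Q ↑ n
      1≤Q^ n = ≤-resp (1^ n) refl (^-mono n 0≤1 1≤Q)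
      0≤Q^ : ∀ n → 0ℚ ≤ Q ↑ n
      0≤Q^ n = ^-nonneg n 0≤Q
      1≤r : 1ℚ ≤ r
      1≤r = ≤-resp ♯-1 refl (♯-mono (ℕ.s≤s ℕ.z≤n))
      0≤r : 0ℚ ≤ r
      0≤r = ♯-nonneg R
      r≤R₂ : r ≤ R₂
      r≤R₂ = ♯-mono (ℕₚ.m≤m+n R R)
      1≤R₂ = ≤-trans 1≤r r≤R₂
      0≤R₂ = ♯-nonneg (R ℕ.+ R)
      0≤R₂² : 0ℚ ≤ R₂ * R₂
      0≤R₂² = *-nonneg 0≤R₂ 0≤R₂
      0≤2 : 0ℚ ≤ 1ℚ + 1ℚ
      0≤2 = +-nonneg 0≤1 0≤1
      0≤C : 0ℚ ≤ Γ
      0≤C = *-nonneg (*-nonneg 0≤2 (*-nonneg 0≤Q 0≤Q)) (0≤Q^ r-1)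

      1*1≤ : ∀ {a b} → 1ℚ ≤ a → 1ℚ ≤ b → 1ℚ ≤ a * b
      1*1≤ {a} {b} h k = ≤-resp (*-identityˡ 1ℚ) refl (*-mono 0≤1 (≤-trans 0≤1 k) h k)

      1≤C : 1ℚ ≤ Γ
      1≤C = 1*1≤ (1*1≤ (≤-+ʳ 0≤1) (1*1≤ 1≤Q 1≤Q)) (1≤Q^ r-1)

    module _ (0<κ : 0ℚ < κ) (small : smallness * κ ≤ 1ℚ) where

      private
        J₀ J D T′ : ℕ
        -- `J` exceeds Q / κ, so that the discretisation error η Q² is at most κ. It also exceeds
        -- |V| and 2R, so that |V| h and m h stay below 1.
        J₀ = proj₁ (archimedean (Q * inv κ))
        J = suc (J₀ ℕ.+ (length V ℕ.+ (R ℕ.+ R)))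
        -- `D` steps of size η = 1 / D would bring β from 1 to 0; stopping J steps earlier, after
        -- `T′`, leaves β = J η = ι.
        D = suc q-1 ℕ.* J
        T′ = q-1 ℕ.* J

        j η : ℚ
        j = ♯ J
        η = inv (♯ D)

        0<D : 0ℚ < ♯ D
        0<D = ≤-<-pos
          where
          ≤-<-pos : 0ℚ < ♯ D
          ≤-<-pos = ♯-pos _
        0<η : 0ℚ < η
        0<η = inv-pos 0<D
        0≤η = ℚₚ.<⇒≤ 0<η
        Dη : ♯ D * η ≡ 1ℚ
        Dη = *-inv 0<D
        D≡ : ♯ D ≡ Q * j
        D≡ = ♯-* (suc q-1) J
        D≡′ : ♯ D ≡ j + ♯ T′
        D≡′ = ♯-+ J T′

        jη : j * η ≡ ι
        jη = trans (sym (*-identityˡ _)) (trans (cong (_* (j * η)) (sym Qι)) (trans (eq Q ι j η)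
          (trans (cong (ι *_) (trans (cong (_* η) (sym D≡)) Dη)) (*-identityʳ ι))))
          where
          opaque
            unfolding _+_
            eq : ∀ q i j e → q * i * (j * e) ≡ i * (q * j * e)
            eq = solve-∀ ℚ-ring

        Tη : ♯ T′ * η ≡ 1ℚ - ι
        Tη = trans (eq (♯ T′) j η) (cong₂ _-_ (trans (cong (_* η) (sym D≡′)) Dη) jη)
          where
          opaque
            unfolding _+_
            eq : ∀ t j e → t * e ≡ (j + t) * e - j * e
            eq = solve-∀ ℚ-ring

        ηQj : η * Q * j ≡ 1ℚ
        ηQj = trans (eq η Q j) (trans (cong (_* η) (sym D≡)) Dη)
          where
          opaque
            unfolding _+_
            eq : ∀ e q j → e * q * j ≡ q * j * e
            eq = solve-∀ ℚ-ring

        0≤ηQ : 0ℚ ≤ η * Q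
        0≤ηQ = *-nonneg 0≤η 0≤Q

        -- β decreases linearly from 1 to ι; the degree expected inside U is μ, and c exceeds it by a factor 1 + ι.
        β h μ c σ : ℕ → ℚ
        β t = 1ℚ - ♯ (t ℕ.⊓ T′) * η
        h t = η * inv (β t)
        μ t = β t ↑ r-1
        c t = (1ℚ + ι) * μ t
        σ t = h t * inv (c t)

        -- The truncation at `T′` inside `β` is what gives this for all t; several fields of
        -- `Schedule` quantify over all t.
        β≥ι : ∀ t → ι ≤ β t
        β≥ι t = ≤-trans (≤-reflexive (trans (eq ι) (cong (1ℚ -_) (sym Tη))))
          (sub-mono ≤-refl (*-monoʳ 0≤η (♯-mono (ℕₚ.m⊓n≤n t T′))))
          where
          opaque
            unfolding _+_
            eq : ∀ i → i ≡ 1ℚ - (1ℚ - i)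
            eq = solve-∀ ℚ-ring

        0<β : ∀ t → 0ℚ < β t
        0<β t = ℚₚ.<-≤-trans 0<ι (β≥ι t)
        0≤β : ∀ t → 0ℚ ≤ β t
        0≤β t = ℚₚ.<⇒≤ (0<β t)
        β≤1 : ∀ t → β t ≤ 1ℚ
        β≤1 t = sub-≤ (*-nonneg (♯-nonneg (t ℕ.⊓ T′)) 0≤η)

        -- This turns the multiplicative recursion for β into the subtraction of η in every step.
        hβ : ∀ t → h t * β t ≡ η
        hβ t = trans (eq η (inv (β t)) (β t)) (trans (cong (η *_) (*-inv (0<β t))) (*-identityʳ η))
          where
          opaque
            unfolding _+_
            eq : ∀ e i b → e * i * b ≡ e * (b * i)
            eq = solve-∀ ℚ-ring

        0≤h : ∀ t → 0ℚ ≤ h t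
        0≤h t = *-nonneg 0≤η (inv-nonneg (0<β t))

        h≤ηQ : ∀ t → h t ≤ η * Q
        h≤ηQ t = *-monoˡ 0≤η (inv-≤ (0<β t) (≤-trans (≤-reflexive (sym (trans (*-comm ι Q) Qι))) (*-monoʳ 0≤Q (β≥ι t))))

        n*h≤1 : ∀ {n} t → 0ℚ ≤ n → n ≤ j → n * h t ≤ 1ℚ
        n*h≤1 {n} t 0≤n n≤j = ≤-trans (*-mono 0≤n 0≤ηQ n≤j (h≤ηQ t)) (≤-reflexive (trans (*-comm j _) ηQj))

        βQ : ∀ t → 1ℚ ≤ μ t * Q ↑ r-1
        βQ t = ≤-trans (≤-reflexive (trans (sym (trans (cong (_↑ r-1) (trans (*-comm ι Q) Qι)) (1^ r-1))) (^-* ι Q r-1)))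
          (*-monoʳ (0≤Q^ r-1) (^-mono r-1 0≤ι (β≥ι t)))

        0<μ : ∀ t → 0ℚ < μ t
        0<μ t = ^-pos r-1 (0<β t)
        0<c : ∀ t → 0ℚ < c t
        0<c t = *-pos (ℚₚ.<-≤-trans 0<1 (≤-+ʳ 0≤ι)) (0<μ t)

        0≤σ : ∀ t → 0ℚ ≤ σ t
        0≤σ t = *-nonneg (0≤h t) (inv-nonneg (0<c t))

        σc : ∀ t → h t ≡ σ t * c t
        σc t = sym (trans (eq (h t) (inv (c t)) (c t)) (trans (cong (h t *_) (*-inv (0<c t))) (*-identityʳ (h t))))
          where
          opaque
            unfolding _+_
            eq : ∀ h i c → h * i * c ≡ h * (c * i)
            eq = solve-∀ ℚ-ring

        σ≤ : ∀ t → σ t ≤ η * Q ↑ R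
        σ≤ t = ≤-trans (*-mono (0≤h t) (0≤Q^ r-1) (h≤ηQ t) (inv-≤ (0<c t) (≤-trans (βQ t) (*-monoʳ (0≤Q^ r-1) μ≤c))))
          (≤-reflexive (*-assoc η Q _))
          where
          μ≤c : μ t ≤ c t
          μ≤c = ≤-resp (*-identityˡ (μ t)) refl (*-monoʳ (ℚₚ.<⇒≤ (0<μ t)) (≤-+ʳ 0≤ι))

        J≥ : ∀ {n} → n ℕ.≤ length V ℕ.+ (R ℕ.+ R) → ♯ n ≤ j
        J≥ n≤ = ♯-mono (ℕₚ.≤-trans n≤ (ℕₚ.m≤n⇒m≤1+n (ℕₚ.m≤n+m _ J₀)))

        schedule : Schedule N
        schedule = record
          { T = T′ ; β = β ; h = h ; σ = σ ; c = c
          ; β-0 = trans (cong (λ z → 1ℚ - z * η) ♯-0) (eq₀ η)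
          ; β-suc = β-suc′
          ; β-nonneg = 0≤β
          ; β-≤1 = β≤1
          ; h≡σc = σc
          ; σ-nonneg = 0≤σ
          ; c-nonneg = λ t → ℚₚ.<⇒≤ (0<c t)
          ; N*h≤1 = λ t _ → n*h≤1 t (♯-nonneg (length V)) (J≥ (ℕₚ.m≤m+n (length V) _))
          ; h≤1 = λ t _ → ≤-resp (*-identityˡ (h t)) refl (n*h≤1 t 0≤1 (≤-resp ♯-1 refl (♯-mono (ℕ.s≤s ℕ.z≤n))))
          }
          where
          opaque
            unfolding _+_
            eq₀ : ∀ e → 1ℚ - 0ℚ * e ≡ 1ℚ
            eq₀ = solve-∀ ℚ-ring
            eq₁ : ∀ t e → 1ℚ - (1ℚ + t) * e ≡ (1ℚ - t * e) - e
            eq₁ = solve-∀ ℚ-ring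
            eq₂ : ∀ h b → b - h * b ≡ (1ℚ - h) * b
            eq₂ = solve-∀ ℚ-ring
          β-suc′ : ∀ t → t ℕ.< T′ → β (suc t) ≡ (1ℚ - h t) * β t
          β-suc′ t t<T = begin
            1ℚ - ♯ (suc t ℕ.⊓ T′) * η        ≡⟨ cong (λ m → 1ℚ - ♯ m * η) (ℕₚ.m≤n⇒m⊓n≡m t<T) ⟩
            1ℚ - ♯ (suc t) * η               ≡⟨ cong (λ z → 1ℚ - z * η) (♯-suc t) ⟩
            1ℚ - (1ℚ + ♯ t) * η              ≡⟨ eq₁ (♯ t) η ⟩
            1ℚ - ♯ t * η - η                 ≡⟨ cong₂ (λ m z → 1ℚ - ♯ m * η - z) (sym (ℕₚ.m≤n⇒m⊓n≡m (ℕₚ.<⇒≤ t<T)))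
                (sym (hβ t)) ⟩
            β t - h t * β t                  ≡⟨ eq₂ (h t) (β t) ⟩
            (1ℚ - h t) * β t                 ∎
            where open ≡-Reasoning

        open Nibble H schedule
        open Gain H schedule using (matching)
        open Process h p

        -- `e` bounds the error of one step after inserting h ≤ η Q and σ ≤ η Q^R; `τ` is `D` times
        -- `e` and so covers the whole run.
        e τ : ℚ
        e = R₂ * R₂ * (η * Q * (η * Q)) + R₂ * R₂ * (η * Q ↑ R * κ)
        τ = R₂ * R₂ * (η * Q * Q + Q ↑ R * κ)

        0≤κ = κ-nonneg

        0≤e : 0ℚ ≤ e
        0≤e = +-nonneg (*-nonneg 0≤R₂² (*-nonneg 0≤ηQ 0≤ηQ)) (*-nonneg 0≤R₂² (*-nonneg (*-nonneg 0≤η (0≤Q^ R)) 0≤κ))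

        0≤τ : 0ℚ ≤ τ
        0≤τ = *-nonneg 0≤R₂² (+-nonneg (*-nonneg 0≤ηQ 0≤Q) (*-nonneg (0≤Q^ R) 0≤κ))

        t*e≤τ : ∀ t → t ℕ.≤ T′ → ♯ t * e ≤ τ
        t*e≤τ t t≤T = ≤-trans (*-monoʳ 0≤e (♯-mono (ℕₚ.≤-trans t≤T (ℕₚ.m≤n+m T′ J))))
          (≤-reflexive (trans (eq (♯ D) (R₂ * R₂) η Q (Q ↑ R) κ) (trans (cong (_* τ) Dη) (*-identityˡ τ))))
          where
          opaque
            unfolding _+_
            eq : ∀ d s e q p k → d * (s * (e * q * (e * q)) + s * (e * p * k)) ≡ d * e * (s * (e * q * q + p * k))
            eq = solve-∀ ℚ-ring

        short : ∀ {m} → m ℕ.≤ suc r-1 ℕ.+ r-1 → m ℕ.≤ R ℕ.+ R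
        short m≤ = ℕₚ.≤-trans m≤ (ℕₚ.+-monoʳ-≤ R (ℕₚ.n≤1+n r-1))

        m*h : ∀ {m} → m ℕ.≤ suc r-1 ℕ.+ r-1 → ∀ t → t ℕ.< T′ → ♯ m * h t ≤ 1ℚ
        m*h m≤ t _ = n*h≤1 t (♯-nonneg _) (J≥ (ℕₚ.≤-trans (short m≤) (ℕₚ.m≤n+m _ (length V))))

        e≥ : ∀ {m} → m ℕ.≤ suc r-1 ℕ.+ r-1 → ∀ t → t ℕ.< T′ → ♯ m * ♯ m * (h t * h t) + ♯ m * ♯ m * (σ t * κ) ≤ e
        e≥ {m} m≤ t _ = +-mono-≤
            (*-mono 0≤mm (*-nonneg 0≤ηQ 0≤ηQ) mm≤ (*-mono (0≤h t) 0≤ηQ (h≤ηQ t) (h≤ηQ t)))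
            (*-mono 0≤mm (*-nonneg (*-nonneg 0≤η (0≤Q^ R)) 0≤κ) mm≤ (*-monoʳ 0≤κ (σ≤ t)))
          where
          0≤mm : 0ℚ ≤ ♯ m * ♯ m
          0≤mm = *-nonneg (♯-nonneg m) (♯-nonneg m)
          mm≤ : ♯ m * ♯ m ≤ R₂ * R₂
          mm≤ = *-mono (♯-nonneg m) 0≤R₂ (♯-mono (short m≤)) (♯-mono (short m≤))

        upper : ∀ t → t ℕ.< T′ → ∀ A → Unique A → (∀ x → x ∈ A → x ∈ V) → length A ℕ.≤ suc r-1 ℕ.+ r-1 →
          𝔼 t (avail A) ≤ β t ↑ length A + τ
        upper t t<T A uA A⊆V lenA = ≤-trans (P-upper A uA A⊆V e (m*h lenA) (e≥ lenA) t (ℕₚ.<⇒≤ t<T))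
          (+-monoʳ-≤ (β t ↑ length A) (t*e≤τ t (ℕₚ.<⇒≤ t<T)))

        lower : ∀ t → t ℕ.< T′ → ∀ A → Unique A → (∀ x → x ∈ A → x ∈ V) → length A ℕ.≤ suc r-1 ℕ.+ r-1 →
          β t ↑ length A - τ ≤ 𝔼 t (avail A)
        lower t t<T A uA A⊆V lenA = ≤-trans (sub-mono ≤-refl (t*e≤τ t (ℕₚ.<⇒≤ t<T)))
          (P-lower A uA A⊆V e (m*h lenA) (e≥ lenA) t (ℕₚ.<⇒≤ t<T))

        C≥ : ∀ t → 1ℚ + ι ≤ Γ * (ι * ι * μ t)
        C≥ t = begin
          1ℚ + ι                                                   ≤⟨ +-monoʳ-≤ 1ℚ ι≤1 ⟩
          1ℚ + 1ℚ                                                  ≡⟨ sym (*-identityʳ _) ⟩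
          (1ℚ + 1ℚ) * 1ℚ                                           ≤⟨ *-monoˡ 0≤2 (βQ t) ⟩
          (1ℚ + 1ℚ) * (μ t * Q ↑ r-1)                              ≡⟨ eq (1ℚ + 1ℚ) (μ t) (Q ↑ r-1) ⟩
          (1ℚ + 1ℚ) * (μ t * Q ↑ r-1) * (1ℚ * 1ℚ)                  ≡⟨ cong (λ z → (1ℚ + 1ℚ) * (μ t * Q ↑ r-1) * (z * z))
              (sym Qι) ⟩
          (1ℚ + 1ℚ) * (μ t * Q ↑ r-1) * (Q * ι * (Q * ι))          ≡⟨ eq′ (1ℚ + 1ℚ) (μ t) (Q ↑ r-1) Q ι ⟩
          Γ * (ι * ι * μ t) ∎
          where
          open ℚₚ.≤-Reasoning
          opaque
            unfolding _+_
            eq : ∀ a m p → a * (m * p) ≡ a * (m * p) * (1ℚ * 1ℚ)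
            eq = solve-∀ ℚ-ring
            eq′ : ∀ a m p q i → a * (m * p) * (q * i * (q * i)) ≡ a * (q * q) * p * (i * i * m)
            eq′ = solve-∀ ℚ-ring

        -- This is `τ` with the discretisation term η Q² enlarged to the codegree term Q^R κ, so
        -- that everything is proportional to κ.
        τ₁ : ℚ
        τ₁ = (1ℚ + 1ℚ) * (R₂ * R₂ * Q ↑ R) * κ

        τ≤τ₁ : τ ≤ τ₁
        τ≤τ₁ = ≤-trans (*-monoˡ 0≤R₂² (+-monoˡ-≤ (Q ↑ R * κ) (≤-trans ηQQ≤κ
            (≤-resp (*-identityˡ κ) refl (*-monoʳ 0≤κ (1≤Q^ R))))))
          (≤-reflexive (eq (R₂ * R₂) (Q ↑ R) κ))
          where
          opaque
            unfolding _+_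
            eq : ∀ s p k → s * (p * k + p * k) ≡ (1ℚ + 1ℚ) * (s * p) * k
            eq = solve-∀ ℚ-ring
          Q≤jκ : Q ≤ j * κ
          Q≤jκ = ≤-resp (trans (*-assoc Q _ κ) (trans (cong (Q *_) (trans (*-comm _ κ) (*-inv 0<κ))) (*-identityʳ Q))) refl
            (*-monoʳ 0≤κ (≤-trans (proj₂ (archimedean (Q * inv κ))) (♯-mono (ℕₚ.m≤n⇒m≤1+n (ℕₚ.m≤m+n J₀ _)))))
          ηQQ≤κ : η * Q * Q ≤ κ
          ηQQ≤κ = ≤-trans (*-monoˡ 0≤ηQ Q≤jκ) (≤-reflexive (trans (sym (*-assoc (η * Q) j κ))
              (trans (cong (_* κ) ηQj) (*-identityˡ κ))))

        rκ≤τ₁ : r * κ ≤ τ₁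
        rκ≤τ₁ = *-monoʳ 0≤κ (≤-trans (≤-trans (≤-resp (*-identityʳ r) refl (*-mono 0≤r 0≤R₂ r≤R₂ 1≤R₂))
          (≤-resp (*-identityʳ _) refl (*-monoˡ 0≤R₂² (1≤Q^ R))))
          (≤-resp (*-identityˡ _) refl (*-monoʳ (*-nonneg 0≤R₂² (0≤Q^ R)) (≤-+ʳ {1ℚ} 0≤1))))

        0≤τ₁ : 0ℚ ≤ τ₁
        0≤τ₁ = ≤-trans 0≤τ τ≤τ₁

        loss : ℚ
        loss = τ + r * (Γ * (τ + r * κ + (1ℚ + 1ℚ) * τ + τ))

        -- The origin of `six`: one for the leading `τ` and 1 + 1 + 2 + 1 for the summands in the
        -- bracket, each bounded by `τ₁`.
        loss-≤ : loss ≤ six * (r * (Γ * τ₁))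
        loss-≤ = ≤-trans (+-mono-≤
            (≤-trans τ≤τ₁ (≤-resp (*-identityˡ τ₁) (*-assoc r Γ τ₁) (*-monoʳ 0≤τ₁ (1*1≤ 1≤r 1≤C))))
            (*-monoˡ 0≤r (*-monoˡ 0≤C (+-mono-≤ (+-mono-≤ (+-mono-≤ τ≤τ₁ rκ≤τ₁) (*-monoˡ 0≤2 τ≤τ₁)) τ≤τ₁))))
          (≤-reflexive (eq r Γ τ₁))
          where
          opaque
            unfolding _+_
            eq : ∀ r Γ t → r * (Γ * t) + r * (Γ * (t + t + (1ℚ + 1ℚ) * t + t)) ≡ (1ℚ + (1ℚ + 1ℚ + 1ℚ + 1ℚ + 1ℚ)) * (r * (Γ * t))
            eq = solve-∀ ℚ-ring

        0≤loss : 0ℚ ≤ loss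
        0≤loss = +-nonneg 0≤τ (*-nonneg 0≤r (*-nonneg 0≤C (+-nonneg
            (+-nonneg (+-nonneg 0≤τ (*-nonneg 0≤r 0≤κ)) (*-nonneg 0≤2 0≤τ)) 0≤τ)))

        loss-small : Q ↑ R * loss ≤ ι
        loss-small = *-cancelˡ 0<Q (≤-trans (*-monoˡ 0≤Q (*-monoˡ (0≤Q^ R) loss-≤))
          (≤-trans (≤-reflexive (eq Q (Q ↑ R) six r Γ ((1ℚ + 1ℚ) * (R₂ * R₂ * Q ↑ R)) κ))
              (≤-trans small (≤-reflexive (sym Qι)))))
          where
          opaque
            unfolding _+_
            eq : ∀ q p s r Γ a k → q * (p * (s * (r * (Γ * (a * k))))) ≡ q * (p * (s * (r * (Γ * a)))) * k
            eq = solve-∀ ℚ-ring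

        -- Of the two ι, one pays for the factor 1 + ι in the cap `c`, the other for `loss`.
        γ : ℚ
        γ = η * (1ℚ - ι - ι)

        σβ : ∀ t → σ t * (β t ↑ R) * (1ℚ + ι) ≡ η
        σβ t = trans (eq (σ t) (β t) (μ t) ι) (trans (cong (_* β t) (sym (σc t))) (hβ t))
          where
          opaque
            unfolding _+_
            eq : ∀ s b m i → s * (b * m) * (1ℚ + i) ≡ s * ((1ℚ + i) * m) * b
            eq = solve-∀ ℚ-ring

        γ≤ : ∀ t → t ℕ.< T′ → γ ≤ σ t * (β t ↑ R - τ - r * (Γ * (τ + r * κ + (1ℚ + 1ℚ) * τ + τ)))
        γ≤ t t<T = begin
          η * (1ℚ - ι - ι)                                ≡⟨ eq₁ η ι ⟩
          η * (1ℚ - ι) - η * ι                            ≤⟨ sub-mono main (*-monoˡ 0≤η loss-small) ⟩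
          σ t * β t ↑ R - η * (Q ↑ R * loss)              ≤⟨ sub-mono ≤-refl
              (≤-resp refl (*-assoc η _ loss) (*-monoʳ 0≤loss (σ≤ t))) ⟩
          σ t * β t ↑ R - σ t * loss                      ≡⟨ eq₂ (σ t) (β t ↑ R) τ _ ⟩
          σ t * (β t ↑ R - τ - r * (Γ * (τ + r * κ + (1ℚ + 1ℚ) * τ + τ))) ∎
          where
          open ℚₚ.≤-Reasoning
          opaque
            unfolding _+_
            eq₁ : ∀ e i → e * (1ℚ - i - i) ≡ e * (1ℚ - i) - e * i
            eq₁ = solve-∀ ℚ-ring
            eq₂ : ∀ s b t l → s * b - s * (t + l) ≡ s * (b - t - l)
            eq₂ = solve-∀ ℚ-ring
            eq₃ : ∀ s i → s ≡ s * (1ℚ + i) * (1ℚ - i) + s * (i * i)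
            eq₃ = solve-∀ ℚ-ring
          main : η * (1ℚ - ι) ≤ σ t * β t ↑ R
          main = ≤-resp (cong (_* (1ℚ - ι)) (σβ t)) refl
            (≤-cert (*-nonneg (*-nonneg (0≤σ t) (^-nonneg R (0≤β t))) (*-nonneg 0≤ι 0≤ι)) (eq₃ (σ t * β t ↑ R) ι))

      -- Two of the three ι come from `γ`, the third from stopping at β = ι, that is, from T′ η = 1
      -- - ι.
      nibble : ∃ λ M → IsMatching M × (1ℚ - (ι + ι + ι)) * N ≤ r * ♯ (length M)
      nibble = proj₁ result , proj₁ (proj₂ result) , ≤-trans (≤-trans
          (*-monoʳ (♯-nonneg (length V)) (≤-cert (+-nonneg (*-nonneg 0≤ι 0≤ι) (*-nonneg 0≤ι 0≤ι)) (eq ι)))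
          (≤-reflexive (trans (cong (λ z → z * (1ℚ - ι - ι) * N) (sym Tη)) (eq′ (♯ T′) η (1ℚ - ι - ι) N))))
              (proj₂ (proj₂ result))
        where
        result : ∃ λ M → IsMatching M × ♯ T′ * (γ * N) ≤ r * ♯ (length M)
        result = matching ι Γ τ 0≤ι 0≤C 0≤τ (λ _ → refl) C≥ upper lower γ γ≤
        opaque
          unfolding _+_
          eq : ∀ i → (1ℚ - i) * (1ℚ - i - i) ≡ 1ℚ - (i + i + i) + (i * i + i * i)
          eq = solve-∀ ℚ-ring
          eq′ : ∀ t e g n → t * e * g * n ≡ t * (e * g * n)
          eq′ = solve-∀ ℚ-ring

-- Symmetric functions summed over tuples, and the gadget identity.

module SymmetricSums where

  open Arithmetic
  open RandomGreedy

  private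
    variable
      A : Set

  ∑-↭ : ∀ {x y : List A} (g : A → ℚ) → x ↭ y → ∑ x g ≡ ∑ y g
  ∑-↭ g Perm.refl = refl
  ∑-↭ g (Perm.prep a p) = cong (g a +_) (∑-↭ g p)
  ∑-↭ g (Perm.swap a b p) = trans (cong (λ z → g a + (g b + z)) (∑-↭ g p)) (eq (g a) (g b) _)
    where
    opaque
      unfolding _+_
      eq : ∀ a b c → a + (b + c) ≡ b + (a + c)
      eq = solve-∀ ℚ-ring
  ∑-↭ g (Perm.trans p q) = trans (∑-↭ g p) (∑-↭ g q)

  allᵇ-↭ : ∀ {x y : List A} (P : A → Bool) → x ↭ y → allᵇ P x ≡ allᵇ P y
  allᵇ-↭ P Perm.refl = refl
  allᵇ-↭ P (Perm.prep a p) = cong (P a ∧_) (allᵇ-↭ P p)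
  allᵇ-↭ P (Perm.swap a b p) rewrite allᵇ-↭ P p with P a | P b
  ... | true | _ = refl
  ... | false | true = refl
  ... | false | false = refl
  allᵇ-↭ P (Perm.trans p q) = trans (allᵇ-↭ P p) (allᵇ-↭ P q)

  Symmetric : (List A → ℚ) → Set
  Symmetric φ = ∀ {x y} → x ↭ y → φ x ≡ φ y

  module Tuples {A : Set} (vs : List A) where

    tuples : ℕ → List (List A)
    tuples zero = [] ∷ []
    tuples (suc m) = concatMap (λ v → map (v ∷_) (tuples m)) vs

    -- An iterated sum rather than a sum over `tuples`: its variables can be exchanged one by one
    -- with `∑-swap`.
    ∑^ : ℕ → (List A → ℚ) → ℚ
    ∑^ zero φ = φ []
    ∑^ (suc m) φ = ∑ vs (λ v → ∑^ m (λ x → φ (v ∷ x)))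

    ∑-tuples : ∀ m φ → ∑ (tuples m) φ ≡ ∑^ m φ
    ∑-tuples zero φ = +-identityʳ (φ [])
    ∑-tuples (suc m) φ = trans (go vs) (∑-cong vs (λ v → trans (∑-map (v ∷_) (tuples m) φ) (∑-tuples m _)))
      where
      go : ∀ L → ∑ (concatMap (λ v → map (v ∷_) (tuples m)) L) φ ≡ ∑ L (λ v → ∑ (map (v ∷_) (tuples m)) φ)
      go [] = refl
      go (v ∷ L) = trans (∑-++ (map (v ∷_) (tuples m)) _ φ) (cong (∑ (map (v ∷_) (tuples m)) φ +_) (go L))

    ∈-tuples-length : ∀ m {x} → x ∈ tuples m → length x ≡ m
    ∈-tuples-length zero (here refl) = refl
    ∈-tuples-length (suc m) x∈ = go vs x∈
      where
      go : ∀ L {x} → x ∈ concatMap (λ v → map (v ∷_) (tuples m)) L → length x ≡ suc m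
      go (v ∷ L) x∈ with ∈-++⁻ (map (v ∷_) (tuples m)) x∈
      ... | inj₂ x∈L = go L x∈L
      ... | inj₁ x∈v with ∈-map⁻ (v ∷_) x∈v
      ... | y , y∈ , refl = cong suc (∈-tuples-length m y∈)

    ∑^-cong : ∀ m {φ ψ} → (∀ x → length x ≡ m → φ x ≡ ψ x) → ∑^ m φ ≡ ∑^ m ψ
    ∑^-cong zero h = h [] refl
    ∑^-cong (suc m) h = ∑-cong vs (λ v → ∑^-cong m (λ x l → h (v ∷ x) (cong suc l)))

    ∑^-mono : ∀ m {φ ψ} → (∀ x → length x ≡ m → φ x ≤ ψ x) → ∑^ m φ ≤ ∑^ m ψ
    ∑^-mono zero h = h [] refl
    ∑^-mono (suc m) h = ∑-mono vs (λ v → ∑^-mono m (λ x l → h (v ∷ x) (cong suc l)))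

    ∑^-+ : ∀ m φ ψ → ∑^ m (λ x → φ x + ψ x) ≡ ∑^ m φ + ∑^ m ψ
    ∑^-+ zero φ ψ = refl
    ∑^-+ (suc m) φ ψ = trans (∑-cong vs (λ v → ∑^-+ m _ _)) (∑-+ vs _ _)

    ∑^-*ˡ : ∀ m c φ → ∑^ m (λ x → c * φ x) ≡ c * ∑^ m φ
    ∑^-*ˡ zero c φ = refl
    ∑^-*ˡ (suc m) c φ = trans (∑-cong vs (λ v → ∑^-*ˡ m c _)) (∑-*ˡ c vs _)

    ∑^-const : ∀ m c → ∑^ m (λ _ → c) ≡ ♯ (length vs) ↑ m * c
    ∑^-const zero c = sym (*-identityˡ c)
    ∑^-const (suc m) c = trans (∑-cong vs (λ _ → ∑^-const m c)) (trans (∑-const vs _) (sym (*-assoc (♯ (length vs)) _ c)))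

    ∑^-swap : ∀ m {B : Set} (L : List B) (f : List A → B → ℚ) → ∑^ m (λ x → ∑ L (f x)) ≡ ∑ L (λ b → ∑^ m (λ x → f x b))
    ∑^-swap zero L f = refl
    ∑^-swap (suc m) L f = trans (∑-cong vs (λ v → ∑^-swap m L _)) (∑-swap vs L _)

    symmetric-∷ : ∀ {Θ : List A → ℚ} a → Symmetric Θ → Symmetric (λ x → Θ (a ∷ x))
    symmetric-∷ a s p = s (Perm.prep a p)

    -- By symmetry the m coordinates of x contribute equally. The additional variable y is there for
    -- the induction: it changes places with the first entry of x.
    extract : ∀ m (g : A → ℚ) {Θ} → Symmetric Θ →
      ∑ vs (λ y → ∑^ m (λ x → ∑ x g * Θ (y ∷ x))) ≡ ♯ m * ∑ vs (λ y → g y * ∑^ m (λ x → Θ (y ∷ x)))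
    extract zero g s = trans (∑-cong vs (λ y → *-zeroˡ _)) (trans (∑-0 vs) (sym (trans (cong₂ _*_ ♯-0 refl) (*-zeroˡ _))))
    extract (suc m) g {Θ} s = begin
      ∑ vs (λ y → ∑ vs (λ a → ∑^ m (λ x → (g a + ∑ x g) * Θ (y ∷ a ∷ x))))
        ≡⟨ ∑-cong vs (λ y → trans (∑-cong vs (λ a → trans (∑^-cong m (λ x _ → *-distribʳ-+ _ (g a) (∑ x g))) (∑^-+ m _ _)))
            (∑-+ vs _ _)) ⟩
      ∑ vs (λ y → ∑ vs (λ a → ∑^ m (λ x → g a * Θ (y ∷ a ∷ x))) + ∑ vs (λ a → ∑^ m (λ x → ∑ x g * Θ (y ∷ a ∷ x))))
        ≡⟨ ∑-+ vs _ _ ⟩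
      ∑ vs (λ y → ∑ vs (λ a → ∑^ m (λ x → g a * Θ (y ∷ a ∷ x)))) + ∑ vs
          (λ y → ∑ vs (λ a → ∑^ m (λ x → ∑ x g * Θ (y ∷ a ∷ x))))
        ≡⟨ cong₂ _+_ first second ⟩
      S + ♯ m * S
        ≡⟨ trans (eq S (♯ m)) (cong (_* S) (sym (♯-suc m))) ⟩
      ♯ (suc m) * S ∎
      where
      open ≡-Reasoning
      S = ∑ vs (λ y → g y * ∑^ (suc m) (λ x → Θ (y ∷ x)))
      opaque
        unfolding _+_
        eq : ∀ s m → s + m * s ≡ (1ℚ + m) * s
        eq = solve-∀ ℚ-ring
      swapped : ∑ vs (λ y → ∑ vs (λ a → g a * ∑^ m (λ x → Θ (y ∷ a ∷ x)))) ≡ S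
      swapped = trans (∑-swap vs vs _) (∑-cong vs (λ a → trans (∑-*ˡ (g a) vs _)
        (cong (g a *_) (∑-cong vs (λ y → ∑^-cong m (λ x _ → s (Perm.swap y a ↭-refl)))))))
      first : ∑ vs (λ y → ∑ vs (λ a → ∑^ m (λ x → g a * Θ (y ∷ a ∷ x)))) ≡ S
      first = trans (∑-cong vs (λ y → ∑-cong vs (λ a → ∑^-*ˡ m (g a) _))) swapped
      second : ∑ vs (λ y → ∑ vs (λ a → ∑^ m (λ x → ∑ x g * Θ (y ∷ a ∷ x)))) ≡ ♯ m * S
      second = trans (∑-cong vs (λ y → extract m g (symmetric-∷ y s))) (trans (∑-*ˡ (♯ m) vs _) (cong (♯ m *_) swapped))

    extract-all : ∀ m (g : A → ℚ) {Θ} → Symmetric Θ →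
      ∑^ (suc m) (λ x → ∑ x g * Θ x) ≡ ♯ (suc m) * ∑ vs (λ v → g v * ∑^ m (λ x → Θ (v ∷ x)))
    extract-all m g {Θ} s = trans (∑-cong vs (λ v → trans (∑^-cong m (λ x _ → *-distribʳ-+ _ (g v) (∑ x g))) (∑^-+ m _ _)))
      (trans (∑-+ vs _ _) (trans (cong₂ _+_ (∑-cong vs (λ v → ∑^-*ˡ m (g v) _)) (extract m g s))
        (trans (eq _ (♯ m)) (cong₂ _*_ (sym (♯-suc m)) refl))))
      where
      opaque
        unfolding _+_
        eq : ∀ s m → s + m * s ≡ (1ℚ + m) * s
        eq = solve-∀ ℚ-ring

    module Pairs (b : A → A → ℚ) (b-sym : ∀ u v → b u v ≡ b v u) where

      pairs : List A → ℚ
      pairs [] = 0ℚ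
      pairs (a ∷ x) = ∑ x (b a) + pairs x

      pairs-↭ : Symmetric pairs
      pairs-↭ Perm.refl = refl
      pairs-↭ (Perm.prep a p) = cong₂ _+_ (∑-↭ (b a) p) (pairs-↭ p)
      pairs-↭ {_ ∷ _ ∷ x} {_ ∷ _ ∷ y} (Perm.swap a c p) = trans
        (cong₂ _+_ (cong₂ _+_ (b-sym a c) (∑-↭ (b a) p)) (cong₂ _+_ (∑-↭ (b c) p) (pairs-↭ p)))
        (eq (b c a) (∑ y (b a)) (∑ y (b c)) (pairs y))
        where
        opaque
          unfolding _+_
          eq : ∀ b s t p → (b + s) + (t + p) ≡ (b + t) + (s + p)
          eq = solve-∀ ℚ-ring
      pairs-↭ (Perm.trans p q) = trans (pairs-↭ p) (pairs-↭ q)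

      -- In the gadget, y and z are the two vertices of a (k + 2)-clique that are left out of the
      -- k-clique made of x and a fixed edge.
      ⟪_⟫ : (A → A → List A → ℚ) → ℕ → (List A → ℚ) → ℚ
      ⟪ F ⟫ m Ψ = ∑ vs (λ y → ∑ vs (λ z → ∑^ m (λ x → F y z x * Ψ (y ∷ z ∷ x))))

      ⟪⟫-cong : ∀ m {F F′ : A → A → List A → ℚ} {Ψ} → (∀ y z x → F y z x ≡ F′ y z x) → ⟪ F ⟫ m Ψ ≡ ⟪ F′ ⟫ m Ψ
      ⟪⟫-cong m h = ∑-cong vs (λ y → ∑-cong vs (λ z → ∑^-cong m (λ x _ → cong₂ _*_ (h y z x) refl)))

      ⟪⟫-+ : ∀ m F F′ Ψ → ⟪ (λ y z x → F y z x + F′ y z x) ⟫ m Ψ ≡ ⟪ F ⟫ m Ψ + ⟪ F′ ⟫ m Ψ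
      ⟪⟫-+ m F F′ Ψ = trans (∑-cong vs (λ y → trans (∑-cong vs (λ z →
          trans (∑^-cong m (λ x _ → *-distribʳ-+ _ (F y z x) _)) (∑^-+ m _ _)))
        (∑-+ vs _ _))) (∑-+ vs _ _)

      ⟪⟫-*ˡ : ∀ m c F Ψ → ⟪ (λ y z x → c * F y z x) ⟫ m Ψ ≡ c * ⟪ F ⟫ m Ψ
      ⟪⟫-*ˡ m c F Ψ = trans (∑-cong vs (λ y → trans (∑-cong vs (λ z →
          trans (∑^-cong m (λ x _ → *-assoc c (F y z x) _)) (∑^-*ˡ m c _)))
        (∑-*ˡ c vs _))) (∑-*ˡ c vs _)

      ⟪⟫-flip : ∀ m F {Ψ} → Symmetric Ψ → ⟪ (λ y z x → F z y x) ⟫ m Ψ ≡ ⟪ F ⟫ m Ψ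
      ⟪⟫-flip m F s = trans (∑-swap vs vs _) (∑-cong vs (λ y → ∑-cong vs
          (λ z → ∑^-cong m (λ x _ → cong (F y z x *_) (s (Perm.swap z y ↭-refl))))))

      -- By symmetry the summation variables inside x may be traded for z.
      ⟪⟫-row : ∀ m (g : A → A → ℚ) {Ψ} → Symmetric Ψ →
        ⟪ (λ y z x → ∑ x (g y)) ⟫ m Ψ ≡ ♯ m * ⟪ (λ y z x → g y z) ⟫ m Ψ
      ⟪⟫-row m g {Ψ} s = trans (∑-cong vs (λ y → trans (extract m (g y) (symmetric-∷ y s))
        (cong (♯ m *_) (∑-cong vs (λ z → sym (∑^-*ˡ m (g y z) _)))))) (∑-*ˡ (♯ m) vs _)

      private
        edge : A → A → List A → ℚ
        edge y z x = b y z

        peel : ∀ m (F : A → A → List A → ℚ) Ψ → ⟪ F ⟫ (suc m) Ψ ≡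
          ∑ vs (λ a → ∑ vs (λ y → ∑ vs (λ z → ∑^ m (λ x → F y z (a ∷ x) * Ψ (y ∷ z ∷ a ∷ x)))))
        peel m F Ψ = trans (∑-cong vs (λ y → ∑-swap vs vs _)) (∑-swap vs vs _)

        to-front : ∀ {y z a : A} {x} → y ∷ z ∷ a ∷ x ↭ a ∷ y ∷ z ∷ x
        to-front {y} {z} {a} = ↭-trans (Perm.prep y (Perm.swap z a ↭-refl)) (Perm.swap y a ↭-refl)

      ⟪⟫-peel : ∀ m (F : A → A → List A → ℚ) {Ψ} → Symmetric Ψ → ⟪ F ⟫ (suc m) Ψ ≡
        ∑ vs (λ a → ⟪ (λ y z x → F y z (a ∷ x)) ⟫ m (λ x → Ψ (a ∷ x)))
      ⟪⟫-peel m F {Ψ} s = trans (peel m F Ψ) (∑-cong vs (λ a → ∑-cong vs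
          (λ y → ∑-cong vs (λ z → ∑^-cong m (λ x _ → cong₂ _*_ refl (s to-front))))))

      -- A tuple of length m has m (m - 1) ordered pairs of places, and each can be moved to y and
      -- z. Peeling off one variable separates the pairs that use it from the others.
      ⟪⟫-pairs : ∀ m {Ψ} → Symmetric Ψ →
        ⟪ (λ y z x → (1ℚ + 1ℚ) * pairs x) ⟫ m Ψ ≡ ♯ m * (♯ m - 1ℚ) * ⟪ (λ y z x → b y z) ⟫ m Ψ
      ⟪⟫-pairs zero {Ψ} s = trans (∑-cong vs (λ y → trans (∑-cong vs (λ z → eq₀ (Ψ (y ∷ z ∷ [])))) (∑-0 vs))) (trans (∑-0 vs)
          (sym (trans (cong₂ _*_ (cong (λ n → n * (n - 1ℚ)) ♯-0) refl) (eq₁ _))))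
        where
        opaque
          unfolding _+_
          eq₀ : ∀ p → (1ℚ + 1ℚ) * 0ℚ * p ≡ 0ℚ
          eq₀ = solve-∀ ℚ-ring
          eq₁ : ∀ s → 0ℚ * (0ℚ - 1ℚ) * s ≡ 0ℚ
          eq₁ = solve-∀ ℚ-ring
      ⟪⟫-pairs (suc m) {Ψ} s = begin
        ⟪ (λ y z x → (1ℚ + 1ℚ) * pairs x) ⟫ (suc m) Ψ
          ≡⟨ ⟪⟫-peel m (λ y z x → (1ℚ + 1ℚ) * pairs x) s ⟩
        ∑ vs (λ a → ⟪ (λ y z x → (1ℚ + 1ℚ) * (∑ x (b a) + pairs x)) ⟫ m (Ψ′ a))
          ≡⟨ ∑-cong vs (λ a → trans (⟪⟫-cong m {Ψ = Ψ′ a} (λ y z x → *-distribˡ-+ _ (∑ x (b a)) (pairs x)))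
              (trans (⟪⟫-+ m _ _ (Ψ′ a))
               (cong₂ _+_ (trans (⟪⟫-*ˡ m _ _ (Ψ′ a)) (cong ((1ℚ + 1ℚ) *_) (⟪⟫-row m (λ _ → b a) (s′ a))))
                   (⟪⟫-pairs m (s′ a))))) ⟩
        ∑ vs (λ a → (1ℚ + 1ℚ) * (♯ m * ⟪ (λ y z x → b a z) ⟫ m (Ψ′ a)) + ♯ m * (♯ m - 1ℚ) * ⟪ edge ⟫ m (Ψ′ a))
          ≡⟨ trans (∑-+ vs _ _) (cong₂ _+_ (trans (∑-*ˡ _ vs _) (cong ((1ℚ + 1ℚ) *_) (∑-*ˡ (♯ m) vs _))) (∑-*ˡ _ vs _)) ⟩
        (1ℚ + 1ℚ) * (♯ m * ∑ vs (λ a → ⟪ (λ y z x → b a z) ⟫ m (Ψ′ a))) + ♯ m * (♯ m - 1ℚ) * ∑ vs (λ a → ⟪ edge ⟫ m (Ψ′ a))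
          ≡⟨ cong₂ (λ p q → (1ℚ + 1ℚ) * (♯ m * p) + ♯ m * (♯ m - 1ℚ) * q) rotate (sym (⟪⟫-peel m edge s)) ⟩
        (1ℚ + 1ℚ) * (♯ m * S) + ♯ m * (♯ m - 1ℚ) * S
          ≡⟨ trans (eq (♯ m) S) (cong (λ n → n * (n - 1ℚ) * S) (sym (♯-suc m))) ⟩
        ♯ (suc m) * (♯ (suc m) - 1ℚ) * S ∎
        where
        open ≡-Reasoning
        S = ⟪ edge ⟫ (suc m) Ψ
        Ψ′ : A → List A → ℚ
        Ψ′ a x = Ψ (a ∷ x)
        s′ : ∀ a → Symmetric (Ψ′ a)
        s′ a = symmetric-∷ a s
        opaque
          unfolding _+_
          eq : ∀ m s → (1ℚ + 1ℚ) * (m * s) + m * (m - 1ℚ) * s ≡ (1ℚ + m) * (1ℚ + m - 1ℚ) * s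
          eq = solve-∀ ℚ-ring
        rotate : ∑ vs (λ a → ⟪ (λ y z x → b a z) ⟫ m (Ψ′ a)) ≡ S
        rotate = ∑-cong vs (λ a → trans (∑-swap vs vs _) (∑-cong vs (λ z → ∑-cong vs (λ y → ∑^-cong m (λ x _ →
          cong (b a z *_) (s (Perm.prep a (Perm.swap y z ↭-refl))))))))

      -- The weights 2, - m and m (m + 1) of an edge meeting a k-set of a (k + 2)-set in 2, 1 or 0 vertices
      -- (m = k - 2) add up to 0 over the k-sets containing any other given edge.
      bracket : ℚ → A → A → List A → ℚ
      bracket m y z x = (1ℚ + 1ℚ) * pairs x - m * (∑ x (b y) + ∑ x (b z)) + m * (m + 1ℚ) * b y z

      -- Sort the edges by how they meet the edge uv. One common vertex gives total coefficient 2m -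
      -- 2m = 0, none gives m (m - 1) - 2m² + m (m + 1) = 0, and only uv itself survives.
      gadget : ∀ m u v {Ψ} → Symmetric Ψ →
        ⟪ (λ y z x → bracket (♯ m) y z (v ∷ u ∷ x)) ⟫ m Ψ ≡ ⟪ (λ y z x → (1ℚ + 1ℚ) * b v u) ⟫ m Ψ
      gadget m u v {Ψ} s = begin
        ⟪ (λ y z x → bracket M y z (v ∷ u ∷ x)) ⟫ m Ψ
          ≡⟨ ⟪⟫-cong m {Ψ = Ψ} (λ y z x → trans (cong₂ (λ p q → (1ℚ + 1ℚ) * (b v u + ∑ x
              (b v) + (∑ x (b u) + pairs x)) - M * (p + q) + M * (M + 1ℚ) * b y z)
               (cong₂ (λ p q → p + (q + ∑ x (b y))) (b-sym y v) (b-sym y u))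
                   (cong₂ (λ p q → p + (q + ∑ x (b z))) (b-sym z v) (b-sym z u)))
               (regroup M (b v u) (∑ x (b v)) (∑ x (b u)) (pairs x) (b v y) (b u y) (∑ x (b y)) (b v z) (b u z) (∑ x (b z))
                   (b y z))) ⟩
        ⟪ (λ y z x → (1ℚ + 1ℚ) * b v u + ((1ℚ + 1ℚ) * (∑ x (b v) + ∑ x (b u)) + ((1ℚ + 1ℚ) * pairs x
            + ((0ℚ - M) * (b v y + b u y + (b v z + b u z)) + ((0ℚ - M) * (∑ x (b y) + ∑ x (b z)) + M * (M + 1ℚ) * b y z)))))
                ⟫ m Ψ
          ≡⟨ trans (⟪⟫-+ m _ _ Ψ) (cong₂ _+_ refl (trans (⟪⟫-+ m _ _ Ψ) (cong₂ _+_ (trans (⟪⟫-*ˡ m _ _ Ψ) (cong ((1ℚ + 1ℚ) *_)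
               (trans (⟪⟫-+ m _ _ Ψ) (cong₂ _+_ (⟪⟫-row m (λ _ → b v) s) (⟪⟫-row m (λ _ → b u) s)))))
               (trans (⟪⟫-+ m _ _ Ψ) (cong₂ _+_ (⟪⟫-pairs m s) (trans (⟪⟫-+ m _ _ Ψ) (cong₂ _+_
                 (trans (⟪⟫-*ˡ m _ _ Ψ) (cong ((0ℚ - M) *_) (trans (⟪⟫-+ m _ _ Ψ) (cong₂ _+_
                    (trans (⟪⟫-+ m _ _ Ψ) (cong₂ _+_ (⟪⟫-flip m (λ y z x → b v z) s) (⟪⟫-flip m (λ y z x → b u z) s)))
                        (⟪⟫-+ m _ _ Ψ)))))
                 (trans (⟪⟫-+ m _ _ Ψ) (cong₂ _+_ (trans (⟪⟫-*ˡ m _ _ Ψ) (cong ((0ℚ - M) *_) (trans (⟪⟫-+ m _ _ Ψ) (cong₂ _+_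
                    (⟪⟫-row m b s) (trans (⟪⟫-flip m (λ y z x → ∑ x (b y)) s) (⟪⟫-row m b s))))))
                   (⟪⟫-*ˡ m _ _ Ψ)))))))))) ⟩
        B₀ + ((1ℚ + 1ℚ) * (M * Sv + M * Su) + (M * (M - 1ℚ) * S₀ + ((0ℚ - M) * (Sv + Su + (Sv + Su)) + ((0ℚ - M) * (M * S₀ + M * S₀) + M * (M + 1ℚ) * S₀))))
          ≡⟨ cancel M B₀ Sv Su S₀ ⟩
        B₀ ∎
        where
        open ≡-Reasoning
        M B₀ Sv Su S₀ : ℚ
        M = ♯ m
        B₀ = ⟪ (λ y z x → (1ℚ + 1ℚ) * b v u) ⟫ m Ψ
        Sv = ⟪ (λ y z x → b v z) ⟫ m Ψ
        Su = ⟪ (λ y z x → b u z) ⟫ m Ψ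
        S₀ = ⟪ edge ⟫ m Ψ
        opaque
          unfolding _+_
          regroup : ∀ m b sv su p vy uy sy vz uz sz yz →
            (1ℚ + 1ℚ) * (b + sv + (su + p)) - m * ((vy + (uy + sy)) + (vz + (uz + sz))) + m * (m + 1ℚ) * yz
            ≡ (1ℚ + 1ℚ) * b + ((1ℚ + 1ℚ) * (sv + su) + ((1ℚ + 1ℚ) * p
              + ((0ℚ - m) * (vy + uy + (vz + uz)) + ((0ℚ - m) * (sy + sz) + m * (m + 1ℚ) * yz))))
          regroup = solve-∀ ℚ-ring
          cancel : ∀ m b v u s → b + ((1ℚ + 1ℚ) * (m * v + m * u) + (m * (m - 1ℚ) * s + ((0ℚ - m) * (v + u + (v + u)) + ((0ℚ - m) * (m * s + m * s) + m * (m + 1ℚ) * s)))) ≡ b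
          cancel = solve-∀ ℚ-ring

-- Counting cliques in graphs of large minimum degree.

module CliqueCounts where

  open Arithmetic
  open RandomGreedy
  open Correlations
  open SymmetricSums

  inv-unique : ∀ {p x} → 0ℚ < p → p * x ≡ 1ℚ → x ≡ inv p
  inv-unique {p} {x} 0<p e = begin
    x                 ≡⟨ sym (*-identityʳ x) ⟩
    x * 1ℚ            ≡⟨ cong (x *_) (sym (*-inv 0<p)) ⟩
    x * (p * inv p)   ≡⟨ eq x p (inv p) ⟩
    (p * x) * inv p   ≡⟨ trans (cong (_* inv p) e) (*-identityˡ _) ⟩
    inv p             ∎
    where
    open ≡-Reasoning
    opaque
      unfolding _+_
      eq : ∀ x p i → x * (p * i) ≡ (p * x) * i
      eq = solve-∀ ℚ-ring

  module Cliques {n : ℕ} (G : Graph n) where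

    vs : List (Fin n)
    vs = allFin n

    open Tuples vs public
    open Membership {Fin n} Finₚ._≟_ public

    ν : ℚ
    ν = ♯ n

    ν≡ : ♯ (length vs) ≡ ν
    ν≡ = cong ♯ (Listₚ.length-tabulate (λ i → i))

    ∑vs-const : ∀ c → ∑ vs (λ _ → c) ≡ ν * c
    ∑vs-const c = trans (∑-const vs c) (cong (_* c) ν≡)

    -- Repeated vertices are ruled out by irreflexivity of `adj`, without a separate condition.
    isClique : List (Fin n) → Bool
    isClique [] = true
    isClique (a ∷ x) = allᵇ (adj G a) x ∧ isClique x

    cl : List (Fin n) → ℚ
    cl x = 𝟙 (isClique x)

    cl-nonneg : ∀ x → 0ℚ ≤ cl x
    cl-nonneg x = 𝟙-nonneg (isClique x)

    cl-∷ : ∀ a x → cl (a ∷ x) ≡ 𝟙 (allᵇ (adj G a) x) * cl x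
    cl-∷ a x = 𝟙-∧ (allᵇ (adj G a) x) (isClique x)

    cl-∷-≤ : ∀ a x → cl (a ∷ x) ≤ cl x
    cl-∷-≤ a x = ≤-resp (sym (cl-∷ a x)) (*-identityˡ _) (*-monoʳ (cl-nonneg x) (𝟙-≤1 (allᵇ (adj G a) x)))

    isClique-↭ : ∀ {x y} → x ↭ y → isClique x ≡ isClique y
    isClique-↭ Perm.refl = refl
    isClique-↭ (Perm.prep a p) = cong₂ _∧_ (allᵇ-↭ (adj G a) p) (isClique-↭ p)
    isClique-↭ (Perm.swap a c p) rewrite allᵇ-↭ (adj G a) p | allᵇ-↭ (adj G c) p | isClique-↭ p | adj-sym G a c =
        exchange (adj G c a) _ _ _
      where
      exchange : ∀ p q r s → (p ∧ q) ∧ (r ∧ s) ≡ (p ∧ r) ∧ (q ∧ s)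
      exchange false q r s = refl
      exchange true false false s = refl
      exchange true false true s = refl
      exchange true true false s = refl
      exchange true true true s = refl
    isClique-↭ (Perm.trans p q) = trans (isClique-↭ p) (isClique-↭ q)

    cl-↭ : Symmetric cl
    cl-↭ p = cong 𝟙 (isClique-↭ p)

    clique-adj : ∀ {a x c} → isClique (a ∷ x) ≡ true → c ∈ x → adj G a c ≡ true
    clique-adj {a} {x} e c∈ = allᵇ-∈ {P = adj G a} (Boolₚ.∧-conicalˡ (allᵇ (adj G a) x) _ e) c∈

    clique-tail : ∀ {a x} → isClique (a ∷ x) ≡ true → isClique x ≡ true
    clique-tail {a} {x} e = Boolₚ.∧-conicalʳ (allᵇ (adj G a) x) _ e

    clique-unique : ∀ {x} → isClique x ≡ true → Unique x
    clique-unique {[]} e = []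
    clique-unique {a ∷ x} e = All.tabulate (λ { {c} c∈ refl → case trans (sym (adj-irrefl G a))
        (clique-adj {a} {x} e c∈) of λ () })
      ∷ clique-unique (clique-tail {a} {x} e)

    -- Being a sum over x, this is accessible to `extract-all`, unlike the Boolean membership test;
    -- on cliques the two agree by `occ-unique`.
    occ : Fin n → List (Fin n) → ℚ
    occ u x = ∑ x (λ a → 𝟙 ⌊ a Finₚ.≟ u ⌋)

    occ-↭ : ∀ u → Symmetric (occ u)
    occ-↭ u = ∑-↭ _

    occ-unique : ∀ u {x} → Unique x → 𝟙 (u ∈ᵇ x) ≡ occ u x
    occ-unique u [] = refl
    occ-unique u {a ∷ x} (a∉ ∷ ux) = trans (𝟙-∈ᵇ-∷ {u} (λ a∈ → All.lookup a∉ a∈ refl))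
      (cong₂ _+_ (cong 𝟙 (≟-sym u a)) (occ-unique u ux))

    ≟-≢ : ∀ {a u : Fin n} → a ≢ u → ⌊ a Finₚ.≟ u ⌋ ≡ false
    ≟-≢ {a} {u} a≢u with a Finₚ.≟ u
    ... | yes a≡u = ⊥-elim (a≢u a≡u)
    ... | no _ = refl

    -- The factor counts the places that u can take in the tuple.
    pin : ∀ m u {Θ} → Symmetric Θ → ∑^ (suc m) (λ x → occ u x * Θ x) ≡ ♯ (suc m) * ∑^ m (λ x → Θ (u ∷ x))
    pin m u s = trans (extract-all m _ s) (cong (♯ (suc m) *_) (trans (∑-cong vs (λ v → *-comm _ _))
      (∑-δ _ (Uniqueₚ.allFin⁺ n) (∈-allFin u))))

    occ-∷ : ∀ {a u} x → a ≢ u → occ u (a ∷ x) ≡ occ u x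
    occ-∷ {a} {u} x a≢u = trans (cong (λ b → 𝟙 b + occ u x) (≟-≢ a≢u)) (+-identityˡ _)

    pin₂ : ∀ m {u v} → u ≢ v → ∀ {Θ} → Symmetric Θ →
      ∑^ (suc (suc m)) (λ x → occ u x * (occ v x * Θ x)) ≡ ♯ (suc (suc m)) * (♯ (suc m) * ∑^ m (λ x → Θ (v ∷ u ∷ x)))
    pin₂ m {u} {v} u≢v {Θ} s = trans (pin (suc m) u (λ p → cong₂ _*_ (occ-↭ v p) (s p)))
      (cong (♯ (suc (suc m)) *_) (trans (∑^-cong (suc m) (λ x _ → cong (_* Θ (u ∷ x)) (occ-∷ x u≢v)))
        (trans (pin m v (symmetric-∷ u s)) (cong (♯ (suc m) *_) (∑^-cong m (λ x _ → s (Perm.swap u v ↭-refl)))))))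

    pin₃ : ∀ m {u v t} → u ≢ v → u ≢ t → v ≢ t → ∀ {Θ} → Symmetric Θ →
      ∑^ (suc (suc (suc m))) (λ x → occ u x * (occ v x * (occ t x * Θ x)))
        ≡ ♯ (suc (suc (suc m))) * (♯ (suc (suc m)) * (♯ (suc m) * ∑^ m (λ x → Θ (v ∷ u ∷ t ∷ x))))
    pin₃ m {u} {v} {t} u≢v u≢t v≢t {Θ} s = trans (pin₂ (suc m) u≢v (λ p → cong₂ _*_ (occ-↭ t p) (s p)))
      (cong (♯ (suc (suc (suc m))) *_) (cong (♯ (suc (suc m)) *_) (trans
        (∑^-cong (suc m) (λ x _ → cong (_* Θ (v ∷ u ∷ x)) (trans (occ-∷ (u ∷ x) v≢t) (occ-∷ x u≢t))))
        (trans (pin m t (symmetric-∷ u (symmetric-∷ v s)))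
          (cong (♯ (suc m) *_) (∑^-cong m (λ x _ → s (Perm.prep v ↭-refl))))))))

    module Counting (ℓ : ℕ) (ς : ℚ) (0≤ς : 0ℚ ≤ ς) (deg-≥ : ∀ v → ν - ν * ς ≤ ∑ vs (λ a → 𝟙 (adj G v a)))
      (ρ≤1 : ♯ ℓ * ς ≤ 1ℚ) where

      ρ L : ℚ
      ρ = ♯ ℓ * ς
      L = ν * (1ℚ - ρ)

      0≤ρ : 0ℚ ≤ ρ
      0≤ρ = *-nonneg (♯-nonneg ℓ) 0≤ς

      0≤L : 0ℚ ≤ L
      0≤L = *-nonneg (♯-nonneg n) (sub-nonneg ρ≤1)

      non-neighbours : ∀ a → ∑ vs (λ v → 𝟙 (not (adj G v a))) ≤ ν * ς
      non-neighbours a = begin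
        ∑ vs (λ v → 𝟙 (not (adj G v a)))           ≡⟨ ∑-cong vs (λ v →
            trans (𝟙-not (adj G v a)) (cong (λ b → 1ℚ - 𝟙 b) (adj-sym G v a))) ⟩
        ∑ vs (λ v → 1ℚ - 𝟙 (adj G a v))            ≡⟨ trans (∑-sub vs _ _)
            (cong (_- ∑ vs (λ v → 𝟙 (adj G a v))) (trans (∑vs-const 1ℚ) (*-identityʳ ν))) ⟩
        ν - ∑ vs (λ v → 𝟙 (adj G a v))             ≤⟨ sub-mono ≤-refl (deg-≥ a) ⟩
        ν - (ν - ν * ς)                            ≡⟨ eq ν (ν * ς) ⟩
        ν * ς                                      ∎
        where
        open ℚₚ.≤-Reasoning
        opaque
          unfolding _+_
          eq : ∀ a b → a - (a - b) ≡ b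
          eq = solve-∀ ℚ-ring

      common-neighbours : ∀ t → length t ℕ.≤ ℓ → L ≤ ∑ vs (λ v → 𝟙 (allᵇ (adj G v) t))
      common-neighbours t t≤ℓ = begin
        ν * (1ℚ - ♯ ℓ * ς)                                          ≡⟨ eq ν (♯ ℓ) ς ⟩
        ν - ♯ ℓ * (ν * ς)                                           ≤⟨ sub-mono ≤-refl
            (*-monoʳ (*-nonneg (♯-nonneg n) 0≤ς) (♯-mono t≤ℓ)) ⟩
        ν - ♯ (length t) * (ν * ς)                                  ≡⟨ cong (λ z → ν - z) (sym (∑-const t (ν * ς))) ⟩
        ν - ∑ t (λ _ → ν * ς)                                       ≤⟨ sub-mono ≤-refl (∑-mono t non-neighbours) ⟩
        ν - ∑ t (λ a → ∑ vs (λ v → 𝟙 (not (adj G v a))))            ≡⟨ cong₂ _-_ (sym (trans (∑vs-const 1ℚ) (*-identityʳ ν)))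
            (∑-swap t vs _) ⟩
        ∑ vs (λ _ → 1ℚ) - ∑ vs (λ v → ∑ t (λ a → 𝟙 (not (adj G v a)))) ≡⟨ sym (∑-sub vs _ _) ⟩
        ∑ vs (λ v → 1ℚ - ∑ t (λ a → 𝟙 (not (adj G v a))))           ≤⟨ ∑-mono vs (λ v → 𝟙-allᵇ-≥ (adj G v) t) ⟩
        ∑ vs (λ v → 𝟙 (allᵇ (adj G v) t))                           ∎
        where
        open ℚₚ.≤-Reasoning
        opaque
          unfolding _+_
          eq : ∀ a l s → a * (1ℚ - l * s) ≡ a - l * (a * s)
          eq = solve-∀ ℚ-ring

      -- A clique grows vertex by vertex through common neighbours. Reversed concatenation puts each
      -- new vertex in front of the clique built so far, which is the form of the induction.
      extensions : ∀ j t → j ℕ.+ length t ℕ.≤ suc ℓ → L ↑ j * cl t ≤ ∑^ j (λ x → cl (x ʳ++ t))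
      extensions zero t _ = ≤-reflexive (*-identityˡ _)
      extensions (suc j) t (ℕ.s≤s j+t≤ℓ) = begin
        L * L ↑ j * cl t                             ≡⟨ eq L (L ↑ j) (cl t) ⟩
        L ↑ j * cl t * L                             ≤⟨ *-monoˡ (*-nonneg (^-nonneg j 0≤L) (cl-nonneg t))
            (common-neighbours t (ℕₚ.≤-trans (ℕₚ.m≤n+m (length t) j) j+t≤ℓ)) ⟩
        L ↑ j * cl t * ∑ vs (λ v → 𝟙 (allᵇ (adj G v) t)) ≡⟨ sym (∑-*ˡ _ vs _) ⟩
        ∑ vs (λ v → L ↑ j * cl t * 𝟙 (allᵇ (adj G v) t)) ≡⟨ ∑-cong vs
            (λ v → trans (eq₂ (L ↑ j) (cl t) _) (cong (L ↑ j *_) (sym (cl-∷ v t)))) ⟩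
        ∑ vs (λ v → L ↑ j * cl (v ∷ t))              ≤⟨ ∑-mono vs
            (λ v → extensions j (v ∷ t) (ℕₚ.≤-trans (ℕₚ.≤-reflexive (ℕₚ.+-suc j (length t))) (ℕ.s≤s j+t≤ℓ))) ⟩
        ∑ vs (λ v → ∑^ j (λ x → cl (x ʳ++ (v ∷ t)))) ∎
        where
        open ℚₚ.≤-Reasoning
        opaque
          unfolding _+_
          eq : ∀ l p c → l * p * c ≡ p * c * l
          eq = solve-∀ ℚ-ring
          eq₂ : ∀ p c a → p * c * a ≡ p * (a * c)
          eq₂ = solve-∀ ℚ-ring

      cliquesOn : ℕ → Fin n → Fin n → ℚ
      cliquesOn j u v = ∑^ j (λ x → cl (u ∷ v ∷ x))

      cliquesOn-≥ : ∀ j u v → j ℕ.+ 2 ℕ.≤ suc ℓ → adj G u v ≡ true → ν ↑ j * (1ℚ - ♯ j * ρ) ≤ cliquesOn j u v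
      cliquesOn-≥ j u v j≤ uv = begin
        ν ↑ j * (1ℚ - ♯ j * ρ)                    ≤⟨ *-monoˡ (^-nonneg j (♯-nonneg n)) (bernoulli-lower j 0≤ρ ρ≤1) ⟩
        ν ↑ j * (1ℚ - ρ) ↑ j                      ≡⟨ sym (^-* ν (1ℚ - ρ) j) ⟩
        L ↑ j                                     ≡⟨ sym (*-identityʳ _) ⟩
        L ↑ j * 1ℚ                                ≡⟨ cong (λ b → L ↑ j * 𝟙 ((b ∧ true) ∧ true)) (sym uv) ⟩
        L ↑ j * cl (u ∷ v ∷ [])                   ≤⟨ extensions j (u ∷ v ∷ []) j≤ ⟩
        ∑^ j (λ x → cl (x ʳ++ (u ∷ v ∷ [])))      ≡⟨ ∑^-cong j (λ x _ →
            cl-↭ (↭-trans (↭-sym (Permₚ.++↭ʳ++ x (u ∷ v ∷ []))) (Permₚ.++-comm x (u ∷ v ∷ [])))) ⟩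
        cliquesOn j u v                           ∎
        where open ℚₚ.≤-Reasoning

      cliquesOn-≤ : ∀ j u v → cliquesOn j u v ≤ ν ↑ j
      cliquesOn-≤ j u v = ≤-trans (∑^-mono j (λ x _ → 𝟙-≤1 (isClique (u ∷ v ∷ x))))
        (≤-reflexive (trans (∑^-const j 1ℚ) (trans (*-identityʳ _) (cong (_↑ j) ν≡))))

      cliquesOn-sym : ∀ j u v → cliquesOn j u v ≡ cliquesOn j v u
      cliquesOn-sym j u v = ∑^-cong j (λ x _ → cl-↭ {u ∷ v ∷ x} (Perm.swap u v ↭-refl))

-- The fractional decomposition into k-cliques.

module FractionalDecomposition where

  open Arithmetic
  open RandomGreedy
  open SymmetricSums
  open CliqueCounts

  -- With m = k - 2, `dense` reads 2 m² k (k + 2) ς ≤ 1, which is the inequality on which `W-nonneg`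
  -- rests.
  module Weights {n : ℕ} (G : Graph n) (0<n : 0ℚ < ♯ n) (m-1 : ℕ) (ς : ℚ) (0≤ς : 0ℚ ≤ ς)
    (deg-≥ : ∀ v → ♯ n - ♯ n * ς ≤ ∑ (allFin n) (λ a → 𝟙 (adj G v a)))
    (dense : (1ℚ + 1ℚ) * (♯ (suc m-1) * ♯ (suc m-1)) * ♯ (2 ℕ.+ suc m-1) * (♯ (4 ℕ.+ suc m-1) * ς) ≤ 1ℚ) where

    open Cliques G

    private
      m k : ℕ
      m = suc m-1
      k = suc (suc m)

      M k̂ : ℚ
      M = ♯ m
      k̂ = ♯ k

      0≤M : 0ℚ ≤ M
      0≤M = ♯-nonneg m
      0≤k̂ : 0ℚ ≤ k̂
      0≤k̂ = ♯-nonneg k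
      1≤M : 1ℚ ≤ M
      1≤M = ≤-resp ♯-1 refl (♯-mono (ℕ.s≤s ℕ.z≤n))
      1≤k̂ : 1ℚ ≤ k̂
      1≤k̂ = ≤-resp ♯-1 refl (♯-mono (ℕ.s≤s ℕ.z≤n))
      0≤2 : 0ℚ ≤ 1ℚ + 1ℚ
      0≤2 = +-nonneg 0≤1 0≤1

      ρ′ : ℚ
      ρ′ = ♯ (4 ℕ.+ m) * ς
      0≤ρ′ : 0ℚ ≤ ρ′
      0≤ρ′ = *-nonneg (♯-nonneg (4 ℕ.+ m)) 0≤ς

      1≤* : ∀ {a b} → 1ℚ ≤ a → 1ℚ ≤ b → 1ℚ ≤ a * b
      1≤* {a} {b} h l = ≤-resp (*-identityˡ 1ℚ) refl (*-mono 0≤1 (≤-trans 0≤1 l) h l)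

      below : ∀ {c d} → c ≤ d → d * ρ′ ≤ 1ℚ → c * ρ′ ≤ 1ℚ
      below c≤d h = ≤-trans (*-monoʳ 0≤ρ′ c≤d) h

      ρ≤1 : ρ′ ≤ 1ℚ
      ρ≤1 = ≤-resp (*-identityˡ ρ′) refl (below (1≤* (1≤* (≤-+ʳ 0≤1) (1≤* 1≤M 1≤M)) 1≤k̂) dense)

      2kρ≤1 : (1ℚ + 1ℚ) * k̂ * ρ′ ≤ 1ℚ
      2kρ≤1 = below (*-monoʳ 0≤k̂ (≤-resp (*-identityʳ _) refl (*-monoˡ 0≤2 (1≤* 1≤M 1≤M)))) dense

      Mρ≤1 : M * ρ′ ≤ 1ℚ
      Mρ≤1 = below (≤-trans (♯-mono (ℕₚ.m≤n+m m 2)) (≤-resp (*-identityˡ k̂) refl (*-monoʳ 0≤k̂ (≤-+ʳ {1ℚ} 0≤1)))) 2kρ≤1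

    open Counting (4 ℕ.+ m) ς 0≤ς deg-≥ ρ≤1

    private
      0<ν^ : ∀ j → 0ℚ < ν ↑ j
      0<ν^ j = ^-pos j 0<n

      K₂ w₀ : ℚ
      K₂ = k̂ * ♯ (suc m)
      0<K₂ : 0ℚ < K₂
      0<K₂ = *-pos (♯-pos (suc m)) (♯-pos m)
      0≤K₂ = ℚₚ.<⇒≤ 0<K₂

      0<K₂ν : ∀ j → 0ℚ < K₂ * ν ↑ j
      0<K₂ν j = *-pos 0<K₂ (0<ν^ j)

      -- The right uniform weight if every m-tuple completed an edge to a clique. As ν^m is an upper
      -- bound for the completions, all deficits are nonnegative.
      w₀ = inv (K₂ * ν ↑ m)
      0≤w₀ : 0ℚ ≤ w₀
      0≤w₀ = inv-nonneg (0<K₂ν m)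

      K₂w₀ν : K₂ * w₀ * ν ↑ m ≡ 1ℚ
      K₂w₀ν = trans (eq K₂ w₀ (ν ↑ m)) (*-inv (0<K₂ν m))
        where
        opaque
          unfolding _+_
          eq : ∀ a b c → a * b * c ≡ a * c * b
          eq = solve-∀ ℚ-ring

      deficit : Fin n → Fin n → ℚ
      deficit u v = 1ℚ - K₂ * w₀ * cliquesOn m u v

      -- By `gadget`, a correction a at the edge uv raises its total weight by 2 K₂ a times
      -- `cliquesOn k u v`; the quotient makes this equal to the deficit.
      correction : Fin n → Fin n → ℚ
      correction u v = 𝟙 (adj G u v) * (deficit u v * inv ((1ℚ + 1ℚ) * K₂ * cliquesOn k u v))

      correction-sym : ∀ u v → correction u v ≡ correction v u
      correction-sym u v = cong₂ _*_ (cong 𝟙 (adj-sym G u v)) (cong₂ _*_ (cong (λ z → 1ℚ - K₂ * w₀ * z) (cliquesOn-sym m u v))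
        (cong (λ z → inv ((1ℚ + 1ℚ) * K₂ * z)) (cliquesOn-sym k u v)))

      2q≥ : ∀ u v → adj G u v ≡ true → ν ↑ k ≤ (1ℚ + 1ℚ) * cliquesOn k u v
      2q≥ u v uv = ≤-trans (≤-cert (*-nonneg (ℚₚ.<⇒≤ (0<ν^ k)) (sub-nonneg 2kρ≤1)) (eq (ν ↑ k) k̂ ρ′))
        (*-monoˡ 0≤2 (cliquesOn-≥ k u v (ℕₚ.≤-trans (ℕₚ.≤-reflexive (ℕₚ.+-comm k 2)) (ℕₚ.n≤1+n (4 ℕ.+ m))) uv))
        where
        opaque
          unfolding _+_
          eq : ∀ p k r → (1ℚ + 1ℚ) * (p * (1ℚ - k * r)) ≡ p + p * (1ℚ - (1ℚ + 1ℚ) * k * r)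
          eq = solve-∀ ℚ-ring

      2K₂q≥ : ∀ u v → adj G u v ≡ true → K₂ * ν ↑ k ≤ (1ℚ + 1ℚ) * K₂ * cliquesOn k u v
      2K₂q≥ u v uv = ≤-trans (*-monoˡ 0≤K₂ (2q≥ u v uv)) (≤-reflexive (eq K₂ _))
        where
        opaque
          unfolding _+_
          eq : ∀ a b → a * ((1ℚ + 1ℚ) * b) ≡ (1ℚ + 1ℚ) * a * b
          eq = solve-∀ ℚ-ring

      0<2K₂q : ∀ u v → adj G u v ≡ true → 0ℚ < (1ℚ + 1ℚ) * K₂ * cliquesOn k u v
      0<2K₂q u v uv = ℚₚ.<-≤-trans (0<K₂ν k) (2K₂q≥ u v uv)

      0≤K₂w₀ : 0ℚ ≤ K₂ * w₀
      0≤K₂w₀ = *-nonneg 0≤K₂ 0≤w₀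

      deficit-nonneg : ∀ u v → 0ℚ ≤ deficit u v
      deficit-nonneg u v = sub-nonneg (≤-trans (*-monoˡ 0≤K₂w₀ (cliquesOn-≤ m u v)) (≤-reflexive K₂w₀ν))

      deficit-≤ : ∀ u v → adj G u v ≡ true → deficit u v ≤ M * ρ′
      deficit-≤ u v uv = ≤-trans (sub-mono ≤-refl (*-monoˡ 0≤K₂w₀ (cliquesOn-≥ m u v
          (ℕₚ.≤-trans (ℕₚ.≤-reflexive (ℕₚ.+-comm m 2)) (ℕₚ.m≤n+m (2 ℕ.+ m) 3)) uv)))
        (≤-reflexive (trans (cong (λ z → 1ℚ - z) (sym (*-assoc (K₂ * w₀) (ν ↑ m) _)))
            (trans (cong (λ z → 1ℚ - z * (1ℚ - M * ρ′)) K₂w₀ν) (eq (M * ρ′)))))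
        where
        opaque
          unfolding _+_
          eq : ∀ a → 1ℚ - 1ℚ * (1ℚ - a) ≡ a
          eq = solve-∀ ℚ-ring

      -- A bound for all corrections: deficits are at most M ρ′, and twice the number of completions
      -- to (k + 2)-cliques is at least ν^k.
      b̂ : ℚ
      b̂ = M * ρ′ * inv (K₂ * ν ↑ k)

      0≤Mρ : 0ℚ ≤ M * ρ′
      0≤Mρ = *-nonneg 0≤M 0≤ρ′

      0≤b̂ : 0ℚ ≤ b̂
      0≤b̂ = *-nonneg 0≤Mρ (inv-nonneg (0<K₂ν k))

      correction-nonneg : ∀ u v → 0ℚ ≤ correction u v
      correction-nonneg u v = go (adj G u v) refl
        where
        go : ∀ b → adj G u v ≡ b → 0ℚ ≤ 𝟙 b * (deficit u v * inv ((1ℚ + 1ℚ) * K₂ * cliquesOn k u v))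
        go false uv = ≤-reflexive (sym (*-zeroˡ _))
        go true uv = *-nonneg 0≤1 (*-nonneg (deficit-nonneg u v) (inv-nonneg (0<2K₂q u v uv)))

      correction-≤ : ∀ u v → correction u v ≤ b̂
      correction-≤ u v = go (adj G u v) refl
        where
        go : ∀ b → adj G u v ≡ b → 𝟙 b * (deficit u v * inv ((1ℚ + 1ℚ) * K₂ * cliquesOn k u v)) ≤ b̂
        go false uv = ≤-trans (≤-reflexive (*-zeroˡ _)) 0≤b̂
        go true uv = ≤-trans (≤-reflexive (*-identityˡ _)) (*-mono (deficit-nonneg u v) (inv-nonneg (0<K₂ν k))
            (deficit-≤ u v uv)
          (inv-≤ (0<2K₂q u v uv) (≤-trans (≤-reflexive (sym (*-inv (0<K₂ν k))))
              (*-monoʳ (inv-nonneg (0<K₂ν k)) (2K₂q≥ u v uv)))))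

      -- Summing over y and z costs the factor ν²; after it the gadgets are comparable with `w₀`.
      ννb̂ : ν * (ν * b̂) ≡ M * ρ′ * w₀
      ννb̂ = trans (eq ν (M * ρ′) _) (cong (M * ρ′ *_) (inv-unique (0<K₂ν m) (trans (eq₂ K₂ (ν ↑ m) ν _) (*-inv (0<K₂ν k)))))
        where
        opaque
          unfolding _+_
          eq : ∀ n a i → n * (n * (a * i)) ≡ a * (n * (n * i))
          eq = solve-∀ ℚ-ring
          eq₂ : ∀ k p n i → k * p * (n * (n * i)) ≡ k * (n * (n * p)) * i
          eq₂ = solve-∀ ℚ-ring

    open Pairs correction correction-sym

    private
      Br : Fin n → Fin n → List (Fin n) → ℚ
      Br = bracket M

      row-bounds : ∀ y x → length x ≡ k → 0ℚ ≤ ∑ x (correction y) × ∑ x (correction y) ≤ k̂ * b̂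
      row-bounds y x l = ∑-nonneg x (correction-nonneg y) ,
        ≤-trans (∑-mono x (correction-≤ y)) (≤-reflexive (trans (∑-const x b̂) (cong (λ j → ♯ j * b̂) l)))

      pairs-nonneg : ∀ x → 0ℚ ≤ pairs x
      pairs-nonneg [] = ≤-refl
      pairs-nonneg (a ∷ x) = +-nonneg (∑-nonneg x (correction-nonneg a)) (pairs-nonneg x)

      pairs-≤ : ∀ x → pairs x ≤ ♯ (length x) * ♯ (length x) * b̂
      pairs-≤ [] = *-nonneg (*-nonneg (♯-nonneg 0) (♯-nonneg 0)) 0≤b̂
      pairs-≤ (a ∷ x) = ≤-trans (+-mono-≤ (≤-trans (∑-mono x (correction-≤ a)) (≤-reflexive (∑-const x b̂))) (pairs-≤ x))
        (≤-cert (*-nonneg (+-nonneg 0≤1 (♯-nonneg (length x))) 0≤b̂)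
          (trans (cong (λ z → z * z * b̂) (♯-suc (length x))) (eq (♯ (length x)) b̂)))
        where
        opaque
          unfolding _+_
          eq : ∀ l b → (1ℚ + l) * (1ℚ + l) * b ≡ l * b + l * l * b + (1ℚ + l) * b
          eq = solve-∀ ℚ-ring

      -- Only edges with exactly one end in x have a negative coefficient.
      Br-≥ : ∀ y z x → length x ≡ k → 0ℚ - M * (k̂ * b̂ + k̂ * b̂) ≤ Br y z x
      Br-≥ y z x l = ≤-trans (sub-mono (*-nonneg 0≤2 (pairs-nonneg x))
          (*-monoˡ 0≤M (+-mono-≤ (proj₂ (row-bounds y x l)) (proj₂ (row-bounds z x l)))))
        (≤-+ʳ (*-nonneg (*-nonneg 0≤M (+-nonneg 0≤M 0≤1)) (correction-nonneg y z)))

      Ĉ : ℚ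
      Ĉ = (1ℚ + 1ℚ) * (k̂ * k̂) + M * (M + 1ℚ)

      0≤Ĉ : 0ℚ ≤ Ĉ
      0≤Ĉ = +-nonneg (*-nonneg 0≤2 (*-nonneg 0≤k̂ 0≤k̂)) (*-nonneg 0≤M (+-nonneg 0≤M 0≤1))

      Br-≤ : ∀ y z x → length x ≡ k → Br y z x ≤ Ĉ * b̂
      Br-≤ y z x l = ≤-trans (+-mono-≤ (≤-trans (sub-≤ (*-nonneg 0≤M
          (+-nonneg (proj₁ (row-bounds y x l)) (proj₁ (row-bounds z x l)))))
          (*-monoˡ 0≤2 (≤-trans (pairs-≤ x) (≤-reflexive (cong (λ j → ♯ j * ♯ j * b̂) l)))))
          (*-monoˡ (*-nonneg 0≤M (+-nonneg 0≤M 0≤1)) (correction-≤ y z)))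
        (≤-reflexive (eq k̂ M b̂))
        where
        opaque
          unfolding _+_
          eq : ∀ k m b → (1ℚ + 1ℚ) * (k * k * b) + m * (m + 1ℚ) * b ≡ ((1ℚ + 1ℚ) * (k * k) + m * (m + 1ℚ)) * b
          eq = solve-∀ ℚ-ring

      cl₂-≤ : ∀ y z x → cl (y ∷ z ∷ x) ≤ cl x
      cl₂-≤ y z x = ≤-trans (cl-∷-≤ y (z ∷ x)) (cl-∷-≤ z x)

      ∑∑-const : ∀ c → ∑ vs (λ y → ∑ vs (λ z → c)) ≡ ν * (ν * c)
      ∑∑-const c = trans (∑-cong vs (λ _ → ∑vs-const c)) (∑vs-const _)

      -- All gadgets together: every (k + 2)-clique containing x passes on to x the corrections of
      -- all its edges, with the coefficients of `bracket`.
      H : List (Fin n) → ℚ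
      H x = ∑ vs (λ y → ∑ vs (λ z → Br y z x * cl (y ∷ z ∷ x)))

    W : List (Fin n) → ℚ
    W x = w₀ * cl x + H x

    W-↭ : Symmetric W
    W-↭ {x} {x′} p = cong₂ _+_ (cong (w₀ *_) (cl-↭ p)) (∑-cong vs (λ y → ∑-cong vs (λ z → cong₂ _*_
      (cong₂ _+_ (cong₂ _-_ (cong ((1ℚ + 1ℚ) *_) (pairs-↭ p)) (cong (M *_)
          (cong₂ _+_ (∑-↭ (correction y) p) (∑-↭ (correction z) p)))) refl)
      (cl-↭ (Perm.prep y (Perm.prep z p))))))

    W-nonneg : ∀ x → length x ≡ k → 0ℚ ≤ W x
    W-nonneg x l = begin
      0ℚ                                       ≤⟨ *-nonneg (*-nonneg 0≤w₀ (cl-nonneg x)) (sub-nonneg dense) ⟩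
      w₀ * cl x * (1ℚ - (1ℚ + 1ℚ) * (M * M) * k̂ * ρ′) ≡⟨ eq w₀ (cl x) M k̂ ρ′ ⟩
      w₀ * cl x + (0ℚ - M * (k̂ + k̂) * (M * ρ′ * w₀) * cl x) ≡⟨ cong (λ z → w₀ * cl x + (0ℚ - M * (k̂ + k̂) * z * cl x))
          (sym ννb̂) ⟩
      w₀ * cl x + (0ℚ - M * (k̂ + k̂) * (ν * (ν * b̂)) * cl x) ≡⟨ cong (w₀ * cl x +_)
          (trans (eq₂ M k̂ ν b̂ (cl x)) (sym (∑∑-const _))) ⟩
      w₀ * cl x + ∑ vs (λ y → ∑ vs (λ z → 0ℚ - c * cl x)) ≤⟨ +-monoʳ-≤ _ (∑-mono vs (λ y → ∑-mono vs (λ z → term y z))) ⟩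
      W x ∎
      where
      open ℚₚ.≤-Reasoning
      c = M * (k̂ * b̂ + k̂ * b̂)
      0≤c : 0ℚ ≤ c
      0≤c = *-nonneg 0≤M (+-nonneg (*-nonneg 0≤k̂ 0≤b̂) (*-nonneg 0≤k̂ 0≤b̂))
      opaque
        unfolding _+_
        eq : ∀ w a m k r → w * a * (1ℚ - (1ℚ + 1ℚ) * (m * m) * k * r) ≡ w * a + (0ℚ - m * (k + k) * (m * r * w) * a)
        eq = solve-∀ ℚ-ring
        eq₂ : ∀ m k n b a → 0ℚ - m * (k + k) * (n * (n * b)) * a ≡ n * (n * (0ℚ - m * (k * b + k * b) * a))
        eq₂ = solve-∀ ℚ-ring
        eq₃ : ∀ c a → (0ℚ - c) * a ≡ 0ℚ - c * a
        eq₃ = solve-∀ ℚ-ring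
      term : ∀ y z → 0ℚ - c * cl x ≤ Br y z x * cl (y ∷ z ∷ x)
      term y z = ≤-trans (sub-mono ≤-refl (*-monoˡ 0≤c (cl₂-≤ y z x)))
        (≤-trans (≤-reflexive (sym (eq₃ c _))) (*-monoʳ (cl-nonneg (y ∷ z ∷ x)) (Br-≥ y z x l)))

    W-≤ : ∀ x → length x ≡ k → W x ≤ w₀ * (1ℚ + Ĉ)
    W-≤ x l = begin
      w₀ * cl x + H x                              ≤⟨ +-mono-≤ (*-monoˡ 0≤w₀ (𝟙-≤1 (isClique x)))
          (∑-mono vs (λ y → ∑-mono vs (λ z → term y z))) ⟩
      w₀ * 1ℚ + ∑ vs (λ y → ∑ vs (λ z → Ĉ * b̂))    ≡⟨ cong (w₀ * 1ℚ +_) (∑∑-const _) ⟩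
      w₀ * 1ℚ + ν * (ν * (Ĉ * b̂))                  ≡⟨ cong (w₀ * 1ℚ +_) (trans (eq ν Ĉ b̂) (cong (Ĉ *_) ννb̂)) ⟩
      w₀ * 1ℚ + Ĉ * (M * ρ′ * w₀)                  ≤⟨ +-monoʳ-≤ _ (*-monoˡ 0≤Ĉ (*-monoʳ 0≤w₀ Mρ≤1)) ⟩
      w₀ * 1ℚ + Ĉ * (1ℚ * w₀)                      ≡⟨ eq₂ w₀ Ĉ ⟩
      w₀ * (1ℚ + Ĉ)                                ∎
      where
      open ℚₚ.≤-Reasoning
      opaque
        unfolding _+_
        eq : ∀ n c b → n * (n * (c * b)) ≡ c * (n * (n * b))
        eq = solve-∀ ℚ-ring
        eq₂ : ∀ w c → w * 1ℚ + c * (1ℚ * w) ≡ w * (1ℚ + c)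
        eq₂ = solve-∀ ℚ-ring
      term : ∀ y z → Br y z x * cl (y ∷ z ∷ x) ≤ Ĉ * b̂
      term y z = ≤-trans (*-monoʳ (cl-nonneg (y ∷ z ∷ x)) (Br-≤ y z x l))
        (≤-resp refl (*-identityʳ _) (*-monoˡ (*-nonneg 0≤Ĉ 0≤b̂) (𝟙-≤1 (isClique (y ∷ z ∷ x)))))

    W-nonclique : ∀ x → isClique x ≡ false → W x ≡ 0ℚ
    W-nonclique x e = trans (cong₂ _+_ (trans (cong (λ b → w₀ * 𝟙 b) e) (*-zeroʳ w₀))
        (trans (∑-cong vs (λ y → trans (∑-cong vs (λ z → trans (cong (Br y z x *_) (vanishes y z)) (*-zeroʳ _))) (∑-0 vs)))
            (∑-0 vs)))
      (+-identityˡ 0ℚ)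
      where
      vanishes : ∀ y z → cl (y ∷ z ∷ x) ≡ 0ℚ
      vanishes y z = trans (cong (λ b → 𝟙 (allᵇ (adj G y) (z ∷ x) ∧ (allᵇ (adj G z) x ∧ b))) e)
        (cong 𝟙 (trans (cong (allᵇ (adj G y) (z ∷ x) ∧_) (Boolₚ.∧-zeroʳ _)) (Boolₚ.∧-zeroʳ _)))

    W-occ : ∀ u x → 𝟙 (u ∈ᵇ x) * W x ≡ occ u x * W x
    W-occ u x = go (isClique x) refl
      where
      go : ∀ b → isClique x ≡ b → 𝟙 (u ∈ᵇ x) * W x ≡ occ u x * W x
      go true e = cong (_* W x) (occ-unique u {x} (clique-unique {x} e))
      go false e = trans (cong (𝟙 (u ∈ᵇ x) *_) (W-nonclique x e))
          (trans (*-zeroʳ _) (sym (trans (cong (occ u x *_) (W-nonclique x e)) (*-zeroʳ _))))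

    private
      -- Through a fixed edge, the deficit of the uniform weighting is exactly compensated by the gadgets.
      pinned : ∀ u v → adj G v u ≡ true → K₂ * ∑^ m (λ x → W (v ∷ u ∷ x)) ≡ 1ℚ
      pinned u v vu = begin
        K₂ * ∑^ m (λ x → W (v ∷ u ∷ x))
          ≡⟨ cong (K₂ *_) (trans (∑^-+ m (λ x → w₀ * cl (v ∷ u ∷ x)) (λ x → H (v ∷ u ∷ x)))
              (cong₂ _+_ (∑^-*ˡ m w₀ (λ x → cl (v ∷ u ∷ x))) gadgets)) ⟩
        K₂ * (w₀ * D + (1ℚ + 1ℚ) * correction v u * q)
          ≡⟨ cong (λ b → K₂ * (w₀ * D + (1ℚ + 1ℚ) * (𝟙 b * (deficit v u * inv ((1ℚ + 1ℚ) * K₂ * q))) * q)) vu ⟩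
        K₂ * (w₀ * D + (1ℚ + 1ℚ) * (1ℚ * (deficit v u * inv ((1ℚ + 1ℚ) * K₂ * q))) * q)
          ≡⟨ eq K₂ w₀ D (deficit v u) (inv ((1ℚ + 1ℚ) * K₂ * q)) q ⟩
        K₂ * w₀ * D + deficit v u * ((1ℚ + 1ℚ) * K₂ * q * inv ((1ℚ + 1ℚ) * K₂ * q))
          ≡⟨ cong (λ z → K₂ * w₀ * D + deficit v u * z) (*-inv (0<2K₂q v u vu)) ⟩
        K₂ * w₀ * D + (1ℚ - K₂ * w₀ * D) * 1ℚ
          ≡⟨ eq₂ (K₂ * w₀ * D) ⟩
        1ℚ ∎
        where
        open ≡-Reasoning
        D q : ℚ
        D = cliquesOn m v u
        q = cliquesOn k v u
        opaque
          unfolding _+_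
          eq : ∀ k w d a i q → k * (w * d + (1ℚ + 1ℚ) * (1ℚ * (a * i)) * q) ≡ k * w * d + a * ((1ℚ + 1ℚ) * k * q * i)
          eq = solve-∀ ℚ-ring
          eq₂ : ∀ a → a + (1ℚ - a) * 1ℚ ≡ 1ℚ
          eq₂ = solve-∀ ℚ-ring
        Ψ : List (Fin n) → ℚ
        Ψ t = cl (v ∷ u ∷ t)
        Ψ-↭ : Symmetric Ψ
        Ψ-↭ = symmetric-∷ {λ t → cl (v ∷ t)} u (symmetric-∷ {cl} v cl-↭)
        reorder : ∀ y z x → cl (y ∷ z ∷ v ∷ u ∷ x) ≡ Ψ (y ∷ z ∷ x)
        reorder y z x = cl-↭ (Permₚ.shifts (y ∷ z ∷ []) (v ∷ u ∷ []) {x})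
        gadgets : ∑^ m (λ x → H (v ∷ u ∷ x)) ≡ (1ℚ + 1ℚ) * correction v u * q
        gadgets = begin
          ∑^ m (λ x → H (v ∷ u ∷ x))
            ≡⟨ trans (∑^-swap m vs (λ x y → ∑ vs (F x y))) (∑-cong vs
                (λ y → trans (∑^-swap m vs (λ x → F x y)) (∑-cong vs (λ z → ∑^-cong m (λ x _ →
                 cong (Br y z (v ∷ u ∷ x) *_) (reorder y z x)))))) ⟩
          ⟪ (λ y z x → Br y z (v ∷ u ∷ x)) ⟫ m Ψ
            ≡⟨ gadget m u v Ψ-↭ ⟩
          ⟪ (λ y z x → (1ℚ + 1ℚ) * correction v u) ⟫ m Ψ
            ≡⟨ ∑^-*ˡ (suc (suc m)) ((1ℚ + 1ℚ) * correction v u) Ψ ⟩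
          (1ℚ + 1ℚ) * correction v u * q ∎
          where
          F : List (Fin n) → Fin n → Fin n → ℚ
          F x y z = Br y z (v ∷ u ∷ x) * cl (y ∷ z ∷ v ∷ u ∷ x)

    W-degree : ∀ u v → adj G u v ≡ true → ∑^ k (λ x → W x * (𝟙 (u ∈ᵇ x) * 𝟙 (v ∈ᵇ x))) ≡ 1ℚ
    W-degree u v uv = begin
      ∑^ k (λ x → W x * (𝟙 (u ∈ᵇ x) * 𝟙 (v ∈ᵇ x)))        ≡⟨ ∑^-cong k (λ x _ → replace x) ⟩
      ∑^ k (λ x → occ u x * (occ v x * W x))              ≡⟨ pin₂ m u≢v W-↭ ⟩
      k̂ * (♯ (suc m) * ∑^ m (λ x → W (v ∷ u ∷ x)))        ≡⟨ sym (*-assoc k̂ _ _) ⟩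
      K₂ * ∑^ m (λ x → W (v ∷ u ∷ x))                     ≡⟨ pinned u v (trans (adj-sym G v u) uv) ⟩
      1ℚ ∎
      where
      open ≡-Reasoning
      u≢v : u ≢ v
      u≢v refl = case trans (sym (adj-irrefl G u)) uv of λ ()
      opaque
        unfolding _+_
        eq : ∀ w a b → w * (a * b) ≡ a * (b * w)
        eq = solve-∀ ℚ-ring
        eq₂ : ∀ a b w → a * (b * w) ≡ b * (a * w)
        eq₂ = solve-∀ ℚ-ring
      replace : ∀ x → W x * (𝟙 (u ∈ᵇ x) * 𝟙 (v ∈ᵇ x)) ≡ occ u x * (occ v x * W x)
      replace x = trans (eq (W x) (𝟙 (u ∈ᵇ x)) (𝟙 (v ∈ᵇ x))) (trans (cong (𝟙 (u ∈ᵇ x) *_) (W-occ v x))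
        (trans (eq₂ _ (occ v x) (W x)) (trans (cong (occ v x *_) (W-occ u x)) (eq₂ (occ v x) _ (W x)))))

    κ₃ : ℚ
    κ₃ = M * (1ℚ + ((1ℚ + 1ℚ) * (k̂ * k̂) + M * (M + 1ℚ))) * inv ν

    -- There are k (k - 1) m placements of the three vertices and at most ν^(k-3) completions, each
    -- of weight at most `w₀` times a constant; against the ν^(k-2) in `w₀` this leaves 1 / ν.
    W-codegree : ∀ u v t → u ≢ v → u ≢ t → v ≢ t →
      ∑^ k (λ x → W x * (𝟙 (u ∈ᵇ x) * (𝟙 (v ∈ᵇ x) * 𝟙 (t ∈ᵇ x)))) ≤ κ₃
    W-codegree u v t u≢v u≢t v≢t = begin
      ∑^ k (λ x → W x * (𝟙 (u ∈ᵇ x) * (𝟙 (v ∈ᵇ x) * 𝟙 (t ∈ᵇ x))))   ≡⟨ ∑^-cong k (λ x _ → replace x) ⟩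
      ∑^ k (λ x → occ u x * (occ v x * (occ t x * W x)))              ≡⟨ pin₃ m-1 u≢v u≢t v≢t W-↭ ⟩
      k̂ * (♯ (suc m) * (M * ∑^ m-1 (λ x → W (v ∷ u ∷ t ∷ x))))
        ≤⟨ *-monoˡ 0≤k̂ (*-monoˡ (♯-nonneg (suc m)) (*-monoˡ 0≤M
            (≤-trans (∑^-mono m-1 (λ x l → W-≤ (v ∷ u ∷ t ∷ x) (cong (3 ℕ.+_) l)))
             (≤-reflexive (trans (∑^-const m-1 _) (cong (λ z → z ↑ m-1 * (w₀ * (1ℚ + Ĉ))) ν≡)))))) ⟩
      k̂ * (♯ (suc m) * (M * (ν ↑ m-1 * (w₀ * (1ℚ + Ĉ)))))             ≡⟨ eq k̂ (♯ (suc m)) M (ν ↑ m-1) w₀ (1ℚ + Ĉ) ⟩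
      M * (1ℚ + Ĉ) * (K₂ * w₀ * ν ↑ m-1)                              ≡⟨ cong (M * (1ℚ + Ĉ) *_)
          (inv-unique 0<n (trans (eq₂ ν (K₂ * w₀) (ν ↑ m-1)) K₂w₀ν)) ⟩
      κ₃ ∎
      where
      open ℚₚ.≤-Reasoning
      opaque
        unfolding _+_
        eq : ∀ k s m n w c → k * (s * (m * (n * (w * c)))) ≡ m * c * (k * s * w * n)
        eq = solve-∀ ℚ-ring
        eq₂ : ∀ n a p → n * (a * p) ≡ a * (n * p)
        eq₂ = solve-∀ ℚ-ring
        eq₃ : ∀ w a b c → w * (a * (b * c)) ≡ a * (b * (c * w))
        eq₃ = solve-∀ ℚ-ring
        eq₄ : ∀ a b c w → a * (b * (c * w)) ≡ c * (b * (a * w))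
        eq₄ = solve-∀ ℚ-ring
        eq₅ : ∀ a b c w → a * (b * (c * w)) ≡ a * (c * (b * w))
        eq₅ = solve-∀ ℚ-ring
      replace : ∀ x → W x * (𝟙 (u ∈ᵇ x) * (𝟙 (v ∈ᵇ x) * 𝟙 (t ∈ᵇ x))) ≡ occ u x * (occ v x * (occ t x * W x))
      replace x = trans (eq₃ (W x) (𝟙 (u ∈ᵇ x)) (𝟙 (v ∈ᵇ x)) (𝟙 (t ∈ᵇ x)))
        (trans (cong (λ z → 𝟙 (u ∈ᵇ x) * (𝟙 (v ∈ᵇ x) * z)) (W-occ t x))
        (trans (eq₅ _ _ (occ t x) (W x)) (trans (cong (λ z → 𝟙 (u ∈ᵇ x) * (occ t x * z)) (W-occ v x))
        (trans (eq₄ _ (occ t x) (occ v x) (W x)) (trans (cong (λ z → occ v x * (occ t x * z)) (W-occ u x))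
        (trans (eq₄ (occ v x) (occ t x) (occ u x) (W x)) (eq₅ (occ u x) _ _ (W x))))))))

-- Edge lists of graphs and cliques, and packings from edge-disjoint cliques.

module EdgeSets where

  open Arithmetic
  open RandomGreedy
  open SymmetricSums
  open CliqueCounts

  module EdgeLists {n : ℕ} (G : Graph n) where
    open Cliques G

    -- Edges are pairs with the smaller end first, which gives every edge a single representative.
    order : Fin n → Fin n → Fin n × Fin n
    order a c = if toℕ a ℕ.<ᵇ toℕ c then (a , c) else (c , a)

    order-< : ∀ {a c} → toℕ a ℕ.< toℕ c → order a c ≡ (a , c)
    order-< {a} {c} a<c with toℕ a ℕ.<ᵇ toℕ c in e
    ... | true = refl
    ... | false = ⊥-elim (subst Bool.T e (ℕₚ.<⇒<ᵇ a<c))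

    order-≮ : ∀ {a c} → ¬ toℕ a ℕ.< toℕ c → order a c ≡ (c , a)
    order-≮ {a} {c} a≮c with toℕ a ℕ.<ᵇ toℕ c in e
    ... | true = ⊥-elim (a≮c (ℕₚ.<ᵇ⇒< (toℕ a) (toℕ c) (subst Bool.T (sym e) _)))
    ... | false = refl

    order-cases : ∀ a c → (order a c ≡ (a , c) × toℕ a ℕ.< toℕ c) ⊎ (order a c ≡ (c , a) × toℕ c ℕ.≤ toℕ a)
    order-cases a c with toℕ a ℕ.<? toℕ c
    ... | yes a<c = inj₁ (order-< a<c , a<c)
    ... | no a≮c = inj₂ (order-≮ a≮c , ℕₚ.≮⇒≥ a≮c)

    edgesOf : List (Fin n) → List (Fin n × Fin n)
    edgesOf [] = []
    edgesOf (a ∷ x) = map (order a) x ++ edgesOf x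

    edgesOf-length : ∀ x → length (edgesOf x) ≡ length x C 2
    edgesOf-length [] = refl
    edgesOf-length (a ∷ x) = begin
      length (map (order a) x ++ edgesOf x)           ≡⟨ Listₚ.length-++ (map (order a) x) ⟩
      length (map (order a) x) ℕ.+ length (edgesOf x) ≡⟨ cong₂ ℕ._+_
          (trans (Listₚ.length-map (order a) x) (sym (nC1≡n (length x)))) (edgesOf-length x) ⟩
      length x C 1 ℕ.+ length x C 2                   ≡⟨ nCk+nC[k+1]≡[n+1]C[k+1] (length x) 1 ⟩
      suc (length x) C 2                              ∎
      where open ≡-Reasoning

    ∈-edgesOf⁻ : ∀ {u v x} → Unique x → (u , v) ∈ edgesOf x → toℕ u ℕ.< toℕ v × u ∈ x × v ∈ x
    ∈-edgesOf⁻ {u} {v} {a ∷ x} (a∉ ∷ ux) e∈ with ∈-++⁻ (map (order a) x) e∈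
    ... | inj₂ e∈x = proj₁ ih , there (proj₁ (proj₂ ih)) , there (proj₂ (proj₂ ih))
      where ih = ∈-edgesOf⁻ ux e∈x
    ... | inj₁ e∈a with ∈-map⁻ (order a) e∈a
    ... | c , c∈ , eq with order-cases a c
    ... | inj₁ (oac , a<c) with trans eq oac
    ... | refl = a<c , here refl , there c∈
    ∈-edgesOf⁻ {u} {v} {a ∷ x} (a∉ ∷ ux) e∈ | inj₁ e∈a | c , c∈ , eq | inj₂ (oac , c≤a) with trans eq oac
    ... | refl = ℕₚ.≤∧≢⇒< c≤a (λ c≡a → All.lookup a∉ c∈ (sym (Finₚ.toℕ-injective c≡a))) , there c∈ , here refl

    ∈-edgesOf⁺ : ∀ {u v x} → toℕ u ℕ.< toℕ v → u ∈ x → v ∈ x → (u , v) ∈ edgesOf x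
    ∈-edgesOf⁺ u<v (here refl) (here refl) = ⊥-elim (ℕₚ.<-irrefl refl u<v)
    ∈-edgesOf⁺ {u} {v} {a ∷ x} u<v (here refl) (there v∈) =
      ∈-++⁺ˡ (subst (_∈ map (order a) x) (order-< u<v) (∈-map⁺ (order a) v∈))
    ∈-edgesOf⁺ {u} {v} {a ∷ x} u<v (there u∈) (here refl) =
      ∈-++⁺ˡ (subst (_∈ map (order a) x) (order-≮ (ℕₚ.<-asym u<v)) (∈-map⁺ (order a) u∈))
    ∈-edgesOf⁺ {u} {v} {a ∷ x} u<v (there u∈) (there v∈) = ∈-++⁺ʳ (map (order a) x) (∈-edgesOf⁺ u<v u∈ v∈)

    order-injective : ∀ a {c d} → order a c ≡ order a d → c ≡ d
    order-injective a {c} {d} e with order-cases a c | order-cases a d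
    ... | inj₁ (p , _) | inj₁ (q , _) with trans (sym p) (trans e q)
    ... | refl = refl
    order-injective a {c} {d} e | inj₁ (p , _) | inj₂ (q , _) with trans (sym p) (trans e q)
    ... | refl = refl
    order-injective a {c} {d} e | inj₂ (p , _) | inj₁ (q , _) with trans (sym p) (trans e q)
    ... | refl = refl
    order-injective a {c} {d} e | inj₂ (p , _) | inj₂ (q , _) with trans (sym p) (trans e q)
    ... | refl = refl

    order-∋ : ∀ a c {P : Fin n → Set} → P (proj₁ (order a c)) → P (proj₂ (order a c)) → P a
    order-∋ a c {P} p q with order-cases a c
    ... | inj₁ (e , _) = subst (λ z → P (proj₁ z)) e p
    ... | inj₂ (e , _) = subst (λ z → P (proj₂ z)) e q

    edgesOf-unique : ∀ {x} → Unique x → Unique (edgesOf x)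
    edgesOf-unique [] = []
    edgesOf-unique {a ∷ x} (a∉ ∷ ux) = Uniqueₚ.++⁺ (Uniqueₚ.map⁺ (order-injective a) ux) (edgesOf-unique ux) disjoint
      where
      disjoint : ∀ {e} → e ∈ map (order a) x × e ∈ edgesOf x → ⊥
      disjoint (e∈a , e∈x) with ∈-map⁻ (order a) e∈a
      ... | c , c∈ , refl = All.lookup a∉ (order-∋ a c {_∈ x} (proj₁ (proj₂ (∈-edgesOf⁻ ux e∈x)))
          (proj₂ (proj₂ (∈-edgesOf⁻ ux e∈x)))) refl

    clique-pair : ∀ {x u v} → isClique x ≡ true → u ∈ x → v ∈ x → u ≢ v → adj G u v ≡ true
    clique-pair {a ∷ x} cx (here refl) (here refl) u≢v = ⊥-elim (u≢v refl)
    clique-pair {a ∷ x} cx (here refl) (there v∈) u≢v = clique-adj {a} {x} cx v∈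
    clique-pair {a ∷ x} cx (there u∈) (here refl) u≢v = trans (adj-sym G _ a) (clique-adj {a} {x} cx u∈)
    clique-pair {a ∷ x} cx (there u∈) (there v∈) u≢v = clique-pair (clique-tail {a} {x} cx) u∈ v∈ u≢v

    isEdge : Fin n × Fin n → Bool
    isEdge (u , v) = (toℕ u ℕ.<ᵇ toℕ v) ∧ adj G u v

    isEdge? : ∀ e → Dec (isEdge e ≡ true)
    isEdge? e = isEdge e Bool.≟ true

    edgeList : List (Fin n × Fin n)
    edgeList = filter isEdge? (cartesianProduct vs vs)

    edgeList-unique : Unique edgeList
    edgeList-unique = Uniqueₚ.filter⁺ isEdge? (Uniqueₚ.cartesianProduct⁺ (Uniqueₚ.allFin⁺ n) (Uniqueₚ.allFin⁺ n))

    ∈-edgeList⁻ : ∀ {u v} → (u , v) ∈ edgeList → toℕ u ℕ.< toℕ v × adj G u v ≡ true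
    ∈-edgeList⁻ {u} {v} e∈ = ℕₚ.<ᵇ⇒< (toℕ u) (toℕ v) (subst Bool.T (sym (Boolₚ.∧-conicalˡ _ _ e)) _) ,
        Boolₚ.∧-conicalʳ (toℕ u ℕ.<ᵇ toℕ v) _ e
      where
      e : isEdge (u , v) ≡ true
      e = proj₂ (∈-filter⁻ isEdge? {xs = cartesianProduct vs vs} e∈)

    ∈-edgeList⁺ : ∀ {u v} → toℕ u ℕ.< toℕ v → adj G u v ≡ true → (u , v) ∈ edgeList
    ∈-edgeList⁺ {u} {v} u<v uv = ∈-filter⁺ isEdge? (∈-cartesianProduct⁺ (∈-allFin u) (∈-allFin v))
        (cong₂ _∧_ (<ᵇ-true u<v) uv)
      where
      <ᵇ-true : ∀ {a b} → a ℕ.< b → (a ℕ.<ᵇ b) ≡ true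
      <ᵇ-true {a} {b} a<b with a ℕ.<ᵇ b in e
      ... | true = refl
      ... | false = ⊥-elim (subst Bool.T e (ℕₚ.<⇒<ᵇ a<b))

    ♯-filter : ∀ {A : Set} (f : A → Bool) L → ♯ (length (filter (λ a → f a Bool.≟ true) L)) ≡ ∑ L (λ a → 𝟙 (f a))
    ♯-filter f [] = ♯-0
    ♯-filter f (a ∷ L) with f a
    ... | true = trans (♯-suc _) (cong (1ℚ +_) (♯-filter f L))
    ... | false = trans (♯-filter f L) (sym (+-identityˡ _))

    ∑-cartesianProduct : ∀ {A B : Set} (L : List A) (M : List B) f →
        ∑ (cartesianProduct L M) f ≡ ∑ L (λ a → ∑ M (λ b → f (a , b)))
    ∑-cartesianProduct [] M f = refl
    ∑-cartesianProduct (a ∷ L) M f = trans (∑-++ (map (a ,_) M) _ f) (cong₂ _+_ (∑-map (a ,_) M f) (∑-cartesianProduct L M f))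

    ♯-sum : ∀ {A : Set} (f : A → ℕ) L → ♯ (sum (map f L)) ≡ ∑ L (λ a → ♯ (f a))
    ♯-sum f [] = ♯-0
    ♯-sum f (a ∷ L) = trans (♯-+ (f a) _) (cong (♯ (f a) +_) (♯-sum f L))

    ♯-count : ∀ (f : Fin n → Bool) → ♯ (count f) ≡ ∑ vs (λ i → 𝟙 (f i))
    ♯-count f = trans (♯-sum (λ i → if f i then 1 else 0) vs) (∑-cong vs (λ i → ♯-if (f i)))
      where
      ♯-if : ∀ b → ♯ (if b then 1 else 0) ≡ 𝟙 b
      ♯-if true = ♯-1
      ♯-if false = ♯-0

    ♯-edges : ♯ (edges G) ≡ ♯ (length edgeList)
    ♯-edges = trans (♯-sum (λ i → count (λ j → isEdge (i , j))) vs) (trans (∑-cong vs (λ i → ♯-count _))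
      (sym (trans (♯-filter isEdge (cartesianProduct vs vs)) (∑-cartesianProduct vs vs _))))

    module _ (k : ℕ) where

      Clique : Set
      Clique = Σ (List (Fin n)) (λ x → isClique x ≡ true × length x ≡ k)

      -- The outcome of the test is a separate argument with its equation: the clique can then store
      -- the proof, and later sums can split on it.
      consClique : ∀ x b → isClique x ≡ b → length x ≡ k → List Clique → List Clique
      consClique x true e l R = (x , e , l) ∷ R
      consClique x false e l R = R

      cliquesIn : ∀ L → (∀ {x} → x ∈ L → length x ≡ k) → List Clique
      cliquesIn [] h = []
      cliquesIn (x ∷ L) h = consClique x (isClique x) refl (h (here refl)) (cliquesIn L (h ∘ there))

      module _ (φ : List (Fin n) → ℚ) (φ-nonclique : ∀ x → isClique x ≡ false → φ x ≡ 0ℚ) where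

        ∑-consClique : ∀ x b e l R → ∑ (consClique x b e l R) (λ K → φ (proj₁ K)) ≡ φ x + ∑ R (λ K → φ (proj₁ K))
        ∑-consClique x true e l R = refl
        ∑-consClique x false e l R = sym (trans (cong (_+ ∑ R (λ K → φ (proj₁ K))) (φ-nonclique x e)) (+-identityˡ _))

        ∑-cliquesIn : ∀ L (h : ∀ {x} → x ∈ L → length x ≡ k) → ∑ (cliquesIn L h) (λ K → φ (proj₁ K)) ≡ ∑ L φ
        ∑-cliquesIn [] h = refl
        ∑-cliquesIn (x ∷ L) h = trans (∑-consClique x (isClique x) refl (h (here refl)) (cliquesIn L (h ∘ there)))
          (cong (φ x +_) (∑-cliquesIn L (h ∘ there)))

      -- Every k-clique is listed in all its orders, to match `∑^`. For k ≥ 2 two orders share their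
      -- edges, so a matching uses at most one.
      cliques : List Clique
      cliques = cliquesIn (tuples k) (∈-tuples-length k)

      ∑-cliques : ∀ φ → (∀ x → isClique x ≡ false → φ x ≡ 0ℚ) → ∑ cliques (λ K → φ (proj₁ K)) ≡ ∑^ k φ
      ∑-cliques φ φ-nonclique = trans (∑-cliquesIn φ φ-nonclique (tuples k) (∈-tuples-length k)) (∑-tuples k φ)

  lookup-injective : ∀ {A : Set} {x : List A} → Unique x → ∀ i j → lookup x i ≡ lookup x j → i ≡ j
  lookup-injective (a∉ ∷ u) Fin.zero Fin.zero _ = refl
  lookup-injective (a∉ ∷ u) Fin.zero (Fin.suc j) e = ⊥-elim (All.lookup a∉ (∈-lookup j) e)
  lookup-injective (a∉ ∷ u) (Fin.suc i) Fin.zero e = ⊥-elim (All.lookup a∉ (∈-lookup i) (sym e))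
  lookup-injective (a∉ ∷ u) (Fin.suc i) (Fin.suc j) e = cong Fin.suc (lookup-injective u i j e)

  AllPairs-lookup : ∀ {A : Set} {R : A → A → Set} {L} → (∀ {a b} → R a b → R b a) → AllPairs R L →
    ∀ i j → i ≢ j → R (lookup L i) (lookup L j)
  AllPairs-lookup s (p ∷ ps) Fin.zero Fin.zero i≢j = ⊥-elim (i≢j refl)
  AllPairs-lookup s (p ∷ ps) Fin.zero (Fin.suc j) _ = All.lookup p (∈-lookup j)
  AllPairs-lookup s (p ∷ ps) (Fin.suc i) Fin.zero _ = s (All.lookup p (∈-lookup i))
  AllPairs-lookup s (p ∷ ps) (Fin.suc i) (Fin.suc j) i≢j = AllPairs-lookup s ps i j (i≢j ∘ cong Fin.suc)

  module Packing {n : ℕ} (G : Graph n) (k : ℕ) where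
    open Cliques G
    open EdgeLists G

    EdgeDisjoint : Clique k → Clique k → Set
    EdgeDisjoint K K′ = ∀ e → e ∈ edgesOf (proj₁ K) → e ∈ edgesOf (proj₁ K′) → ⊥

    vertex : Clique k → Fin k → Fin n
    vertex (x , _ , l) i = lookup x (Fin.cast (sym l) i)

    vertex-∈ : ∀ K i → vertex K i ∈ proj₁ K
    vertex-∈ (x , _ , l) i = ∈-lookup (Fin.cast (sym l) i)

    vertex-injective : ∀ K i j → vertex K i ≡ vertex K j → i ≡ j
    vertex-injective (x , cx , l) i j e = Finₚ.toℕ-injective (trans (sym (Finₚ.toℕ-cast (sym l) i))
      (trans (cong toℕ (lookup-injective {x = x} (clique-unique {x} cx) _ _ e)) (Finₚ.toℕ-cast (sym l) j)))

    -- Two vertices common to two copies, put in increasing order, form a common element of their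
    -- edge lists.
    packing : ∀ M → AllPairs EdgeDisjoint M → HasKkPacking k (length M) G
    packing M disjoint = (λ a → vertex (lookup M a)) , (λ a → vertex-injective (lookup M a) , λ i j i≢j →
        clique-pair (proj₁ (proj₂ (lookup M a))) (vertex-∈ (lookup M a) i) (vertex-∈ (lookup M a) j)
            (i≢j ∘ vertex-injective (lookup M a) i j)) ,
        apart
      where
      apart : ∀ a b → ¬ (a ≡ b) → ∀ i j i′ j′ → ¬ (i ≡ j) →
        vertex (lookup M a) i ≡ vertex (lookup M b) i′ → vertex (lookup M a) j ≡ vertex (lookup M b) j′ → ⊥
      apart a b a≢b i j i′ j′ i≢j e e′ with ℕₚ.<-cmp (toℕ (vertex (lookup M a) i)) (toℕ (vertex (lookup M a) j))
      ... | tri< u<v _ _ = dis _ (∈-edgesOf⁺ u<v (vertex-∈ (lookup M a) i) (vertex-∈ (lookup M a) j))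
                                  (∈-edgesOf⁺ u<v (subst (_∈ proj₁ (lookup M b)) (sym e) (vertex-∈ (lookup M b) i′))
                                      (subst (_∈ proj₁ (lookup M b)) (sym e′) (vertex-∈ (lookup M b) j′)))
        where dis = AllPairs-lookup {R = EdgeDisjoint} (λ d e p q → d e q p) disjoint a b a≢b
      ... | tri≈ _ u≡v _ = i≢j (vertex-injective (lookup M a) i j (Finₚ.toℕ-injective u≡v))
      ... | tri> _ _ v<u = dis _ (∈-edgesOf⁺ v<u (vertex-∈ (lookup M a) j) (vertex-∈ (lookup M a) i))
                                  (∈-edgesOf⁺ v<u (subst (_∈ proj₁ (lookup M b)) (sym e′) (vertex-∈ (lookup M b) j′))
                                      (subst (_∈ proj₁ (lookup M b)) (sym e) (vertex-∈ (lookup M b) i′)))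
        where dis = AllPairs-lookup {R = EdgeDisjoint} (λ d e p q → d e q p) disjoint a b a≢b

-- The hypergraph of cliques on the edges of G.

module CliqueEdges where

  open Arithmetic
  open RandomGreedy
  open SymmetricSums
  open CliqueCounts
  open FractionalDecomposition
  open EdgeSets

  choose₂ : ∀ l → suc l C 2 ≡ l ℕ.+ l C 2
  choose₂ l = trans (sym (nCk+nC[k+1]≡[n+1]C[k+1] l 1)) (cong (ℕ._+ l C 2) (nC1≡n l))

  module CliqueHypergraph {n : ℕ} (G : Graph n) (0<n : 0ℚ < ♯ n) (m-1 : ℕ) (ς : ℚ) (0≤ς : 0ℚ ≤ ς)
    (deg-≥ : ∀ v → ♯ n - ♯ n * ς ≤ ∑ (allFin n) (λ a → 𝟙 (adj G v a)))
    (dense : (1ℚ + 1ℚ) * (♯ (suc m-1) * ♯ (suc m-1)) * ♯ (2 ℕ.+ suc m-1) * (♯ (4 ℕ.+ suc m-1) * ς) ≤ 1ℚ) where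

    open Cliques G
    open EdgeLists G
    open Weights G 0<n m-1 ς 0≤ς deg-≥ dense

    private
      k : ℕ
      k = 3 ℕ.+ m-1

    _≟ᴱ_ : DecidableEquality (Fin n × Fin n)
    _≟ᴱ_ = Productₚ.≡-dec Finₚ._≟_ Finₚ._≟_

    module E = Membership _≟ᴱ_

    has : Fin n × Fin n → List (Fin n) → Bool
    has e x = e E.∈ᵇ edgesOf x

    has-≡ : ∀ {u v x} → Unique x → toℕ u ℕ.< toℕ v → has (u , v) x ≡ (u ∈ᵇ x) ∧ (v ∈ᵇ x)
    has-≡ {u} {v} {x} ux u<v with u ∈ᵇ x in u∈ | v ∈ᵇ x in v∈
    ... | true | true = E.∈⇒∈ᵇ {L = edgesOf x} (∈-edgesOf⁺ {x = x} u<v (∈ᵇ⇒∈ u∈) (∈ᵇ⇒∈ v∈))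
    ... | true | false = E.∉⇒∈ᵇ (λ e∈ → case trans (sym v∈) (∈⇒∈ᵇ (proj₂ (proj₂ (∈-edgesOf⁻ ux e∈)))) of λ ())
    ... | false | _ = E.∉⇒∈ᵇ (λ e∈ → case trans (sym u∈) (∈⇒∈ᵇ (proj₁ (proj₂ (∈-edgesOf⁻ ux e∈)))) of λ ())

    on-cliques : ∀ {f g : List (Fin n) → ℚ} x → (isClique x ≡ true → f x ≡ g x) → W x * f x ≡ W x * g x
    on-cliques {f} {g} x h = go (isClique x) refl
      where
      go : ∀ b → isClique x ≡ b → W x * f x ≡ W x * g x
      go true e = cong (W x *_) (h e)
      go false e = trans (vanish (f x)) (sym (vanish (g x)))
        where
        vanish : ∀ z → W x * z ≡ 0ℚ
        vanish z = trans (cong (_* z) (W-nonclique x e)) (*-zeroˡ z)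

    ∑-W : ∀ (f : List (Fin n) → ℚ) → ∑ (cliques k) (λ K → W (proj₁ K) * f (proj₁ K)) ≡ ∑^ k (λ x → W x * f x)
    ∑-W f = ∑-cliques k (λ x → W x * f x) (λ x e → trans (cong (_* f x) (W-nonclique x e)) (*-zeroˡ (f x)))

    degree : ∀ e → e ∈ edgeList → ∑ (cliques k) (λ K → W (proj₁ K) * 𝟙 (has e (proj₁ K))) ≡ 1ℚ
    degree (u , v) e∈ with ∈-edgeList⁻ e∈
    ... | u<v , uv = trans (∑-W (λ x → 𝟙 (has (u , v) x))) (trans
        (∑^-cong k (λ x _ → on-cliques {λ x → 𝟙 (has (u , v) x)} {λ x → 𝟙 (u ∈ᵇ x) * 𝟙 (v ∈ᵇ x)} x (λ cx →
        trans (cong 𝟙 (has-≡ {x = x} (clique-unique {x} cx) u<v)) (𝟙-∧ (u ∈ᵇ x) (v ∈ᵇ x))))) (W-degree u v uv))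

    κ₃-pos : 0ℚ < κ₃
    κ₃-pos = *-pos (*-pos (♯-pos m-1) (ℚₚ.<-≤-trans 0<1 (≤-+ʳ (+-nonneg
        (*-nonneg (+-nonneg 0≤1 0≤1) (*-nonneg (♯-nonneg k) (♯-nonneg k)))
      (*-nonneg (♯-nonneg (suc m-1)) (+-nonneg (♯-nonneg (suc m-1)) 0≤1)))))) (inv-pos 0<n)

    -- Two distinct edges span at least three vertices; this reduces codegrees of edges to the
    -- weight on vertex triples.
    third-vertex : ∀ {u v u′ v′ : Fin n} → toℕ u ℕ.< toℕ v → toℕ u′ ℕ.< toℕ v′ → (u , v) ≢ (u′ , v′) →
      ∃ λ t → u ≢ t × v ≢ t × (t ≡ u′ ⊎ t ≡ v′)
    third-vertex {u} {v} {u′} {v′} u<v u<v′ e≢ with u Finₚ.≟ u′ | v Finₚ.≟ u′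
    ... | yes refl | _ = v′ , (λ { refl → ℕₚ.<-irrefl refl u<v′ }) , (λ { refl → e≢ refl }) , inj₂ refl
    ... | no _ | yes refl = v′ , (λ { refl → ℕₚ.<-asym u<v u<v′ }) , (λ { refl → ℕₚ.<-irrefl refl u<v′ }) , inj₂ refl
    ... | no u≢ | no v≢ = u′ , u≢ , v≢ , inj₁ refl

    not-has : ∀ {u v} → ¬ toℕ u ℕ.< toℕ v → ∀ x → isClique x ≡ true → has (u , v) x ≡ false
    not-has u≮v x cx = E.∉⇒∈ᵇ (λ e∈ → u≮v (proj₁ (∈-edgesOf⁻ (clique-unique {x} cx) e∈)))

    -- The pairs e and e′ are arbitrary. One that is not increasing lies in the edge list of no
    -- clique, and the sum is then 0.
    codegree : ∀ e e′ → e ≢ e′ → ∑ (cliques k) (λ K → W (proj₁ K) * (𝟙 (has e (proj₁ K)) * 𝟙 (has e′ (proj₁ K)))) ≤ κ₃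
    codegree e@(u , v) e′@(u′ , v′) e≢ = ≤-trans (≤-reflexive (∑-W both)) bound
      where
      both : List (Fin n) → ℚ
      both x = 𝟙 (has e x) * 𝟙 (has e′ x)
      none : (∀ x → isClique x ≡ true → both x ≡ 0ℚ) → ∑^ k (λ x → W x * both x) ≤ κ₃
      none h = ≤-trans (≤-reflexive (trans (∑^-cong k (λ x _ → trans (on-cliques {both} {λ _ → 0ℚ} x (h x)) (*-zeroʳ (W x))))
        (trans (∑^-const k 0ℚ) (*-zeroʳ _)))) (ℚₚ.<⇒≤ κ₃-pos)
      bound : ∑^ k (λ x → W x * both x) ≤ κ₃
      bound with toℕ u ℕ.<? toℕ v | toℕ u′ ℕ.<? toℕ v′
      ... | no u≮v | _ = none (λ x cx → trans (cong (λ b → 𝟙 b * 𝟙 (has e′ x)) (not-has u≮v x cx)) (*-zeroˡ _))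
      ... | yes _ | no u≮v = none (λ x cx → trans (cong (λ b → 𝟙 (has e x) * 𝟙 b) (not-has u≮v x cx)) (*-zeroʳ _))
      ... | yes u<v | yes u<v′ with third-vertex u<v u<v′ e≢
      ... | t , u≢t , v≢t , t≡ = ≤-trans (∑^-mono k term) (W-codegree u v t (λ { refl → ℕₚ.<-irrefl refl u<v }) u≢t v≢t)
        where
        three : List (Fin n) → ℚ
        three x = 𝟙 (u ∈ᵇ x) * (𝟙 (v ∈ᵇ x) * 𝟙 (t ∈ᵇ x))
        three-nonneg : ∀ x → 0ℚ ≤ three x
        three-nonneg x = *-nonneg (𝟙-nonneg (u ∈ᵇ x)) (*-nonneg (𝟙-nonneg (v ∈ᵇ x)) (𝟙-nonneg (t ∈ᵇ x)))
        t∈ : ∀ {x} → t ≡ u′ ⊎ t ≡ v′ → u′ ∈ x → v′ ∈ x → t ∈ x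
        t∈ (inj₁ refl) u′∈ v′∈ = u′∈
        t∈ (inj₂ refl) u′∈ v′∈ = v′∈
        both≤three : ∀ x → isClique x ≡ true → both x ≤ three x
        both≤three x cx with has e x in e∈ | has e′ x in e∈′
        ... | false | _ = ≤-trans (≤-reflexive (*-zeroˡ _)) (three-nonneg x)
        ... | true | false = ≤-trans (≤-reflexive (*-zeroʳ _)) (three-nonneg x)
        ... | true | true with ∈-edgesOf⁻ (clique-unique {x} cx) (E.∈ᵇ⇒∈ {e} {edgesOf x} e∈) | ∈-edgesOf⁻
            (clique-unique {x} cx) (E.∈ᵇ⇒∈ {e′} {edgesOf x} e∈′)
        ... | _ , u∈ , v∈ | _ , u′∈ , v′∈ rewrite ∈⇒∈ᵇ u∈ | ∈⇒∈ᵇ v∈ | ∈⇒∈ᵇ (t∈ t≡ u′∈ v′∈) =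
            ≤-reflexive (cong (1ℚ *_) (sym (*-identityˡ 1ℚ)))
        term : ∀ x → length x ≡ k → W x * both x ≤ W x * three x
        term x l = go (isClique x) refl
          where
          go : ∀ b → isClique x ≡ b → W x * both x ≤ W x * three x
          go true cx = *-monoˡ (W-nonneg x l) (both≤three x cx)
          go false cx = ≤-reflexive (on-cliques {both} {three} x (λ cx′ → case trans (sym cx) cx′ of λ ()))

    hypergraph : WeightedHypergraph (Fin n × Fin n) (Clique k)
    hypergraph = record
      { _≟_ = _≟ᴱ_
      ; V = edgeList
      ; V-unique = edgeList-unique
      ; E = cliques k
      ; el = λ K → edgesOf (proj₁ K)
      ; el-unique = λ { (x , cx , _) → edgesOf-unique (clique-unique {x} cx) }
      ; el⊆V = λ { (x , cx , _) (u , v) e∈ → el⊆V cx (∈-edgesOf⁻ (clique-unique {x} cx) e∈) }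
      -- Chosen so that `choose₂` identifies `suc r-1` with the number C(k, 2) of edges of a
      -- k-clique.
      ; r-1 = suc m-1 ℕ.+ (2 ℕ.+ m-1) C 2
      ; el-length = λ { (x , _ , l) → trans (edgesOf-length x) (trans (cong (_C 2) l) (choose₂ (2 ℕ.+ m-1))) }
      ; w = λ K → W (proj₁ K)
      ; w-nonneg = λ { (x , _ , l) → W-nonneg x l }
      ; κ = κ₃
      ; κ-nonneg = ℚₚ.<⇒≤ κ₃-pos
      ; degree = degree
      ; codegree = codegree
      }
      where
      el⊆V : ∀ {x u v} → isClique x ≡ true → toℕ u ℕ.< toℕ v × u ∈ x × v ∈ x → (u , v) ∈ edgeList
      el⊆V {x} cx (u<v , u∈ , v∈) = ∈-edgeList⁺ u<v (clique-pair {x} cx u∈ v∈ (λ { refl → ℕₚ.<-irrefl refl u<v }))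

-- Choice of n₀ and conclusion.

module Assembly where

  open Arithmetic
  open RandomGreedy
  open NibbleLemma
  open SymmetricSums
  open CliqueCounts
  open EdgeSets
  open CliqueEdges

  -- The factor 4 combines the 2 in `dense` with the 2 in ς = 2 c₀. From m ≤ k and k + 2 ≤ 2k the
  -- left side is at most 8 k^4.
  dense-arith : ∀ m-1 → let k = 3 ℕ.+ m-1 in
    (suc m-1 ℕ.* suc m-1 ℕ.* k ℕ.* (5 ℕ.+ m-1)) ℕ.* 4 ℕ.≤ 9 ℕ.* k ℕ.^ 10
  dense-arith m-1 = begin
    (m ℕ.* m ℕ.* k ℕ.* (5 ℕ.+ m-1)) ℕ.* 4
      ≤⟨ ℕₚ.*-monoˡ-≤ 4 (ℕₚ.*-mono-≤ (ℕₚ.*-monoˡ-≤ k (ℕₚ.*-mono-≤ m≤k m≤k)) 2+k≤) ⟩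
    (k ℕ.* k ℕ.* k ℕ.* (2 ℕ.* k)) ℕ.* 4
      ≡⟨ eq k ⟩
    8 ℕ.* k ℕ.^ 4
      ≤⟨ ℕₚ.*-mono-≤ (ℕₚ.n≤1+n 8) (ℕₚ.^-monoʳ-≤ k (ℕₚ.m≤m+n 4 6)) ⟩
    9 ℕ.* k ℕ.^ 10 ∎
    where
    open ℕₚ.≤-Reasoning
    m k : ℕ
    m = suc m-1
    k = 3 ℕ.+ m-1
    m≤k : m ℕ.≤ k
    m≤k = ℕₚ.m≤n+m m 2
    2+k≤ : 5 ℕ.+ m-1 ℕ.≤ 2 ℕ.* k
    2+k≤ = ℕₚ.≤-trans (ℕₚ.+-monoˡ-≤ k {2} {k} (ℕ.s≤s (ℕ.s≤s ℕ.z≤n))) (ℕₚ.≤-reflexive (cong (k ℕ.+_) (sym (ℕₚ.+-identityʳ k))))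
    eq : ∀ k → (k ℕ.* k ℕ.* k ℕ.* (2 ℕ.* k)) ℕ.* 4 ≡ 8 ℕ.* (k ℕ.* (k ℕ.* (k ℕ.* (k ℕ.* 1))))
    eq = ℕSolver.solve-∀

  module Final (m-1 : ℕ) (c ε : ℚ) (c-small : c * ♯ (9 ℕ.* (3 ℕ.+ m-1) ℕ.^ 10) < 1ℚ) (0<ε : 0ℚ < ε) where

    private
      k r-1 q-1 : ℕ
      k = 3 ℕ.+ m-1
      r-1 = suc m-1 ℕ.+ (2 ℕ.+ m-1) C 2
      -- At least 3 / ε, so that the loss 3 / q of the nibble is at most ε.
      q-1 = proj₁ (archimedean ((1ℚ + 1ℚ + 1ℚ) * inv ε))

      c₀ ι codegreeBound : ℚ
      c₀ = inv (♯ (9 ℕ.* k ℕ.^ 10))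
      ι = inv (♯ (suc q-1))
      codegreeBound = ♯ (suc m-1) * (1ℚ + ((1ℚ + 1ℚ) * (♯ k * ♯ k) + ♯ (suc m-1) * (♯ (suc m-1) + 1ℚ)))

      n₁ : ℕ
      -- The codegree bound of the clique hypergraph is `codegreeBound` / n, so from n₁ on its
      -- product with `threshold` is at most 1.
      n₁ = proj₁ (archimedean (threshold r-1 q-1 * codegreeBound))

      0<9k : 0ℚ < ♯ (9 ℕ.* k ℕ.^ 10)
      0<9k = ≤-resp-pos (♯-mono (ℕₚ.*-mono-≤ {1} {9} {1} (ℕ.s≤s ℕ.z≤n) (ℕₚ.m^n>0 k 10)))
        where
        ≤-resp-pos : ∀ {x} → ♯ 1 ≤ x → 0ℚ < x
        ≤-resp-pos h = ℚₚ.<-≤-trans 0<1 (≤-resp ♯-1 refl h)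

      0≤c₀ : 0ℚ ≤ c₀
      0≤c₀ = inv-nonneg 0<9k

      c≤c₀ : c ≤ c₀
      c≤c₀ = *-cancelˡ 0<9k (≤-resp (*-comm c _) (sym (*-inv 0<9k)) (ℚₚ.<⇒≤ c-small))

      3ι≤ε : ι + ι + ι ≤ ε
      3ι≤ε = ≤-resp (eq ι) refl (*-cancelˡ (♯-pos q-1) (≤-resp (sym
          (trans (eq₂ (♯ (suc q-1)) ι) (trans (cong ((1ℚ + 1ℚ + 1ℚ) *_) (*-inv (♯-pos q-1))) (*-identityʳ _)))) refl
          (≤-trans (≤-reflexive (sym (trans (*-assoc _ (inv ε) ε)
              (trans (cong ((1ℚ + 1ℚ + 1ℚ) *_) (trans (*-comm (inv ε) ε) (*-inv 0<ε))) (*-identityʳ _)))))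
            (*-monoʳ (ℚₚ.<⇒≤ 0<ε) (≤-trans (proj₂ (archimedean ((1ℚ + 1ℚ + 1ℚ) * inv ε))) (♯-mono (ℕₚ.n≤1+n q-1)))))))
        where
        opaque
          unfolding _+_
          eq : ∀ i → (1ℚ + 1ℚ + 1ℚ) * i ≡ i + i + i
          eq = solve-∀ ℚ-ring
          eq₂ : ∀ q i → q * ((1ℚ + 1ℚ + 1ℚ) * i) ≡ (1ℚ + 1ℚ + 1ℚ) * (q * i)
          eq₂ = solve-∀ ℚ-ring

    -- The summand 9 k^10 ensures c₀ n ≥ 1, the summand `n₁` the codegree condition, and `suc`
    -- excludes the empty graph.
    n₀ : ℕ
    n₀ = suc (9 ℕ.* k ℕ.^ 10 ℕ.+ n₁)

    module _ (n-1 : ℕ) (n≥ : n₀ ℕ.≤ suc n-1) (G : Graph (suc n-1))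
      (min-degree : ∀ v → (1ℚ - c) * ♯ n-1 ≤ ♯ (deg G v)) where

      private
        n : ℕ
        n = suc n-1
        ν ς : ℚ
        ν = ♯ n
        -- One c₀ accounts for c ≤ c₀, the other, through c₀ n ≥ 1, for passing from n - 1 to n in
        -- the degree condition.
        ς = c₀ + c₀

        0<ν : 0ℚ < ν
        0<ν = ♯-pos n-1

        9k≤n : 9 ℕ.* k ℕ.^ 10 ℕ.≤ n
        9k≤n = ℕₚ.≤-trans (ℕₚ.≤-trans (ℕₚ.m≤m+n (9 ℕ.* k ℕ.^ 10) n₁) (ℕₚ.n≤1+n _)) n≥

        1≤c₀ν : 1ℚ ≤ c₀ * ν
        1≤c₀ν = ≤-resp (trans (*-comm c₀ _) (*-inv 0<9k)) refl (*-monoˡ 0≤c₀ (♯-mono 9k≤n))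

        deg-≥ : ∀ v → ν - ν * ς ≤ ∑ (allFin n) (λ a → 𝟙 (adj G v a))
        deg-≥ v = ≤-trans (≤-cert (+-nonneg (+-nonneg (*-nonneg (sub-nonneg c≤c₀) (♯-nonneg n-1)) (sub-nonneg 1≤c₀ν)) 0≤c₀)
              (trans (eq c c₀ (♯ n-1)) (cong (λ z → z - z * ς + ((c₀ - c) * ♯ n-1 + (c₀ * z - 1ℚ) + c₀)) (sym (♯-suc n-1)))))
            (≤-trans (min-degree v) (≤-reflexive (EdgeLists.♯-count G (adj G v))))
          where
          opaque
            unfolding _+_
            eq : ∀ c c₀ p → (1ℚ - c) * p ≡ (1ℚ + p) - (1ℚ + p) * (c₀ + c₀) + ((c₀ - c) * p + (c₀ * (1ℚ + p) - 1ℚ) + c₀)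
            eq = solve-∀ ℚ-ring

        dense : (1ℚ + 1ℚ) * (♯ (suc m-1) * ♯ (suc m-1)) * ♯ k * (♯ (5 ℕ.+ m-1) * ς) ≤ 1ℚ
        dense = begin
          (1ℚ + 1ℚ) * (♯ m * ♯ m) * ♯ k * (♯ (5 ℕ.+ m-1) * (c₀ + c₀))
            ≡⟨ eq (♯ m) (♯ k) (♯ (5 ℕ.+ m-1)) c₀ ⟩
          ♯ m * ♯ m * ♯ k * ♯ (5 ℕ.+ m-1) * (1ℚ + (1ℚ + (1ℚ + 1ℚ))) * c₀
            ≡⟨ cong (_* c₀) (sym (trans (♯-* (m ℕ.* m ℕ.* k ℕ.* (5 ℕ.+ m-1)) 4)
                (cong₂ _*_ (trans (♯-* (m ℕ.* m ℕ.* k) (5 ℕ.+ m-1))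
                 (cong (_* ♯ (5 ℕ.+ m-1)) (trans (♯-* (m ℕ.* m) k) (cong (_* ♯ k) (♯-* m m))))) ♯-4))) ⟩
          ♯ ((m ℕ.* m ℕ.* k ℕ.* (5 ℕ.+ m-1)) ℕ.* 4) * c₀
            ≤⟨ *-monoʳ 0≤c₀ (♯-mono (dense-arith m-1)) ⟩
          ♯ (9 ℕ.* k ℕ.^ 10) * c₀
            ≡⟨ *-inv 0<9k ⟩
          1ℚ ∎
          where
          open ℚₚ.≤-Reasoning
          m : ℕ
          m = suc m-1
          ♯-4 : ♯ 4 ≡ 1ℚ + (1ℚ + (1ℚ + 1ℚ))
          ♯-4 = trans (♯-suc 3) (cong (1ℚ +_) (trans (♯-suc 2) (cong (1ℚ +_) (trans (♯-suc 1) (cong (1ℚ +_) ♯-1)))))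
          opaque
            unfolding _+_
            eq : ∀ m k l c → (1ℚ + 1ℚ) * (m * m) * k * (l * (c + c)) ≡ m * m * k * l * (1ℚ + (1ℚ + (1ℚ + 1ℚ))) * c
            eq = solve-∀ ℚ-ring

        0≤ς : 0ℚ ≤ ς
        0≤ς = +-nonneg 0≤c₀ 0≤c₀

        open CliqueHypergraph G 0<ν m-1 ς 0≤ς deg-≥ dense using (hypergraph; κ₃-pos)
        open EdgeLists G using (edgeList; Clique; ♯-edges)
        open Packing G k using (EdgeDisjoint; packing)

        small : threshold r-1 q-1 * (codegreeBound * inv ν) ≤ 1ℚ
        small = ≤-trans (≤-reflexive (sym (*-assoc _ codegreeBound (inv ν))))
          (≤-trans (*-monoʳ (inv-nonneg 0<ν) (≤-trans (proj₂ (archimedean (threshold r-1 q-1 * codegreeBound)))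
            (♯-mono (ℕₚ.≤-trans (ℕₚ.≤-trans (ℕₚ.m≤n+m n₁ (9 ℕ.* k ℕ.^ 10)) (ℕₚ.n≤1+n _)) n≥))))
          (≤-reflexive (*-inv 0<ν)))

        result : ∃ λ M → AllPairs EdgeDisjoint M × (1ℚ - (ι + ι + ι)) * ♯ (length edgeList) ≤ ♯ (suc r-1) * ♯ (length M)
        result = NibbleTheorem.nibble hypergraph q-1 κ₃-pos small

      near-decomposition : ∃ λ m → HasKkPacking k m G × ((1ℚ - ε) * ♯ (edges G) ≤ ♯ m * ♯ (k C 2))
      near-decomposition = length M , packing M (proj₁ (proj₂ result)) , (begin
          (1ℚ - ε) * ♯ (edges G)                    ≤⟨ *-monoʳ (♯-nonneg (edges G)) (sub-mono ≤-refl 3ι≤ε) ⟩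
          (1ℚ - (ι + ι + ι)) * ♯ (edges G)          ≡⟨ cong ((1ℚ - (ι + ι + ι)) *_) ♯-edges ⟩
          (1ℚ - (ι + ι + ι)) * ♯ (length edgeList)  ≤⟨ proj₂ (proj₂ result) ⟩
          ♯ (suc r-1) * ♯ (length M)                ≡⟨ *-comm _ _ ⟩
          ♯ (length M) * ♯ (suc r-1)                ≡⟨ cong (λ z → ♯ (length M) * ♯ z) (sym (choose₂ (2 ℕ.+ m-1))) ⟩
          ♯ (length M) * ♯ (k C 2)                  ∎)
        where
        open ℚₚ.≤-Reasoning
        M : List (Clique k)
        M = proj₁ result

  private
    core : ∀ m-1 c → c * ♯ (9 ℕ.* (3 ℕ.+ m-1) ℕ.^ 10) < 1ℚ → ∀ ε → 0ℚ < ε →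
      Σ ℕ λ n₀ → (n : ℕ) → n ℕ.≥ n₀ → (G : Graph n) →
        ((v : Fin n) → (1ℚ - c) * ♯ (n ℕ.∸ 1) ≤ ♯ (deg G v)) →
        ∃ λ m → HasKkPacking (3 ℕ.+ m-1) m G × ((1ℚ - ε) * ♯ (edges G) ≤ ♯ m * ♯ ((3 ℕ.+ m-1) C 2))
    core m-1 c c-small ε 0<ε = Final.n₀ m-1 c ε c-small 0<ε ,
      λ { (suc n-1) n≥ G min-degree → Final.near-decomposition m-1 c ε c-small 0<ε n-1 n≥ G min-degree }

  opaque
    unfolding _+_ ♯

    -- In this block the opaque copies unfold, so the result proved with them is definitionally one
    -- about the operations of ℚ itself.
    cliquePackings : ∀ m-1 c → c ℚ.* ℕ→ℚ (9 ℕ.* (3 ℕ.+ m-1) ℕ.^ 10) < 1ℚ → ∀ ε → 0ℚ < ε →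
      Σ ℕ λ n₀ → (n : ℕ) → n ℕ.≥ n₀ → (G : Graph n) →
        ((v : Fin n) → (1ℚ ℚ.- c) ℚ.* ℕ→ℚ (n ℕ.∸ 1) ≤ ℕ→ℚ (deg G v)) →
        ∃ λ m → HasKkPacking (3 ℕ.+ m-1) m G × ((1ℚ ℚ.- ε) ℚ.* ℕ→ℚ (edges G) ≤ ℕ→ℚ m ℚ.* ℕ→ℚ ((3 ℕ.+ m-1) C 2))
    cliquePackings = core

open import Data.Nat using (_≥_; _∸_; _^_)
open import Data.Rational using (_*_; _-_)

theorem1p1 : (k : ℕ) → k ≥ 3 →
    (c : ℚ) → c * ℕ→ℚ (9 ℕ.* k ^ 10) < 1ℚ →
    (ε : ℚ) → 0ℚ < ε →
    Σ ℕ λ n₀ → (n : ℕ) → n ≥ n₀ → (G : Graph n) →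
    ((v : Fin n) → (1ℚ - c) * ℕ→ℚ (n ∸ 1) ≤ ℕ→ℚ (deg G v)) →
    ∃ λ m → HasKkPacking k m G × ((1ℚ - ε) * ℕ→ℚ (edges G) ≤ ℕ→ℚ m * ℕ→ℚ (k C 2))
theorem1p1 0 ()
theorem1p1 1 (ℕ.s≤s ())
theorem1p1 2 (ℕ.s≤s (ℕ.s≤s ()))
theorem1p1 (suc (suc (suc m-1))) _ = Assembly.cliquePackings m-1
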